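{- There exists a polynomial time semi-streaming algorithm for maximizing a non-negative submodular function $f$ subject to a cardinality constraint that assumes value oracle access to the multilinear extension $F$ of $f$ and has an approximation ratio of at most $4.2819$. This algorithm stores at most $O(k\log k)$ elements.
   Context: Problem: given a finite ground set $N$, a non-negative submodular function $f\colon 2^N\to\mathbb{R}_{\ge 0}$ and a positive integer $k$, find $S\subseteq N$ with $|S|\le k$ maximizing $f(S)$; $OPT$ denotes an optimal solution. The multilinear extension of $f$ is $F(x)=\mathbb{E}[f(R(x))]=\sum_{A\subseteq N} f(A)\prod_{u\in A}x_u\prod_{u\notin A}(1-x_u)$ for $x\in[0,1]^N$, where $R(x)$ is a random set containing each $u$ independently with probability $x_u$; a value oracle for $F$ returns $F(x)$ for a given $x$. A (possibly randomized) algorithm has approximation ratio $\beta$ if its output $S$ is always feasible and $\mathbb{E}[f(S)]\ge f(OPT)/\beta$. In the data stream model the elements of $N$ arrive one at a time in an arbitrary order and are processed in a single pass; a semi-streaming algorithm uses memory $O(k\cdot\mathrm{polylog}(k,|N|))$. -}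

module Defs where

open import Algebra.Bundles using (CommutativeRing)
open import Data.Bool using (Bool; true; false; if_then_else_; _∧_; not)
open import Data.Fin using (Fin; zero)
open import Data.Fin.Properties using () renaming (_≟_ to _≟ᶠ_)
open import Data.Fin.Subset using (Subset; inside; outside; _∪_; _∩_; ⁅_⁆; ⋃; ∣_∣)
open import Data.List using (List; []; _∷_; _++_; map; foldr; length; head; drop; concatMap; null; allFin)
open import Data.List.Relation.Binary.Permutation.Propositional using (_↭_)
open import Data.List.Relation.Unary.All using (All; all?)
open import Data.Maybe using (Maybe; just; nothing; maybe; fromMaybe; zip; zipWith; _>>=_)
open import Data.Nat using (ℕ; zero; suc; NonZero)
open import Data.Nat.ListAction using (sum)
open import Data.Nat.Logarithm using (⌈log₂_⌉)
open import Data.Product using (_×_; _,_; ∃-syntax)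
open import Data.Vec using (Vec; []; _∷_; lookup; replicate; toList; _[_]%=_)
open import Level using (_⊔_) renaming (suc to lsuc)
open import Relation.Binary.PropositionalEquality using (_≡_)
open import Relation.Binary.Structures using (IsDecTotalOrder)
open import Relation.Nullary using (¬_)
open import Relation.Nullary.Decidable using (⌊_⌋; _×-dec_)

import Data.List as List
import Data.Nat as ℕ

-- Scalars.  The real numbers form such a field by classical logic; the order
-- is decidable because algorithms in the value oracle model compare values.
-- 0# ⁻¹ is unconstrained.
record OrderedField c ℓ₁ ℓ₂ : Set (lsuc (c ⊔ ℓ₁ ⊔ ℓ₂)) where
  infix 4 _≤_ _<_
  infix 8 _⁻¹
  field
    commutativeRing : CommutativeRing c ℓ₁
  open CommutativeRing commutativeRing public
  field
    _≤_             : Carrier → Carrier → Set ℓ₂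
    isDecTotalOrder : IsDecTotalOrder _≈_ _≤_
    _⁻¹             : Carrier → Carrier
    0≉1             : ¬ (0# ≈ 1#)
    ⁻¹-cong         : ∀ {x y} → x ≈ y → x ⁻¹ ≈ y ⁻¹
    ⁻¹-inverse      : ∀ x → ¬ (x ≈ 0#) → x * x ⁻¹ ≈ 1#
    +-monoʳ-≤       : ∀ x {y z} → y ≤ z → x + y ≤ x + z
    *-nonNeg        : ∀ {x y} → 0# ≤ x → 0# ≤ y → 0# ≤ x * y
  open IsDecTotalOrder isDecTotalOrder public using (_≟_; _≤?_)

  _<_ : Carrier → Carrier → Set ℓ₂
  x < y = ¬ (y ≤ x)

  fromℕ : ℕ → Carrier
  fromℕ zero    = 0#
  fromℕ (suc n) = 1# + fromℕ n

------------------------------------------------------------------------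
-- Streaming algorithms are programs of a random access machine whose
-- memory consists of finitely many growable arrays, each holding naturals,
-- scalars or ground set elements.  A program is fixed for all inputs and
-- contains only natural number constants.  Elements are opaque: they can be
-- copied, compared for equality and used in oracle queries, but not turned
-- into numbers, so information about them cannot be kept without storing
-- them.

data Sort : Set where
  nat real elem : Sort

module Syntax (m : ℕ) where

  Array : Sort → Set
  Array _ = Fin (suc m)

  infix  8 ⟨_⟩_
  infixl 7 _⊗_ _*ʳ_
  infixl 6 _⊕_ _⊖_ _+ʳ_ _-ʳ_
  infix  4 _≤ⁿ_ _≤ʳ_ _≡ᵉ_
  infixr 3 _&_
  infixr 1 _⨾_

  -- ⟨ a ⟩ i is the i-th entry of array a, counted from the entry pushed last.
  data Exp : Sort → Set where
    ⟨_⟩_          : ∀ {s} → Array s → Exp nat → Exp s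
    len           : ∀ s → Array s → Exp nat
    lit           : ℕ → Exp nat
    _⊕_ _⊖_ _⊗_   : Exp nat → Exp nat → Exp nat
    real          : Exp nat → Exp real
    _+ʳ_ _-ʳ_ _*ʳ_ : Exp real → Exp real → Exp real
    inv           : Exp real → Exp real

  data Test : Set where
    _≤ⁿ_ : Exp nat → Exp nat → Test
    _≤ʳ_ : Exp real → Exp real → Test
    _≡ᵉ_ : Exp elem → Exp elem → Test
    more : Test                      -- the stream is not exhausted
    neg  : Test → Test
    _&_  : Test → Test → Test

  data Cmd : Set where
    skip  : Cmd
    _⨾_   : Cmd → Cmd → Cmd
    cond  : Test → Cmd → Cmd → Cmd
    while : Test → Cmd → Cmd
    push  : ∀ s → Array s → Exp s → Cmd
    pop   : ∀ s → Array s → Cmd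
    set   : ∀ s → Array s → Exp nat → Exp s → Cmd
    -- move the next stream element to the given array
    read  : Array elem → Cmd
    -- query r a p pushes F(x) on r, where x assigns to the elements listed in
    -- a the values at the same positions of p, and 0 to all other elements
    query : Array real → Array elem → Array real → Cmd
    -- flip a p pushes 1 on a with probability p and 0 otherwise
    flip  : Array nat → Exp real → Cmd

record Algorithm : Set where
  field
    arrays  : ℕ
    program : Syntax.Cmd arrays

subsets : ∀ n → List (Subset n)
subsets zero    = [] ∷ []
subsets (suc n) = map (outside ∷_) (subsets n) ++ map (inside ∷_) (subsets n)

setAt : ∀ {a} {A : Set a} → ℕ → A → List A → List A
setAt _       _ []       = []
setAt zero    y (_ ∷ xs) = y ∷ xs
setAt (suc i) y (x ∷ xs) = x ∷ setAt i y xs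

module Streaming {c ℓ₁ ℓ₂} (𝕂 : OrderedField c ℓ₁ ℓ₂) where
  open OrderedField 𝕂 hiding (zero)

  Σ[_] : List Carrier → Carrier
  Σ[_] = foldr _+_ 0#

  Π[_] : List Carrier → Carrier
  Π[_] = foldr _*_ 1#

  NonNegative : ∀ {n} → (Subset n → Carrier) → Set ℓ₂
  NonNegative f = ∀ A → 0# ≤ f A

  Submodular : ∀ {n} → (Subset n → Carrier) → Set ℓ₂
  Submodular f = ∀ A B → f (A ∪ B) + f (A ∩ B) ≤ f A + f B

  multilinear : ∀ {n} → (Subset n → Carrier) → (Fin n → Carrier) → Carrier
  multilinear {n} f x =
    Σ[ map (λ A → f A * Π[ map (λ u → if lookup A u then x u else 1# - x u) (allFin n) ]) (subsets n) ]

  -- The ground set is Fin n; order is its arrival order.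
  record Instance : Set (c ⊔ ℓ₂) where
    field
      n           : ℕ
      f           : Subset n → Carrier
      nonNegative : NonNegative f
      submodular  : Submodular f
      k           : ℕ
      k≢0         : NonZero k
      order       : List (Fin n)
      order-↭     : order ↭ allFin n

    Feasible : Subset n → Set
    Feasible S = ∣ S ∣ ℕ.≤ k

    Optimal : Subset n → Set ℓ₂
    Optimal O = Feasible O × (∀ S → Feasible S → f S ≤ f O)

  -- Finite probability distributions as lists of weighted outcomes.
  Dist : ∀ {a} → Set a → Set (c ⊔ a)
  Dist A = List (Carrier × A)

  return : ∀ {a} {A : Set a} → A → Dist A
  return x = (1# , x) ∷ []

  bind : ∀ {a b} {A : Set a} {B : Set b} → Dist A → (A → Dist B) → Dist B
  bind d g = concatMap (λ (p , x) → map (λ (q , y) → p * q , y) (g x)) d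

  expect : ∀ {a} {A : Set a} → (A → Carrier) → Dist A → Carrier
  expect g d = Σ[ map (λ (p , x) → p * g x) d ]

  Surely : ∀ {a ℓ} {A : Set a} → (A → Set ℓ) → Dist A → Set (c ⊔ a ⊔ ℓ)
  Surely P = All (λ (_ , x) → P x)

  module Run (m : ℕ) (I : Instance) where
    open Instance I
    open Syntax m

    record State : Set c where
      constructor state
      field
        stream : List (Fin n)
        nats   : Vec (List ℕ) (suc m)
        reals  : Vec (List Carrier) (suc m)
        elems  : Vec (List (Fin n)) (suc m)
    open State public

    ⟦_⟧ⁿ : Exp nat → State → Maybe ℕ
    ⟦ ⟨ a ⟩ i   ⟧ⁿ σ = ⟦ i ⟧ⁿ σ >>= λ j → head (drop j (lookup (nats σ) a))
    ⟦ len nat a  ⟧ⁿ σ = just (length (lookup (nats σ) a))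
    ⟦ len real a ⟧ⁿ σ = just (length (lookup (reals σ) a))
    ⟦ len elem a ⟧ⁿ σ = just (length (lookup (elems σ) a))
    ⟦ lit i      ⟧ⁿ σ = just i
    ⟦ d ⊕ e      ⟧ⁿ σ = zipWith ℕ._+_ (⟦ d ⟧ⁿ σ) (⟦ e ⟧ⁿ σ)
    ⟦ d ⊖ e      ⟧ⁿ σ = zipWith ℕ._∸_ (⟦ d ⟧ⁿ σ) (⟦ e ⟧ⁿ σ)
    ⟦ d ⊗ e      ⟧ⁿ σ = zipWith ℕ._*_ (⟦ d ⟧ⁿ σ) (⟦ e ⟧ⁿ σ)

    ⟦_⟧ʳ : Exp real → State → Maybe Carrier
    ⟦ ⟨ a ⟩ i ⟧ʳ σ = ⟦ i ⟧ⁿ σ >>= λ j → head (drop j (lookup (reals σ) a))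
    ⟦ real e  ⟧ʳ σ = ⟦ e ⟧ⁿ σ >>= λ j → just (fromℕ j)
    ⟦ d +ʳ e  ⟧ʳ σ = zipWith _+_ (⟦ d ⟧ʳ σ) (⟦ e ⟧ʳ σ)
    ⟦ d -ʳ e  ⟧ʳ σ = zipWith _-_ (⟦ d ⟧ʳ σ) (⟦ e ⟧ʳ σ)
    ⟦ d *ʳ e  ⟧ʳ σ = zipWith _*_ (⟦ d ⟧ʳ σ) (⟦ e ⟧ʳ σ)
    ⟦ inv e   ⟧ʳ σ = ⟦ e ⟧ʳ σ >>= λ x → if ⌊ x ≟ 0# ⌋ then nothing else just (x ⁻¹)

    ⟦_⟧ᵉ : Exp elem → State → Maybe (Fin n)
    ⟦ ⟨ a ⟩ i ⟧ᵉ σ = ⟦ i ⟧ⁿ σ >>= λ j → head (drop j (lookup (elems σ) a))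

    -- A comparison with an undefined side is false.
    ⟦_⟧ᵗ : Test → State → Bool
    ⟦ d ≤ⁿ e ⟧ᵗ σ = fromMaybe false (zipWith (λ i j → ⌊ i ℕ.≤? j ⌋) (⟦ d ⟧ⁿ σ) (⟦ e ⟧ⁿ σ))
    ⟦ d ≤ʳ e ⟧ᵗ σ = fromMaybe false (zipWith (λ x y → ⌊ x ≤? y ⌋) (⟦ d ⟧ʳ σ) (⟦ e ⟧ʳ σ))
    ⟦ d ≡ᵉ e ⟧ᵗ σ = fromMaybe false (zipWith (λ u v → ⌊ u ≟ᶠ v ⌋) (⟦ d ⟧ᵉ σ) (⟦ e ⟧ᵉ σ))
    ⟦ more   ⟧ᵗ σ = not (null (stream σ))
    ⟦ neg b  ⟧ᵗ σ = not (⟦ b ⟧ᵗ σ)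
    ⟦ b & b′ ⟧ᵗ σ = ⟦ b ⟧ᵗ σ ∧ ⟦ b′ ⟧ᵗ σ

    -- If an element is listed repeatedly, its first occurrence counts.
    point : List (Fin n × Carrier) → Fin n → Carrier
    point []             u = 0#
    point ((v , x) ∷ vs) u = if ⌊ u ≟ᶠ v ⌋ then x else point vs u

    -- The oracle answers only for points of the unit cube.
    oracle : List (Fin n × Carrier) → Maybe Carrier
    oracle vs =
      if ⌊ all? (λ (_ , x) → 0# ≤? x ×-dec x ≤? 1#) vs ⌋
      then just (multilinear f (point vs))
      else nothing

    pushⁿ : Array nat → ℕ → State → State
    pushⁿ a i σ = record σ { nats = nats σ [ a ]%= (i ∷_) }

    pushʳ : Array real → Carrier → State → State
    pushʳ a x σ = record σ { reals = reals σ [ a ]%= (x ∷_) }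

    pushᵉ : Array elem → Fin n → State → State
    pushᵉ a u σ = record σ { elems = elems σ [ a ]%= (u ∷_) }

    -- Commands with an undefined argument have no effect.
    when : ∀ {a} {A : Set a} → Maybe A → (A → State) → State → State
    when v g σ = maybe g σ v

    -- The commands on the control stack are executed from the head; the
    -- machine has halted once the stack is empty.
    Config : Set c
    Config = List Cmd × State

    Halted : Config → Set
    Halted (cs , _) = cs ≡ []

    step : Config → Dist Config
    step ([]                  , σ) = return ([] , σ)
    step (skip ∷ cs           , σ) = return (cs , σ)
    step ((p ⨾ q) ∷ cs        , σ) = return (p ∷ q ∷ cs , σ)
    step (cond b p q ∷ cs     , σ) = return ((if ⟦ b ⟧ᵗ σ then p else q) ∷ cs , σ)
    step (while b p ∷ cs      , σ) = return ((if ⟦ b ⟧ᵗ σ then p ∷ while b p ∷ cs else cs) , σ)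
    step (push nat a e ∷ cs   , σ) = return (cs , when (⟦ e ⟧ⁿ σ) (λ v → pushⁿ a v σ) σ)
    step (push real a e ∷ cs  , σ) = return (cs , when (⟦ e ⟧ʳ σ) (λ v → pushʳ a v σ) σ)
    step (push elem a e ∷ cs  , σ) = return (cs , when (⟦ e ⟧ᵉ σ) (λ v → pushᵉ a v σ) σ)
    step (pop nat a ∷ cs      , σ) = return (cs , record σ { nats = nats σ [ a ]%= drop 1 })
    step (pop real a ∷ cs     , σ) = return (cs , record σ { reals = reals σ [ a ]%= drop 1 })
    step (pop elem a ∷ cs     , σ) = return (cs , record σ { elems = elems σ [ a ]%= drop 1 })
    step (set nat a i e ∷ cs  , σ) = return (cs , when (zip (⟦ i ⟧ⁿ σ) (⟦ e ⟧ⁿ σ))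
      (λ (j , v) → record σ { nats = nats σ [ a ]%= setAt j v }) σ)
    step (set real a i e ∷ cs , σ) = return (cs , when (zip (⟦ i ⟧ⁿ σ) (⟦ e ⟧ʳ σ))
      (λ (j , v) → record σ { reals = reals σ [ a ]%= setAt j v }) σ)
    step (set elem a i e ∷ cs , σ) = return (cs , when (zip (⟦ i ⟧ⁿ σ) (⟦ e ⟧ᵉ σ))
      (λ (j , v) → record σ { elems = elems σ [ a ]%= setAt j v }) σ)
    step (read a ∷ cs         , σ) = return (cs , when (head (stream σ))
      (λ u → pushᵉ a u (record σ { stream = drop 1 (stream σ) })) σ)
    step (query r a p ∷ cs    , σ) = return (cs , when (oracle (List.zip (lookup (elems σ) a) (lookup (reals σ) p)))
      (λ v → pushʳ r v σ) σ)
    step (flip a e ∷ cs       , σ) = maybe toss (return (cs , σ)) (⟦ e ⟧ʳ σ)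
      where
      -- Only outcomes of positive probability are listed.
      toss : Carrier → Dist Config
      toss p =
        if ⌊ p ≤? 0# ⌋ then return (cs , pushⁿ a 0 σ) else
        if ⌊ 1# ≤? p ⌋ then return (cs , pushⁿ a 1 σ) else
        (p , cs , pushⁿ a 1 σ) ∷ (1# - p , cs , pushⁿ a 0 σ) ∷ []

    steps : ℕ → Config → Dist Config
    steps zero    γ = return γ
    steps (suc t) γ = bind (step γ) (steps t)

    -- The only input besides the stream is k; n is not given in advance.
    initial : State
    initial = state order ((k ∷ []) ∷ replicate m []) (replicate (suc m) []) (replicate (suc m) [])

    -- The solution is returned in elements array 0.
    output : Config → Subset n
    output (_ , σ) = ⋃ (map ⁅_⁆ (lookup (elems σ) zero))

    storedElements : Config → ℕ
    storedElements (_ , σ) = sum (map length (toList (elems σ)))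

    -- Naturals and elements take space according to their bit length, scalars
    -- take one cell.  The control stack has constant size for a fixed program.
    -- The unread part of the stream is not part of the memory.
    memory : Config → ℕ
    memory γ@(_ , σ) =
      sum (map (λ is → sum (map (λ i → 1 ℕ.+ ⌈log₂ suc i ⌉) is)) (toList (nats σ)))
      ℕ.+ sum (map length (toList (reals σ)))
      ℕ.+ storedElements γ ℕ.* (1 ℕ.+ ⌈log₂ suc n ⌉)

  module _ (alg : Algorithm) where
    open Algorithm alg

    private
      module R (I : Instance) = Run arrays I

    -- The machine after t steps.  Each command, and each test of a loop
    -- condition, is one step.
    after : (I : Instance) → ℕ → Dist (R.Config I)
    after I t = R.steps I t (program ∷ [] , R.initial I)

    -- Polynomial in |N| and the bit length of k.
    PolynomialTime : Set (c ⊔ ℓ₂)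
    PolynomialTime = ∃[ C ] ∃[ d ] ∀ (I : Instance) → let open Instance I in
      Surely (R.Halted I) (after I (C ℕ.* (1 ℕ.+ n ℕ.+ ⌈log₂ suc k ⌉) ℕ.^ d))

    -- ⌈log₂ suc k ⌉ instead of log k makes the bound positive for k = 1.
    SemiStreaming : Set (c ⊔ ℓ₂)
    SemiStreaming = ∃[ C ] ∃[ d ] ∀ (I : Instance) t → let open Instance I in
      Surely (λ γ → R.memory I γ ℕ.≤ C ℕ.* (k ℕ.* (⌈log₂ suc k ⌉ ℕ.+ ⌈log₂ suc n ⌉) ℕ.^ d)) (after I t)

    Stores-O[klogk]-Elements : Set (c ⊔ ℓ₂)
    Stores-O[klogk]-Elements = ∃[ C ] ∀ (I : Instance) t → let open Instance I in
      Surely (λ γ → R.storedElements I γ ℕ.≤ C ℕ.* (k ℕ.* ⌈log₂ suc k ⌉)) (after I t)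

    -- The output is defined once all runs have halted; that this happens is
    -- not part of this property.
    ApproximationRatio : Carrier → Set (c ⊔ ℓ₂)
    ApproximationRatio β = ∀ (I : Instance) t → let open Instance I in
      Surely (R.Halted I) (after I t) →
      Surely (λ γ → Feasible (R.output I γ)) (after I t) ×
      (∀ OPT → Optimal OPT → f OPT * β ⁻¹ ≤ expect (λ γ → f (R.output I γ)) (after I t))

{-# OPTIONS --safe #-}
module Submission where

-- The algorithm keeps the best set found so far and, for geometrically
-- spaced thresholds, groups of w disjoint sets; an arriving element joins the
-- first set of each group in which its marginal value reaches the threshold.
-- Groups whose threshold lies below the best value (divided by k) are dropped,
-- so that only O(log k) groups are alive and no set ever exceeds k elements.
-- After the stream, random greedy is run on the elements of the lowest group.
--
-- Let b be the best value, τ / k the threshold of the lowest group, S₁, …, S_w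
-- its sets, and split an optimal solution O into the part O₁ contained in the
-- group and the rest O₂, which consists of elements rejected by every Sᵢ.
-- Since the Sᵢ are disjoint, the average of f(O ∪ Sᵢ) is at least
-- (1 − 1/w) f(O), while rejection gives f(O ∪ Sᵢ) ≤ f(O₁ ∪ Sᵢ) + |O₂| τ / k and
-- f(O ∪ Sᵢ) ≤ f(O₁) + b + |O₂| τ / k.  Choosing O₁ ∪ Sᵢ with probability
-- |O₂| / k and O₁ otherwise yields a random set of expected size at most k and
-- expected value at least (1 − 1/w) f(O) − max(b, τ), and random greedy obtains
-- a third of this.  Together with τ ≤ (1 + 1/w) b the ratio is
-- 4 (w + 1) / (w − 1), which is 132/31 < 4.2819 for w = 32.

open import Data.Bool using (true; false; if_then_else_; _∧_)
open import Data.Empty using (⊥)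
open import Data.Fin using (Fin; zero; suc)
open import Data.Fin.Patterns using (0F; 1F; 2F; 3F; 4F; 5F; 6F)
open import Data.Fin.Subset using (Subset; inside; outside; ⋃; ⁅_⁆; _∪_; _∩_; ∣_∣) renaming (_∈_ to _∈ˢ_)
open import Data.Fin.Subset.Properties using (x∈⁅x⁆; x∈⁅y⁆⇒x≡y; x∈p∪q⁺; x∈p∪q⁻; x∈p∩q⁺; x∈p∩q⁻; ∉⊥; ⊆-antisym)
open import Data.List using (List; []; _∷_; _++_; map; length; filter; concat; drop; head; tabulate; allFin; applyUpTo; _ʳ++_)
open import Data.List.Membership.Propositional using (_∈_; _∉_)
open import Data.List.Membership.Propositional.Properties using (∈-++⁺ˡ; ∈-++⁺ʳ; ∈-++⁻; ∈-map⁺; ∈-map⁻; ∈-filter⁺; ∈-filter⁻; ∈-∃++; ∈-concat⁻′; ∈-allFin)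
open import Data.List.Relation.Binary.Permutation.Propositional using (_↭_; ↭-refl; ↭-sym; ↭-trans; ↭-reflexive; prep; swap) renaming (refl to ↭-id; trans to ↭-then)
open import Data.List.Relation.Binary.Permutation.Propositional.Properties using (∈-resp-↭; ↭-length; All-resp-↭; ++-comm; ++⁺ˡ; ++⁺ʳ; ↭-reverse) renaming (shift to ↭-shift)
open import Data.List.Relation.Binary.Subset.Propositional using (_⊆_)
open import Data.List.Relation.Unary.All using (All; []; _∷_)
open import Data.List.Relation.Unary.AllPairs using (AllPairs; []; _∷_)
open import Data.List.Relation.Unary.Any using (here; there)
open import Data.List.Relation.Unary.Unique.Propositional using (Unique)
open import Data.Maybe using (just; nothing)
open import Data.Nat using (ℕ; zero; suc; NonZero; z≤n; s≤s)
open import Data.Nat.DivMod using (m%n<n; m≡m%n+[m/n]*n)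
open import Data.Nat.ListAction using (sum)
open import Data.Nat.Logarithm using (⌈log₂_⌉; ⌈log₂⌉-mono-≤; ⌈log₂2^n⌉≡n; ⌈log₂⌈n/2⌉⌉≡⌈log₂n⌉∸1)
open import Data.Nat.Tactic.RingSolver using (solve-∀)
open import Data.Product using (_×_; _,_; proj₁; proj₂; ∃-syntax)
open import Data.Sum using (_⊎_; inj₁; inj₂; [_,_]′)
open import Data.Unit using (⊤)
open import Data.Vec using (Vec; []; _∷_; lookup; updateAt; toList; here; there)
open import Data.Vec.Properties using ([]=⇒lookup; lookup⇒[]=)
open import Function using (_∘_; id)
open import Level using (Level; _⊔_)
open import Relation.Binary.Bundles using (Poset)
open import Relation.Binary.Definitions using (tri<; tri≈; tri>)
open import Relation.Binary.PropositionalEquality as ≡ using (_≡_; _≢_)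
open import Relation.Binary.Structures using (IsDecTotalOrder)
open import Relation.Nullary using (¬_; Dec; yes; no; contradiction)
open import Relation.Nullary.Decidable using (⌊_⌋; ¬?; _×-dec_)

import Algebra.Properties.Ring as RingProperties
import Algebra.Solver.Ring.NaturalCoefficients.Default as SemiringSolver
import Data.Fin as Fin
import Data.Fin.Properties as Fin
import Data.List as List
import Data.List.Membership.DecPropositional as DecMembership
import Data.List.Properties as List
import Data.List.Relation.Unary.All as All
import Data.List.Relation.Unary.All.Properties as All
import Data.List.Relation.Unary.AllPairs.Properties as AllPairs
import Data.List.Relation.Unary.Unique.Propositional.Properties as Unique
import Data.Nat as ℕ
import Data.Nat.Induction as ℕ
import Data.Nat.Properties as ℕ
import Data.Vec.Relation.Unary.All as Vec
import Relation.Binary.Reasoning.PartialOrder as PartialOrderReasoning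

open import Defs

-- Ordered fields

-- Values are bounded backwards: every configuration carries a lower bound on the expected value of
-- the final solution, so the distribution of the runs is never described. For random greedy this
-- bound is a potential in closed form, depending on the current set and the number of iterations
-- left. The competitor of random greedy has size at most k only on average; the sets O₁ ∪ Sᵢ
-- themselves may be larger. This does no harm because the gain estimate is linear in the size, with
-- a nonnegative coefficient. The factor 1/3 stands for 1/e and comes from (1 + 1/j)ʲ ≤ 3, an
-- inequality between natural numbers. The target value ζ is fixed beforehand. If b ≥ ζ, the stream
-- has already reached it. Otherwise b and τ are both at most ζ′ = (1 + 1/w) ζ, and 4 ζ′ ≤ (1 - 1/w)
-- f(O) leaves 3 ζ′ for random greedy after one ζ′ has been lost. Time has to be polynomial in the
-- bit length of k. Therefore neither k iterations nor a walk through all thresholds is affordable: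
-- random greedy runs min(k, |P|) iterations on a pool P, and a large jump of b restarts the
-- numbering of the groups.

module OrderedFieldProperties {c ℓ₁ ℓ₂} (𝕂 : OrderedField c ℓ₁ ℓ₂) where
  open OrderedField 𝕂 hiding (zero)
  open IsDecTotalOrder isDecTotalOrder public
    using (total; antisym)
    renaming (refl to ≤-refl; reflexive to ≤-reflexive; trans to ≤-trans; isPartialOrder to ≤-isPartialOrder)
  open SemiringSolver commutativeSemiring public using (solve; _:=_; _:+_; _:*_; con)
  open RingProperties ring using (-‿distribˡ-*; -‿distribʳ-*; -‿involutive)

  ≤-poset : Poset c ℓ₁ ℓ₂
  ≤-poset = record { isPartialOrder = ≤-isPartialOrder }

  module ≤-Reasoning = PartialOrderReasoning ≤-poset

  ≰⇒≥ : ∀ {x y} → ¬ (x ≤ y) → y ≤ x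
  ≰⇒≥ {x} {y} x≰y with total x y
  ... | inj₁ x≤y = contradiction x≤y x≰y
  ... | inj₂ y≤x = y≤x

  +-monoˡ-≤ : ∀ z {x y} → x ≤ y → x + z ≤ y + z
  +-monoˡ-≤ z {x} {y} x≤y = begin
    x + z ≈⟨ +-comm x z ⟩
    z + x ≤⟨ +-monoʳ-≤ z x≤y ⟩
    z + y ≈⟨ +-comm z y ⟩
    y + z ∎
    where open ≤-Reasoning

  +-mono-≤ : ∀ {x y u v} → x ≤ y → u ≤ v → x + u ≤ y + v
  +-mono-≤ {y = y} {u} x≤y u≤v = ≤-trans (+-monoˡ-≤ u x≤y) (+-monoʳ-≤ y u≤v)

  +-cancelˡ-≤ : ∀ x {y z} → x + y ≤ x + z → y ≤ z
  +-cancelˡ-≤ x {y} {z} p = begin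
    y             ≈⟨ lemma y ⟨
    - x + (x + y) ≤⟨ +-monoʳ-≤ (- x) p ⟩
    - x + (x + z) ≈⟨ lemma z ⟩
    z             ∎
    where
    open ≤-Reasoning
    lemma : ∀ w → - x + (x + w) ≈ w
    lemma w = trans (sym (+-assoc (- x) x w)) (trans (+-congʳ (-‿inverseˡ x)) (+-identityˡ w))

  +-cancelʳ-≤ : ∀ x {y z} → y + x ≤ z + x → y ≤ z
  +-cancelʳ-≤ x {y} {z} p = +-cancelˡ-≤ x
    (≤-trans (≤-reflexive (+-comm x y)) (≤-trans p (≤-reflexive (+-comm z x))))

  ≤-+ʳ : ∀ {x y} → 0# ≤ y → x ≤ x + y
  ≤-+ʳ {x} 0≤y = ≤-trans (≤-reflexive (sym (+-identityʳ x))) (+-monoʳ-≤ x 0≤y)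

  ≤-+ˡ : ∀ {x y} → 0# ≤ y → x ≤ y + x
  ≤-+ˡ {x} 0≤y = ≤-trans (≤-+ʳ 0≤y) (≤-reflexive (+-comm _ _))

  +-nonNeg : ∀ {x y} → 0# ≤ x → 0# ≤ y → 0# ≤ x + y
  +-nonNeg 0≤x 0≤y = ≤-trans 0≤x (≤-+ʳ 0≤y)

  -‿cancelʳ : ∀ x y → x + (y - x) ≈ y
  -‿cancelʳ x y = begin-equality
    x + (y - x)   ≈⟨ +-congˡ (+-comm y (- x)) ⟩
    x + (- x + y) ≈⟨ +-assoc x (- x) y ⟨
    x - x + y     ≈⟨ +-congʳ (-‿inverseʳ x) ⟩
    0# + y        ≈⟨ +-identityˡ y ⟩
    y             ∎
    where open ≤-Reasoning

  x≤y⇒0≤y-x : ∀ {x y} → x ≤ y → 0# ≤ y - x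
  x≤y⇒0≤y-x {x} {y} x≤y = +-cancelˡ-≤ x
    (≤-trans (≤-reflexive (+-identityʳ x)) (≤-trans x≤y (≤-reflexive (sym (-‿cancelʳ x y)))))

  *-monoˡ-≤ : ∀ {x y z} → 0# ≤ x → y ≤ z → x * y ≤ x * z
  *-monoˡ-≤ {x} {y} {z} 0≤x y≤z = begin
    x * y               ≤⟨ ≤-+ʳ (*-nonNeg 0≤x (x≤y⇒0≤y-x y≤z)) ⟩
    x * y + x * (z - y) ≈⟨ distribˡ x y (z - y) ⟨
    x * (y + (z - y))   ≈⟨ *-congˡ (-‿cancelʳ y z) ⟩
    x * z               ∎
    where open ≤-Reasoning

  *-monoʳ-≤ : ∀ {x y z} → 0# ≤ x → y ≤ z → y * x ≤ z * x
  *-monoʳ-≤ 0≤x y≤z = ≤-trans (≤-reflexive (*-comm _ _)) (≤-trans (*-monoˡ-≤ 0≤x y≤z) (≤-reflexive (*-comm _ _)))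

  0≤1 : 0# ≤ 1#
  0≤1 with total 0# 1#
  ... | inj₁ p = p
  ... | inj₂ p = ≤-trans (*-nonNeg 0≤-1 0≤-1) (≤-reflexive eq)
    where
    0≤-1 : 0# ≤ - 1#
    0≤-1 = ≤-trans (x≤y⇒0≤y-x p) (≤-reflexive (+-identityˡ (- 1#)))
    eq : - 1# * - 1# ≈ 1#
    eq = trans (sym (-‿distribˡ-* 1# (- 1#))) (trans (-‿cong (*-identityˡ (- 1#))) (-‿involutive 1#))

  0<⇒0≤ : ∀ {x} → 0# < x → 0# ≤ x
  0<⇒0≤ = ≰⇒≥

  0<⇒≉0 : ∀ {x} → 0# < x → ¬ (x ≈ 0#)
  0<⇒≉0 0<x x≈0 = 0<x (≤-reflexive x≈0)

  *-cancelˡ-≤ : ∀ {x y z} → 0# < x → x * y ≤ x * z → y ≤ z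
  *-cancelˡ-≤ {x} {y} {z} 0<x p with total y z
  ... | inj₁ y≤z = y≤z
  ... | inj₂ z≤y = ≤-reflexive (trans (cancel y) (trans (*-congˡ eq) (sym (cancel z))))
    where
    eq : x * y ≈ x * z
    eq = antisym p (*-monoˡ-≤ (0<⇒0≤ 0<x) z≤y)
    cancel : ∀ w → w ≈ x ⁻¹ * (x * w)
    cancel w = begin-equality
      w              ≈⟨ *-identityˡ w ⟨
      1# * w         ≈⟨ *-congʳ (⁻¹-inverse x (0<⇒≉0 0<x)) ⟨
      x * x ⁻¹ * w   ≈⟨ *-congʳ (*-comm x (x ⁻¹)) ⟩
      x ⁻¹ * x * w   ≈⟨ *-assoc (x ⁻¹) x w ⟩
      x ⁻¹ * (x * w) ∎
      where open ≤-Reasoning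

  0<1 : 0# < 1#
  0<1 1≤0 = 0≉1 (antisym 0≤1 1≤0)

  *-pos : ∀ {x y} → 0# < x → 0# < y → 0# < x * y
  *-pos {x} {y} 0<x 0<y p = 0<y (*-cancelˡ-≤ 0<x (≤-trans p (≤-reflexive (sym (zeroʳ x)))))

  ⁻¹-nonNeg : ∀ {x} → 0# < x → 0# ≤ x ⁻¹
  ⁻¹-nonNeg {x} 0<x with total 0# (x ⁻¹)
  ... | inj₁ p = p
  ... | inj₂ p = contradiction
    (≤-trans (≤-reflexive (sym (⁻¹-inverse x (0<⇒≉0 0<x))))
      (≤-trans (*-monoˡ-≤ (0<⇒0≤ 0<x) p) (≤-reflexive (zeroʳ x)))) 0<1

  ⁻¹-inverseˡ : ∀ {x} → 0# < x → x ⁻¹ * x ≈ 1#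
  ⁻¹-inverseˡ {x} 0<x = trans (*-comm (x ⁻¹) x) (⁻¹-inverse x (0<⇒≉0 0<x))

  fromℕ-nonNeg : ∀ n → 0# ≤ fromℕ n
  fromℕ-nonNeg zero    = ≤-refl
  fromℕ-nonNeg (suc n) = +-nonNeg 0≤1 (fromℕ-nonNeg n)

  fromℕ-pos : ∀ n → 0# < fromℕ (suc n)
  fromℕ-pos n p = 0<1 (≤-trans (≤-+ʳ (fromℕ-nonNeg n)) p)

  fromℕ-pos′ : ∀ n .{{_ : NonZero n}} → 0# < fromℕ n
  fromℕ-pos′ (suc n) = fromℕ-pos n

  fromℕ-+ : ∀ i j → fromℕ (i ℕ.+ j) ≈ fromℕ i + fromℕ j
  fromℕ-+ zero    j = sym (+-identityˡ _)
  fromℕ-+ (suc i) j = trans (+-congˡ (fromℕ-+ i j)) (sym (+-assoc _ _ _))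

  fromℕ-* : ∀ i j → fromℕ (i ℕ.* j) ≈ fromℕ i * fromℕ j
  fromℕ-* zero    j = sym (zeroˡ _)
  fromℕ-* (suc i) j = begin-equality
    fromℕ (j ℕ.+ i ℕ.* j)           ≈⟨ fromℕ-+ j (i ℕ.* j) ⟩
    fromℕ j + fromℕ (i ℕ.* j)       ≈⟨ +-congˡ (fromℕ-* i j) ⟩
    fromℕ j + fromℕ i * fromℕ j     ≈⟨ solve 2 (λ a b → b :+ a :* b := (con 1 :+ a) :* b) refl (fromℕ i) (fromℕ j) ⟩
    (1# + fromℕ i) * fromℕ j        ∎
    where open ≤-Reasoning

  fromℕ-mono : ∀ {i j} → i ℕ.≤ j → fromℕ i ≤ fromℕ j
  fromℕ-mono {j = j} z≤n = fromℕ-nonNeg j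
  fromℕ-mono (s≤s p)     = +-monoʳ-≤ 1# (fromℕ-mono p)

  fromℕ-1 : fromℕ 1 ≈ 1#
  fromℕ-1 = +-identityʳ 1#

  sumOf : ∀ {a} {A : Set a} → (A → Carrier) → List A → Carrier
  sumOf g []       = 0#
  sumOf g (x ∷ xs) = g x + sumOf g xs

  infixr 8 _^_
  _^_ : Carrier → ℕ → Carrier
  x ^ zero  = 1#
  x ^ suc i = x * x ^ i

  ^-nonNeg : ∀ {x} i → 0# ≤ x → 0# ≤ x ^ i
  ^-nonNeg zero    0≤x = 0≤1
  ^-nonNeg (suc i) 0≤x = *-nonNeg 0≤x (^-nonNeg i 0≤x)

  fromℕ-^-inverse : ∀ {x} j i → x * fromℕ j ≈ 1# → x ^ i * fromℕ (j ℕ.^ i) ≈ 1#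
  fromℕ-^-inverse j zero    eq = trans (*-identityˡ _) fromℕ-1
  fromℕ-^-inverse {x} j (suc i) eq = begin-equality
    (x * x ^ i) * fromℕ (j ℕ.* j ℕ.^ i)        ≈⟨ *-congˡ (fromℕ-* j (j ℕ.^ i)) ⟩
    (x * x ^ i) * (fromℕ j * fromℕ (j ℕ.^ i))  ≈⟨ solve 4 (λ a b c d → (a :* b) :* (c :* d) := (a :* c) :* (b :* d)) refl x (x ^ i) (fromℕ j) (fromℕ (j ℕ.^ i)) ⟩
    (x * fromℕ j) * (x ^ i * fromℕ (j ℕ.^ i))  ≈⟨ *-cong eq (fromℕ-^-inverse j i eq) ⟩
    1# * 1#                                    ≈⟨ *-identityˡ 1# ⟩
    1#                                         ∎
    where open ≤-Reasoning

  sumOf-+ : ∀ {a} {A : Set a} (g h : A → Carrier) xs → sumOf (λ x → g x + h x) xs ≈ sumOf g xs + sumOf h xs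
  sumOf-+ g h []       = sym (+-identityˡ 0#)
  sumOf-+ g h (x ∷ xs) = trans (+-congˡ (sumOf-+ g h xs))
    (solve 4 (λ a b c d → (a :+ b) :+ (c :+ d) := (a :+ c) :+ (b :+ d)) refl (g x) (h x) (sumOf g xs) (sumOf h xs))

  sumOf-* : ∀ {a} {A : Set a} k (g : A → Carrier) xs → sumOf (λ x → k * g x) xs ≈ k * sumOf g xs
  sumOf-* k g []       = sym (zeroʳ k)
  sumOf-* k g (x ∷ xs) = trans (+-congˡ (sumOf-* k g xs)) (sym (distribˡ k (g x) (sumOf g xs)))

-- Bounds on arrays under updates

module _ {a p q : Level} {A : Set a} {P : A → Set p} {Q : A → Set q} where

  updateAt⁺ : ∀ {n} {xs : Vec A n} {g} i → (∀ {x} → P x → Q x) → (∀ {x} → P x → Q (g x)) →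
              Vec.All P xs → Vec.All Q (updateAt xs i g)
  updateAt⁺ Fin.zero    P⇒Q P⇒Qg (px Vec.∷ pxs) = P⇒Qg px Vec.∷ Vec.map P⇒Q pxs
  updateAt⁺ (Fin.suc i) P⇒Q P⇒Qg (px Vec.∷ pxs) = P⇒Q px Vec.∷ updateAt⁺ i P⇒Q P⇒Qg pxs

module _ {a} {A : Set a} where

  length-setAt : ∀ i (y : A) xs → length (setAt i y xs) ≡ length xs
  length-setAt _       y []       = ≡.refl
  length-setAt zero    y (x ∷ xs) = ≡.refl
  length-setAt (suc i) y (x ∷ xs) = ≡.cong suc (length-setAt i y xs)

  setAt⁺ : ∀ {p} {P : A → Set p} i {y xs} → P y → All P xs → All P (setAt i y xs)
  setAt⁺ _       py []         = []
  setAt⁺ zero    py (px ∷ pxs) = py ∷ pxs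
  setAt⁺ (suc i) py (px ∷ pxs) = px ∷ setAt⁺ i py pxs

  length-drop₁ : ∀ (xs : List A) → length (drop 1 xs) ℕ.≤ length xs
  length-drop₁ []       = z≤n
  length-drop₁ (x ∷ xs) = ℕ.n≤1+n _

  drop-head⁺ : ∀ {p} {P : A → Set p} i {xs y} → All P xs → head (drop i xs) ≡ just y → P y
  drop-head⁺ zero    (px ∷ pxs) ≡.refl = px
  drop-head⁺ (suc i) (px ∷ pxs) eq     = drop-head⁺ i pxs eq
  drop-head⁺ zero    []         ()
  drop-head⁺ (suc i) []         ()

-- Distributions

module CoinTosses {c ℓ₁ ℓ₂} (𝕂 : OrderedField c ℓ₁ ℓ₂) where
  open OrderedField 𝕂 hiding (zero)
  open OrderedFieldProperties 𝕂

  chance miss : ℕ → Carrier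
  chance c = fromℕ (suc c) ⁻¹
  miss c = 1# - chance c

  0<chance : ∀ c → 0# < chance c
  0<chance c p≤0 = 0<1 (≤-trans (≤-reflexive (sym (⁻¹-inverse _ (0<⇒≉0 (fromℕ-pos c)))))
    (≤-trans (*-monoˡ-≤ (fromℕ-nonNeg (suc c)) p≤0) (≤-reflexive (zeroʳ _))))

  chance≤1 : ∀ c → chance c ≤ 1#
  chance≤1 c = *-cancelˡ-≤ (fromℕ-pos c) (begin
    fromℕ (suc c) * chance c  ≈⟨ ⁻¹-inverse _ (0<⇒≉0 (fromℕ-pos c)) ⟩
    1#                   ≤⟨ ≤-+ʳ (fromℕ-nonNeg c) ⟩
    fromℕ (suc c)        ≈⟨ *-identityʳ _ ⟨
    fromℕ (suc c) * 1#   ∎)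
    where open ≤-Reasoning

  -- The last toss is certain, so the branch in which no candidate is left to choose never arises.
  1≤chance0 : 1# ≤ chance 0
  1≤chance0 = ≤-reflexive (trans (sym (⁻¹-inverse _ (0<⇒≉0 (fromℕ-pos 0)))) (trans (*-congʳ fromℕ-1) (*-identityˡ _)))

  [1+c]*miss : ∀ c → fromℕ (suc c) * miss c ≈ fromℕ c
  [1+c]*miss c = +-cancel (begin-equality
    fromℕ (suc c) * chance c + fromℕ (suc c) * miss c ≈⟨ distribˡ _ _ _ ⟨
    fromℕ (suc c) * (chance c + miss c)               ≈⟨ *-congˡ (-‿cancelʳ (chance c) 1#) ⟩
    fromℕ (suc c) * 1#                         ≈⟨ *-identityʳ _ ⟩
    1# + fromℕ c                               ≈⟨ +-congʳ (⁻¹-inverse _ (0<⇒≉0 (fromℕ-pos c))) ⟨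
    fromℕ (suc c) * chance c + fromℕ c              ∎)
    where
    open ≤-Reasoning
    +-cancel : ∀ {a x y} → a + x ≈ a + y → x ≈ y
    +-cancel {a} eq = antisym (+-cancelˡ-≤ a (≤-reflexive eq)) (+-cancelˡ-≤ a (≤-reflexive (sym eq)))

  -- The value of the branch in which the maximum φ is put aside when z is
  -- the mean of the suc c largest values.
  mean : ℕ → Carrier → Carrier → Carrier
  mean zero    z φ = 0#
  mean (suc c) z φ = fromℕ (suc c) ⁻¹ * (fromℕ (suc (suc c)) * z - φ)

  mean-* : ∀ c z φ → fromℕ (suc c) * mean (suc c) z φ ≈ fromℕ (suc (suc c)) * z - φ
  mean-* c z φ = trans (sym (*-assoc _ _ _)) (trans (*-congʳ (⁻¹-inverse _ (0<⇒≉0 (fromℕ-pos c)))) (*-identityˡ _))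

  -- The probability 1/(c + 1) of keeping the maximum and the mean of the other c values recombine
  -- to z. For c = 0 there are no other values, and `last` compares z with the maximum directly.
  mean-≤ : ∀ c z φ → (c ≡ 0 → fromℕ 1 * z ≤ φ + 0#) → z ≤ chance c * φ + miss c * mean c z φ
  mean-≤ zero z φ last = *-cancelˡ-≤ (fromℕ-pos 0) (begin
    fromℕ 1 * z                                    ≤⟨ last ≡.refl ⟩
    φ + 0#                                         ≈⟨ +-cong (sym (trans (*-congʳ (⁻¹-inverse _ (0<⇒≉0 (fromℕ-pos 0)))) (*-identityˡ φ))) (sym (zeroʳ _)) ⟩
    fromℕ 1 * chance 0 * φ + fromℕ 1 * miss 0 * 0#         ≈⟨ solve 5 (λ a b c d e → a :* b :* c :+ a :* d :* e := a :* (b :* c :+ d :* e)) refl (fromℕ 1) (chance 0) φ (miss 0) 0# ⟩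
    fromℕ 1 * (chance 0 * φ + miss 0 * 0#)                 ∎)
    where open ≤-Reasoning
  mean-≤ (suc c) z φ last = *-cancelˡ-≤ (fromℕ-pos (suc c)) (begin
    κ * z                                          ≈⟨ -‿cancelʳ φ (κ * z) ⟨
    φ + (κ * z - φ)                                ≈⟨ +-cong (sym (trans (*-congʳ (⁻¹-inverse _ (0<⇒≉0 (fromℕ-pos (suc c))))) (*-identityˡ φ))) (sym (mean-* c z φ)) ⟩
    κ * chance (suc c) * φ + fromℕ (suc c) * mean (suc c) z φ ≈⟨ +-congˡ (*-congʳ (sym ([1+c]*miss (suc c)))) ⟩
    κ * chance (suc c) * φ + κ * miss (suc c) * mean (suc c) z φ ≈⟨ solve 5 (λ a b c d e → a :* b :* c :+ a :* d :* e := a :* (b :* c :+ d :* e)) refl κ (chance (suc c)) φ (miss (suc c)) (mean (suc c) z φ) ⟩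
    κ * (chance (suc c) * φ + miss (suc c) * mean (suc c) z φ) ∎)
    where
    open ≤-Reasoning
    κ = fromℕ (suc (suc c))

module DistProperties {c ℓ₁ ℓ₂} (𝕂 : OrderedField c ℓ₁ ℓ₂) where
  open OrderedField 𝕂 hiding (zero)
  open OrderedFieldProperties 𝕂
  open Streaming 𝕂

  module _ {a b} {A : Set a} {B : Set b} where

    Surely-bind⁺ : ∀ {p} {P : B → Set p} {d : Dist A} {h : A → Dist B} →
                   Surely (λ x → Surely P (h x)) d → Surely P (bind d h)
    Surely-bind⁺ []         = []
    Surely-bind⁺ (px ∷ pxs) = All.++⁺ (All.map⁺ px) (Surely-bind⁺ pxs)

    Surely-bind⁻ : ∀ {p} {P : B → Set p} (d : Dist A) (h : A → Dist B) →
                   Surely P (bind d h) → Surely (λ x → Surely P (h x)) d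
    Surely-bind⁻ []            h ps = []
    Surely-bind⁻ ((w , x) ∷ d) h ps =
      let s = map (λ (q , y) → w * q , y) (h x) in
      All.map⁻ (All.++⁻ˡ s ps) ∷ Surely-bind⁻ d h (All.++⁻ʳ s ps)

  module _ {a} {A : Set a} (g : A → Carrier) where

    expect-++ : ∀ d d′ → expect g (d ++ d′) ≈ expect g d + expect g d′
    expect-++ []            d′ = sym (+-identityˡ _)
    expect-++ ((w , x) ∷ d) d′ = trans (+-congˡ (expect-++ d d′)) (sym (+-assoc _ _ _))

    expect-scale : ∀ w d → expect g (map (λ (q , y) → w * q , y) d) ≈ w * expect g d
    expect-scale w []            = sym (zeroʳ w)
    expect-scale w ((q , y) ∷ d) = begin-equality
      w * q * g y + expect g (map (λ (q , y) → w * q , y) d) ≈⟨ +-cong (*-assoc w q (g y)) (expect-scale w d) ⟩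
      w * (q * g y) + w * expect g d                         ≈⟨ distribˡ w (q * g y) (expect g d) ⟨
      w * (q * g y + expect g d)                             ∎
      where open ≤-Reasoning

    expect-bind-return : ∀ {b} {B : Set b} (x : B) (h : B → Dist A) → expect g (bind (return x) h) ≈ expect g (h x)
    expect-bind-return x h = trans (expect-++ (map (λ (q , y) → 1# * q , y) (h x)) [])
      (trans (+-identityʳ _) (trans (expect-scale 1# (h x)) (*-identityˡ _)))

    expect-bind-toss : ∀ {b} {B : Set b} p p′ (x y : B) (h : B → Dist A) →
      expect g (bind ((p , x) ∷ (p′ , y) ∷ []) h) ≈ p * expect g (h x) + p′ * expect g (h y)
    expect-bind-toss p p′ x y h = trans (expect-++ (map (λ (q , z) → p * q , z) (h x)) _)
      (+-cong (expect-scale p (h x))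
        (trans (expect-++ (map (λ (q , z) → p′ * q , z) (h y)) []) (trans (+-identityʳ _) (expect-scale p′ (h y)))))

-- A program logic for expected values, time and memory

module ProgramLogic {c ℓ₁ ℓ₂} (𝕂 : OrderedField c ℓ₁ ℓ₂) (m : ℕ) (I : Streaming.Instance 𝕂) where
  open OrderedField 𝕂 hiding (zero)
  open OrderedFieldProperties 𝕂
  open DistProperties 𝕂
  open Streaming 𝕂
  open Instance I
  open Syntax m
  open Run m I

  -- Expressions whose value is bounded by what the memory already holds: entries, lengths, the
  -- constants 0 and 1, and truncated differences that start from such a value.
  Atomic : Exp nat → Set
  Atomic (⟨ _ ⟩ _)       = ⊤
  Atomic (len _ _)       = ⊤
  Atomic (lit zero)      = ⊤
  Atomic (lit (suc zero)) = ⊤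
  Atomic (d ⊖ _)         = Atomic d
  Atomic _               = ⊥

  Sum : Exp nat → Set
  Sum (d ⊕ e) = Atomic d × Atomic e
  Sum e       = Atomic e

  -- Deterministic commands that lengthen natural numbers by at most one bit.
  Mild : Config → Set
  Mild ([]                , _) = ⊥
  Mild (flip _ _ ∷ _      , _) = ⊥
  Mild (push nat _ e ∷ _  , _) = Sum e
  Mild (set nat _ _ e ∷ _ , _) = Sum e
  Mild _                       = ⊤

  first : Dist Config → Config
  first []            = [] , initial
  first ((_ , γ) ∷ _) = γ

  next : Config → Config
  next γ = first (step γ)

  step-mild : ∀ γ → Mild γ → step γ ≡ return (next γ)
  step-mild (skip ∷ cs           , σ) _ = ≡.refl
  step-mild ((p ⨾ q) ∷ cs        , σ) _ = ≡.refl
  step-mild (cond b p q ∷ cs     , σ) _ = ≡.refl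
  step-mild (while b p ∷ cs      , σ) _ = ≡.refl
  step-mild (push nat a e ∷ cs   , σ) _ = ≡.refl
  step-mild (push real a e ∷ cs  , σ) _ = ≡.refl
  step-mild (push elem a e ∷ cs  , σ) _ = ≡.refl
  step-mild (pop nat a ∷ cs      , σ) _ = ≡.refl
  step-mild (pop real a ∷ cs     , σ) _ = ≡.refl
  step-mild (pop elem a ∷ cs     , σ) _ = ≡.refl
  step-mild (set nat a i e ∷ cs  , σ) _ = ≡.refl
  step-mild (set real a i e ∷ cs , σ) _ = ≡.refl
  step-mild (set elem a i e ∷ cs , σ) _ = ≡.refl
  step-mild (read a ∷ cs         , σ) _ = ≡.refl
  step-mild (query r a p ∷ cs    , σ) _ = ≡.refl

  solution : State → Subset n
  solution σ = output ([] , σ)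

  module Judgement (L B : ℕ) where

    -- The slack `e` counts the steps since the bounds L and B were last known to hold exactly: a
    -- step adds at most one entry to an array and one bit to a natural number.
    record Within (e : ℕ) (σ : State) : Set c where
      constructor within
      field
        nats-length  : Vec.All (λ l → length l ℕ.≤ L ℕ.+ e) (nats σ)
        nats-value   : Vec.All (All (ℕ._≤ 2 ℕ.^ (B ℕ.+ e))) (nats σ)
        reals-length : Vec.All (λ l → length l ℕ.≤ L ℕ.+ e) (reals σ)
        elems-length : Vec.All (λ l → length l ℕ.≤ L ℕ.+ e) (elems σ)

    private
      variable
        e : ℕ

      2^-mono : ∀ {i j} → i ℕ.≤ j → 2 ℕ.^ (B ℕ.+ i) ℕ.≤ 2 ℕ.^ (B ℕ.+ j)
      2^-mono i≤j = ℕ.^-monoʳ-≤ 2 (ℕ.+-monoʳ-≤ B i≤j)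

      1≤2^ : ∀ i → 1 ℕ.≤ 2 ℕ.^ i
      1≤2^ i = ℕ.^-monoʳ-≤ 2 (z≤n {i})

      L+e≤2^ : L ℕ.≤ 2 ℕ.^ B → ∀ e → L ℕ.+ e ℕ.≤ 2 ℕ.^ (B ℕ.+ e)
      L+e≤2^ L≤2^B zero    = ≡.subst₂ ℕ._≤_ (≡.sym (ℕ.+-identityʳ L)) (≡.cong (2 ℕ.^_) (≡.sym (ℕ.+-identityʳ B))) L≤2^B
      L+e≤2^ L≤2^B (suc e) = begin
        L ℕ.+ suc e                               ≡⟨ ℕ.+-suc L e ⟩
        1 ℕ.+ (L ℕ.+ e)                           ≤⟨ ℕ.+-mono-≤ (1≤2^ (B ℕ.+ e)) (L+e≤2^ L≤2^B e) ⟩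
        2 ℕ.^ (B ℕ.+ e) ℕ.+ 2 ℕ.^ (B ℕ.+ e)       ≡⟨ ≡.cong (2 ℕ.^ (B ℕ.+ e) ℕ.+_) (ℕ.+-identityʳ _) ⟨
        2 ℕ.* 2 ℕ.^ (B ℕ.+ e)                     ≡⟨ ≡.cong (2 ℕ.^_) (ℕ.+-suc B e) ⟨
        2 ℕ.^ (B ℕ.+ suc e)                       ∎
        where open ℕ.≤-Reasoning

      lookup⁺ : ∀ {a p} {A : Set a} {P : A → Set p} {n} {xs : Vec A n} → Vec.All P xs → ∀ i → P (lookup xs i)
      lookup⁺ (px Vec.∷ _)   Fin.zero    = px
      lookup⁺ (_ Vec.∷ pxs) (Fin.suc i) = lookup⁺ pxs i

      atomic : L ℕ.≤ 2 ℕ.^ B → ∀ {σ} x {w} → Atomic x → Within e σ → ⟦ x ⟧ⁿ σ ≡ just w → w ℕ.≤ 2 ℕ.^ (B ℕ.+ e)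
      atomic h {σ = σ} (⟨ a ⟩ i) _ W eq with ⟦ i ⟧ⁿ σ
      ... | just j = drop-head⁺ j (lookup⁺ (Within.nats-value W) a) eq
      atomic {e} h (len nat a)  _ W ≡.refl = ℕ.≤-trans (lookup⁺ (Within.nats-length W) a) (L+e≤2^ h e)
      atomic {e} h (len real a) _ W ≡.refl = ℕ.≤-trans (lookup⁺ (Within.reals-length W) a) (L+e≤2^ h e)
      atomic {e} h (len elem a) _ W ≡.refl = ℕ.≤-trans (lookup⁺ (Within.elems-length W) a) (L+e≤2^ h e)
      atomic h (lit zero)       _ W ≡.refl = z≤n
      atomic {e} h (lit (suc zero)) _ W ≡.refl = 1≤2^ (B ℕ.+ e)
      atomic h {σ = σ} (x ⊖ y) at W eq with ⟦ x ⟧ⁿ σ in eqx | ⟦ y ⟧ⁿ σ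
      atomic h (x ⊖ y) at W ≡.refl | just i | just j = ℕ.≤-trans (ℕ.m∸n≤m i j) (atomic h x at W eqx)

      -- Adding two atomic values costs one bit, which is exactly what a single step may add.
      sum-bound : L ℕ.≤ 2 ℕ.^ B → ∀ {σ} x {w} → Sum x → Within e σ → ⟦ x ⟧ⁿ σ ≡ just w → w ℕ.≤ 2 ℕ.^ (B ℕ.+ suc e)
      sum-bound {e} h x@(⟨ _ ⟩ _) s W eq = ℕ.≤-trans (atomic h x s W eq) (2^-mono (ℕ.n≤1+n e))
      sum-bound {e} h x@(len _ _) s W eq = ℕ.≤-trans (atomic h x s W eq) (2^-mono (ℕ.n≤1+n e))
      sum-bound {e} h x@(lit _)   s W eq = ℕ.≤-trans (atomic h x s W eq) (2^-mono (ℕ.n≤1+n e))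
      sum-bound {e} h x@(_ ⊖ _)   s W eq = ℕ.≤-trans (atomic h x s W eq) (2^-mono (ℕ.n≤1+n e))
      sum-bound {e} h {σ} (x ⊕ y) (s , s′) W eq with ⟦ x ⟧ⁿ σ in eqx | ⟦ y ⟧ⁿ σ in eqy
      sum-bound {e} h {σ} (x ⊕ y) (s , s′) W ≡.refl | just i | just j = begin
        i ℕ.+ j                                   ≤⟨ ℕ.+-mono-≤ (atomic h x s W eqx) (atomic h y s′ W eqy) ⟩
        2 ℕ.^ (B ℕ.+ e) ℕ.+ 2 ℕ.^ (B ℕ.+ e)       ≡⟨ ≡.cong (2 ℕ.^ (B ℕ.+ e) ℕ.+_) (ℕ.+-identityʳ _) ⟨
        2 ℕ.* 2 ℕ.^ (B ℕ.+ e)                     ≡⟨ ≡.cong (2 ℕ.^_) (ℕ.+-suc B e) ⟨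
        2 ℕ.^ (B ℕ.+ suc e)                       ∎
        where open ℕ.≤-Reasoning

    Within-mono : ∀ {i j σ} → i ℕ.≤ j → Within i σ → Within j σ
    Within-mono i≤j (within nl nv rl el) = within (Vec.map longer nl)
      (Vec.map (All.map (λ w → ℕ.≤-trans w (2^-mono i≤j))) nv) (Vec.map longer rl) (Vec.map longer el)
      where
      longer : ∀ {x} → x ℕ.≤ _ → x ℕ.≤ _
      longer x≤ = ℕ.≤-trans x≤ (ℕ.+-monoʳ-≤ L i≤j)

    private
      suc-mono : ∀ {σ} → Within e σ → Within (suc e) σ
      suc-mono = Within-mono (ℕ.n≤1+n _)

      wk : ∀ {x} → x ℕ.≤ L ℕ.+ e → x ℕ.≤ L ℕ.+ suc e
      wk {e} p = ℕ.≤-trans p (ℕ.+-monoʳ-≤ L (ℕ.n≤1+n e))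

      wk-suc : ∀ {x} → x ℕ.≤ L ℕ.+ e → suc x ℕ.≤ L ℕ.+ suc e
      wk-suc {e} {x} p = ≡.subst (suc x ℕ.≤_) (≡.sym (ℕ.+-suc L e)) (s≤s p)

      wk-drop : ∀ {a} {A : Set a} (xs : List A) → length xs ℕ.≤ L ℕ.+ e → length (drop 1 xs) ℕ.≤ L ℕ.+ suc e
      wk-drop xs p = wk (ℕ.≤-trans (length-drop₁ xs) p)

      wk-setAt : ∀ {a} {A : Set a} (xs : List A) i y → length xs ℕ.≤ L ℕ.+ e → length (setAt i y xs) ℕ.≤ L ℕ.+ suc e
      wk-setAt xs i y p = wk (ℕ.≤-trans (ℕ.≤-reflexive (length-setAt i y xs)) p)

      wk-val : ∀ {x} → x ℕ.≤ 2 ℕ.^ (B ℕ.+ e) → x ℕ.≤ 2 ℕ.^ (B ℕ.+ suc e)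
      wk-val {e} p = ℕ.≤-trans p (2^-mono (ℕ.n≤1+n e))

    pushⁿ-within : ∀ {σ} a {w} → w ℕ.≤ 2 ℕ.^ (B ℕ.+ suc e) → Within e σ → Within (suc e) (pushⁿ a w σ)
    pushⁿ-within a w≤ (within nl nv rl el) = within (updateAt⁺ a wk wk-suc nl)
      (updateAt⁺ a (All.map wk-val) (λ vs → w≤ ∷ All.map wk-val vs) nv) (Vec.map wk rl) (Vec.map wk el)

    private
      pushʳ-within : ∀ {σ} a x → Within e σ → Within (suc e) (pushʳ a x σ)
      pushʳ-within a x (within nl nv rl el) = within (Vec.map wk nl) (Vec.map (All.map wk-val) nv)
        (updateAt⁺ a wk wk-suc rl) (Vec.map wk el)

      pushᵉ-within : ∀ {σ} a x → Within e σ → Within (suc e) (pushᵉ a x σ)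
      pushᵉ-within a x (within nl nv rl el) = within (Vec.map wk nl) (Vec.map (All.map wk-val) nv)
        (Vec.map wk rl) (updateAt⁺ a wk wk-suc el)

    next-within : L ℕ.≤ 2 ℕ.^ B → ∀ γ → Mild γ → Within e (proj₂ γ) → Within (suc e) (proj₂ (next γ))
    next-within h (skip ∷ cs           , σ) _ W = suc-mono W
    next-within h ((p ⨾ q) ∷ cs        , σ) _ W = suc-mono W
    next-within h (cond b p q ∷ cs     , σ) _ W = suc-mono W
    next-within h (while b p ∷ cs      , σ) _ W = suc-mono W
    next-within h (push nat a x ∷ cs   , σ) s W with ⟦ x ⟧ⁿ σ in eq
    ... | just w  = pushⁿ-within a (sum-bound h x s W eq) W
    ... | nothing = suc-mono W
    next-within h (push real a x ∷ cs  , σ) _ W with ⟦ x ⟧ʳ σ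
    ... | just w  = pushʳ-within a w W
    ... | nothing = suc-mono W
    next-within h (push elem a x ∷ cs  , σ) _ W with ⟦ x ⟧ᵉ σ
    ... | just w  = pushᵉ-within a w W
    ... | nothing = suc-mono W
    next-within h (pop nat a ∷ cs      , σ) _ (within nl nv rl el) = within (updateAt⁺ a wk (λ {xs} → wk-drop xs) nl)
      (updateAt⁺ a (All.map wk-val) (All.drop⁺ 1 ∘ All.map wk-val) nv) (Vec.map wk rl) (Vec.map wk el)
    next-within h (pop real a ∷ cs     , σ) _ (within nl nv rl el) = within (Vec.map wk nl)
      (Vec.map (All.map wk-val) nv) (updateAt⁺ a wk (λ {xs} → wk-drop xs) rl) (Vec.map wk el)
    next-within h (pop elem a ∷ cs     , σ) _ (within nl nv rl el) = within (Vec.map wk nl)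
      (Vec.map (All.map wk-val) nv) (Vec.map wk rl) (updateAt⁺ a wk (λ {xs} → wk-drop xs) el)
    next-within h (set nat a i x ∷ cs  , σ) s W@(within nl nv rl el) with ⟦ i ⟧ⁿ σ | ⟦ x ⟧ⁿ σ in eq
    ... | just j  | just w  = within (updateAt⁺ a wk (λ {xs} → wk-setAt xs j w) nl)
      (updateAt⁺ a (All.map wk-val) (setAt⁺ j (sum-bound h x s W eq) ∘ All.map wk-val) nv) (Vec.map wk rl) (Vec.map wk el)
    ... | just _  | nothing = suc-mono W
    ... | nothing | just _  = suc-mono W
    ... | nothing | nothing = suc-mono W
    next-within h (set real a i x ∷ cs , σ) _ W@(within nl nv rl el) with ⟦ i ⟧ⁿ σ | ⟦ x ⟧ʳ σ
    ... | just j  | just w  = within (Vec.map wk nl) (Vec.map (All.map wk-val) nv)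
      (updateAt⁺ a wk (λ {xs} → wk-setAt xs j w) rl) (Vec.map wk el)
    ... | just _  | nothing = suc-mono W
    ... | nothing | just _  = suc-mono W
    ... | nothing | nothing = suc-mono W
    next-within h (set elem a i x ∷ cs , σ) _ W@(within nl nv rl el) with ⟦ i ⟧ⁿ σ | ⟦ x ⟧ᵉ σ
    ... | just j  | just w  = within (Vec.map wk nl) (Vec.map (All.map wk-val) nv)
      (Vec.map wk rl) (updateAt⁺ a wk (λ {xs} → wk-setAt xs j w) el)
    ... | just _  | nothing = suc-mono W
    ... | nothing | just _  = suc-mono W
    ... | nothing | nothing = suc-mono W
    next-within h (read a ∷ cs         , σ) _ W with head (stream σ)
    ... | just u  = pushᵉ-within a u (within (Within.nats-length W) (Within.nats-value W) (Within.reals-length W) (Within.elems-length W))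
    ... | nothing = suc-mono W
    next-within h (query r a p ∷ cs    , σ) _ W with oracle (Data.List.zip (lookup (elems σ) a) (lookup (reals σ) p))
    ... | just w  = pushʳ-within r w W
    ... | nothing = suc-mono W

    Small : State → Set c
    Small = Within 0

    -- A generous bound on the number of steps between two points at which the memory is
    -- re-examined. It enters the memory bounds only as an additive constant.
    fuel : ℕ
    fuel = 60

    module _ where

      -- Good j t γ v: within t steps the run from γ halts with a feasible
      -- solution of expected value at least v, and at most j steps separate γ
      -- from a point at which the memory is known to be small.
      data Good : ℕ → ℕ → Config → Carrier → Set (c ⊔ ℓ₁ ⊔ ℓ₂) where
        done  : ∀ {j t σ v} → Feasible (solution σ) → v ≤ f (solution σ) → Good j t ([] , σ) v
        det   : ∀ {j t γ v} {mild : Mild γ} → Good j t (next γ) v → Good (suc j) (suc t) γ v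
        jump  : ∀ {j t p cs σ γ v} → step (p ∷ cs , σ) ≡ return γ → Small (proj₂ γ) →
                Good fuel t γ v → Good j (suc t) (p ∷ cs , σ) v
        check : ∀ {j t γ v} → Small (proj₂ γ) → Good fuel t γ v → Good j t γ v
        toss  : ∀ {j t a x cs σ p v v₁ v₂} → ⟦ x ⟧ʳ σ ≡ just p → 0# < p → p ≤ 1# →
                Good j t (cs , pushⁿ a 1 σ) v₁ → (p < 1# → Good j t (cs , pushⁿ a 0 σ) v₂) →
                v ≤ p * v₁ + (1# - p) * v₂ → Good (suc j) (suc t) (flip a x ∷ cs , σ) v

      weaken : ∀ {i j t t′ γ v v′} → i ℕ.≤ j → t ℕ.≤ t′ → v′ ≤ v → Good i t γ v → Good j t′ γ v′
      weaken i≤j t≤t′ v≤ (done fin v≤g)          = done fin (≤-trans v≤ v≤g)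
      weaken (s≤s i≤j) (s≤s t≤t′) v≤ (det {mild = mild} G) = det {mild = mild} (weaken i≤j t≤t′ v≤ G)
      weaken i≤j (s≤s t≤t′) v≤ (jump eq S G)     = jump eq S (weaken ℕ.≤-refl t≤t′ v≤ G)
      weaken i≤j t≤t′ v≤ (check S G)             = check S (weaken ℕ.≤-refl t≤t′ v≤ G)
      weaken (s≤s i≤j) (s≤s t≤t′) v≤ (toss eq p>0 p≤1 G₁ G₂ le) = toss eq p>0 p≤1
        (weaken i≤j t≤t′ ≤-refl G₁) (λ p<1 → weaken i≤j t≤t′ ≤-refl (G₂ p<1)) (≤-trans v≤ le)

      delay : ∀ {j t t′ γ v} → t ℕ.≤ t′ → Good j t γ v → Good j t′ γ v
      delay t≤t′ = weaken ℕ.≤-refl t≤t′ ≤-refl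

      run : ℕ → Config → Config
      run zero    γ = γ
      run (suc i) γ = run i (next γ)

      AllMild : ℕ → Config → Set
      AllMild zero    γ = ⊤
      AllMild (suc i) γ = Mild γ × AllMild i (next γ)

      block : ∀ (i : ℕ) {j t γ v} {mild : AllMild i γ} → Good j t (run i γ) v → Good (i ℕ.+ j) (i ℕ.+ t) γ v
      block zero                          G = G
      block (suc i) {mild = mild , milds} G = det {mild = mild} (block i {mild = milds} G)

      private
        toss-step : ∀ {a x cs σ p} → ⟦ x ⟧ʳ σ ≡ just p → 0# < p → ¬ (1# ≤ p) →
          step (flip a x ∷ cs , σ) ≡ (p , cs , pushⁿ a 1 σ) ∷ (1# - p , cs , pushⁿ a 0 σ) ∷ []
        toss-step {x = x} {σ = σ} {p} eq p>0 p<1 with ⟦ x ⟧ʳ σ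
        toss-step {p = p} ≡.refl p>0 p<1 | just _ with p ≤? 0#
        ... | yes p≤0 = contradiction p≤0 p>0
        ... | no _ with 1# ≤? p
        ... | yes 1≤p = contradiction 1≤p p<1
        ... | no _    = ≡.refl

        -- A certain toss has only one listed outcome; this is why `toss` asks for its second branch
        -- only when p < 1.
        toss-step₁ : ∀ {a x cs σ p} → ⟦ x ⟧ʳ σ ≡ just p → 0# < p → 1# ≤ p →
          step (flip a x ∷ cs , σ) ≡ return (cs , pushⁿ a 1 σ)
        toss-step₁ {x = x} {σ = σ} {p} eq p>0 1≤p with ⟦ x ⟧ʳ σ
        toss-step₁ {p = p} ≡.refl p>0 1≤p | just _ with p ≤? 0#
        ... | yes p≤0 = contradiction p≤0 p>0
        ... | no _ with 1# ≤? p
        ... | yes _   = ≡.refl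
        ... | no 1≰p  = contradiction 1≤p 1≰p

      module _ {p} {P : Config → Set p} where

        surely-by : ∀ s γ {d} → step γ ≡ d → Surely (λ γ′ → Surely P (steps s γ′)) d → Surely P (steps (suc s) γ)
        surely-by s γ ≡.refl ps = Surely-bind⁺ ps

        surely-of : ∀ s γ {d} → step γ ≡ d → Surely P (steps (suc s) γ) → Surely (λ γ′ → Surely P (steps s γ′)) d
        surely-of s γ ≡.refl ps = Surely-bind⁻ (step γ) (steps s) ps

      -- `j` bounds the steps up to the next checkpoint. A step moves one unit from `j` to `e`, and
      -- a checkpoint resets `e` to 0, so `e + j` never exceeds `fuel`.
      always-within : L ℕ.≤ 2 ℕ.^ B → ∀ {e j t γ v} → Good j t γ v → e ℕ.+ j ℕ.≤ fuel → Within e (proj₂ γ) →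
                      ∀ s → Surely (Within fuel ∘ proj₂) (steps s γ)
      always-within h {e} {j} G e+j≤ W zero = Within-mono (ℕ.≤-trans (ℕ.m≤m+n e j) e+j≤) W ∷ []
      always-within h {γ = γ} G@(done _ _) e+j≤ W (suc s) = surely-by s γ ≡.refl (always-within h G e+j≤ W s ∷ [])
      always-within h {e} {suc j} {γ = γ} (det {mild = mild} G) e+j≤ W (suc s) = surely-by s γ (step-mild γ mild)
        (always-within h G (≡.subst (ℕ._≤ fuel) (ℕ.+-suc e j) e+j≤) (next-within h γ mild W) s ∷ [])
      always-within h {γ = γ} (jump eq S G) e+j≤ W (suc s) = surely-by s γ eq (always-within h G ℕ.≤-refl S s ∷ [])
      always-within h (check S G) e+j≤ W (suc s) = always-within h G ℕ.≤-refl S (suc s)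
      always-within h {e} {suc j} {γ = γ} (toss {a = a} {x} {cs} {σ} {p} eq p>0 p≤1 G₁ G₂ le) e+j≤ W (suc s) with 1# ≤? p
      ... | yes 1≤p = surely-by s γ (toss-step₁ {a} {x} {cs} {σ} eq p>0 1≤p)
        (always-within h G₁ (≡.subst (ℕ._≤ fuel) (ℕ.+-suc e j) e+j≤) (pushⁿ-within a (1≤2^ (B ℕ.+ suc e)) W) s ∷ [])
      ... | no p<1 = surely-by s γ (toss-step {a} {x} {cs} {σ} eq p>0 p<1)
        (always-within h G₁ (≡.subst (ℕ._≤ fuel) (ℕ.+-suc e j) e+j≤) (pushⁿ-within a (1≤2^ (B ℕ.+ suc e)) W) s ∷
         always-within h (G₂ p<1) (≡.subst (ℕ._≤ fuel) (ℕ.+-suc e j) e+j≤) (pushⁿ-within a z≤n W) s ∷ [])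

      halts : ∀ {j t γ v} → Good j t γ v → ∀ s → t ℕ.≤ s → Surely Halted (steps s γ)
      halts (done _ _)    zero    t≤s = ≡.refl ∷ []
      halts {γ = γ} (done fin v≤) (suc s) t≤s = surely-by s γ ≡.refl (halts (done {j = 0} {t = 0} fin v≤) s z≤n ∷ [])
      halts {γ = γ} (det {mild = mild} G) (suc s) (s≤s t≤s) = surely-by s γ (step-mild γ mild) (halts G s t≤s ∷ [])
      halts {γ = γ} (jump eq _ G) (suc s) (s≤s t≤s) = surely-by s γ eq (halts G s t≤s ∷ [])
      halts (check _ G) s t≤s = halts G s t≤s
      halts {γ = γ} (toss {a = a} {x} {cs} {σ} {p} eq p>0 p≤1 G₁ G₂ le) (suc s) (s≤s t≤s) with 1# ≤? p
      ... | yes 1≤p = surely-by s γ (toss-step₁ {a} {x} {cs} {σ} eq p>0 1≤p) (halts G₁ s t≤s ∷ [])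
      ... | no p<1  = surely-by s γ (toss-step {a} {x} {cs} {σ} eq p>0 p<1) (halts G₁ s t≤s ∷ halts (G₂ p<1) s t≤s ∷ [])

      -- The time s is arbitrary, as the approximation property demands; it need not exceed t. At s
      -- = 0 the hypothesis of having halted excludes every form of `Good` except `done`, possibly
      -- below checkpoints, because all others have a nonempty control stack.
      finals : ∀ {j t γ v} → Good j t γ v → ∀ s → Surely Halted (steps s γ) → Surely (Feasible ∘ output) (steps s γ)
      finals (done fin _) zero    _ = fin ∷ []
      finals {γ = γ} G@(done _ _) (suc s) h = surely-by s γ ≡.refl (finals G s (All.head (surely-of s γ ≡.refl h)) ∷ [])
      finals {γ = _ ∷ _ , _} (det _) zero (() ∷ _)
      finals {γ = γ} (det {mild = mild} G) (suc s) h =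
        surely-by s γ (step-mild γ mild) (finals G s (All.head (surely-of s γ (step-mild γ mild) h)) ∷ [])
      finals (jump eq _ G) zero (() ∷ _)
      finals {γ = γ} (jump eq _ G) (suc s) h = surely-by s γ eq (finals G s (All.head (surely-of s γ eq h)) ∷ [])
      finals (check _ G) s h = finals G s h
      finals (toss _ _ _ _ _ _) zero (() ∷ _)
      finals {γ = γ} (toss {a = a} {x} {cs} {σ} {p} eq p>0 p≤1 G₁ G₂ le) (suc s) h with 1# ≤? p
      ... | yes 1≤p = let e = toss-step₁ {a} {x} {cs} {σ} eq p>0 1≤p in
        surely-by s γ e (finals G₁ s (All.head (surely-of s γ e h)) ∷ [])
      ... | no p<1 with toss-step {a} {x} {cs} {σ} eq p>0 p<1
      ...   | e with surely-of s γ e h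
      ...     | h₁ ∷ h₂ ∷ [] = surely-by s γ e (finals G₁ s h₁ ∷ finals (G₂ p<1) s h₂ ∷ [])

      value : ∀ {j t γ v} → Good j t γ v → ∀ s → Surely Halted (steps s γ) → v ≤ expect (f ∘ output) (steps s γ)
      value (done {σ = σ} _ v≤) zero _ = ≤-trans v≤ (≤-reflexive (sym (trans (+-identityʳ _) (*-identityˡ _))))
      value {γ = γ} G@(done _ _) (suc s) h = ≤-trans (value G s (All.head (surely-of s γ ≡.refl h)))
        (≤-reflexive (sym (expect-bind-return (f ∘ output) _ (steps s))))
      value {γ = _ ∷ _ , _} (det _) zero (() ∷ _)
      value {γ = γ} (det {mild = mild} G) (suc s) h rewrite step-mild γ mild =
        ≤-trans (value G s (All.head (Surely-bind⁻ (return (next γ)) (steps s) h)))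
          (≤-reflexive (sym (expect-bind-return (f ∘ output) (next γ) (steps s))))
      value (jump eq _ G) zero (() ∷ _)
      value (jump {γ = γ} eq _ G) (suc s) h rewrite eq =
        ≤-trans (value G s (All.head (Surely-bind⁻ (return γ) (steps s) h)))
          (≤-reflexive (sym (expect-bind-return (f ∘ output) γ (steps s))))
      value (check _ G) s h = value G s h
      value (toss _ _ _ _ _ _) zero (() ∷ _)
      value (toss {a = a} {x} {cs} {σ} {p} {v} {v₁} {v₂} eq p>0 p≤1 G₁ G₂ le) (suc s) h with 1# ≤? p
      ... | yes 1≤p rewrite toss-step₁ {a} {x} {cs} {σ} eq p>0 1≤p = begin
        v                        ≤⟨ le ⟩
        p * v₁ + (1# - p) * v₂   ≈⟨ +-cong (*-congʳ p≈1) (*-congʳ (+-congˡ (-‿cong p≈1))) ⟩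
        1# * v₁ + (1# - 1#) * v₂ ≈⟨ +-cong (*-identityˡ v₁) (trans (*-congʳ (-‿inverseʳ 1#)) (zeroˡ v₂)) ⟩
        v₁ + 0#                  ≈⟨ +-identityʳ v₁ ⟩
        v₁                       ≤⟨ value G₁ s (All.head (Surely-bind⁻ (return (cs , pushⁿ a 1 σ)) (steps s) h)) ⟩
        expect (f ∘ output) (steps s (cs , pushⁿ a 1 σ)) ≈⟨ expect-bind-return (f ∘ output) (cs , pushⁿ a 1 σ) (steps s) ⟨
        expect (f ∘ output) (bind (return (cs , pushⁿ a 1 σ)) (steps s)) ∎
        where
        open ≤-Reasoning
        p≈1 : p ≈ 1#
        p≈1 = antisym p≤1 1≤p
      ... | no p<1 rewrite toss-step {a} {x} {cs} {σ} eq p>0 p<1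
        with Surely-bind⁻ ((p , cs , pushⁿ a 1 σ) ∷ (1# - p , cs , pushⁿ a 0 σ) ∷ []) (steps s) h
      ... | h₁ ∷ h₂ ∷ [] = begin
        v                                ≤⟨ le ⟩
        p * v₁ + (1# - p) * v₂           ≤⟨ +-mono-≤ (*-monoˡ-≤ (0<⇒0≤ p>0) (value G₁ s h₁))
                                                     (*-monoˡ-≤ (x≤y⇒0≤y-x p≤1) (value (G₂ p<1) s h₂)) ⟩
        p * expect (f ∘ output) (steps s (cs , pushⁿ a 1 σ))
          + (1# - p) * expect (f ∘ output) (steps s (cs , pushⁿ a 0 σ))
                                         ≈⟨ expect-bind-toss (f ∘ output) p (1# - p) (cs , pushⁿ a 1 σ) (cs , pushⁿ a 0 σ) (steps s) ⟨
        expect (f ∘ output) (bind ((p , cs , pushⁿ a 1 σ) ∷ (1# - p , cs , pushⁿ a 0 σ) ∷ []) (steps s)) ∎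
        where open ≤-Reasoning

-- Lists as finite sets: disjointness, permutations, lengths

module _ {a} {A : Set a} where

  private
    variable
      x : A
      xs ys : List A

  Disjoint : List A → List A → Set a
  Disjoint xs ys = ∀ x → x ∈ xs → x ∉ ys

  ∈⇒↭ : x ∈ xs → ∃[ ys ] xs ↭ x ∷ ys
  ∈⇒↭ {x} x∈xs with ∈-∃++ x∈xs
  ... | ys , zs , ≡.refl = ys ++ zs , ↭-shift x ys zs

  Unique-resp-↭ : xs ↭ ys → Unique xs → Unique ys
  Unique-resp-↭ ↭-id       us = us
  Unique-resp-↭ (prep x p) (x∉ ∷ us) = All-resp-↭ p x∉ ∷ Unique-resp-↭ p us
  Unique-resp-↭ (swap x y p) ((x≢y ∷ x∉) ∷ y∉ ∷ us) =
    (x≢y ∘ ≡.sym ∷ All-resp-↭ p y∉) ∷ All-resp-↭ p x∉ ∷ Unique-resp-↭ p us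
  Unique-resp-↭ (↭-then p q) us = Unique-resp-↭ q (Unique-resp-↭ p us)

  Unique-head-∉ : Unique (x ∷ xs) → x ∉ xs
  Unique-head-∉ (x∉ ∷ _) x∈ = All.lookup x∉ x∈ ≡.refl

  ∉-Unique : x ∉ xs → Unique xs → Unique (x ∷ xs)
  ∉-Unique {x} x∉ us = All.tabulate (λ { y∈ ≡.refl → x∉ y∈ }) ∷ us

  ⊆-drop : x ∉ xs → xs ⊆ (x ∷ ys) → xs ⊆ ys
  ⊆-drop x∉ xs⊆ y∈ with xs⊆ y∈
  ... | here ≡.refl = contradiction y∈ x∉
  ... | there y∈ys  = y∈ys

  Unique-⊆⇒length-≤ : Unique xs → xs ⊆ ys → length xs ℕ.≤ length ys
  Unique-⊆⇒length-≤ {[]}     _  _   = z≤n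
  Unique-⊆⇒length-≤ {x ∷ xs} us@(_ ∷ us′) xs⊆ with ∈⇒↭ (xs⊆ (here ≡.refl))
  ... | zs , p = ≡.subst (suc (length xs) ℕ.≤_) (≡.sym (↭-length p))
    (s≤s (Unique-⊆⇒length-≤ us′ (⊆-drop (Unique-head-∉ us) (∈-resp-↭ p ∘ xs⊆ ∘ there))))

-- Submodular functions

-- A submodular function, evaluated on the set of members of a list.
record SubmodularFunction {c ℓ₁ ℓ₂} (𝕂 : OrderedField c ℓ₁ ℓ₂) (n : ℕ) : Set (c ⊔ ℓ₁ ⊔ ℓ₂) where
  open OrderedField 𝕂
  field
    F            : List (Fin n) → Carrier
    F-nonNeg     : ∀ xs → 0# ≤ F xs
    F-cong       : ∀ {xs ys} → xs ⊆ ys → ys ⊆ xs → F xs ≈ F ys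
    F-submodular : ∀ xs ys zs ws → zs ⊆ (xs ++ ys) → (xs ++ ys) ⊆ zs →
      (∀ {x} → x ∈ ws → x ∈ xs × x ∈ ys) → (∀ {x} → x ∈ xs → x ∈ ys → x ∈ ws) → F zs + F ws ≤ F xs + F ys

module SubmodularProperties {c ℓ₁ ℓ₂} {𝕂 : OrderedField c ℓ₁ ℓ₂} {n : ℕ} (𝔽 : SubmodularFunction 𝕂 n) where
  open OrderedField 𝕂
  open SubmodularFunction 𝔽
  open OrderedFieldProperties 𝕂
  open DecMembership (Fin._≟_ {n}) using (_∈?_)

  private
    A : Set
    A = Fin n

  -- Submodularity for `ys` and `u ∷ xs`: their union is `u ∷ ys`, and their intersection is `xs`
  -- because u lies outside `ys`.
  F-diminishing : ∀ {u xs ys} → u ∉ ys → xs ⊆ ys → F (u ∷ ys) + F xs ≤ F ys + F (u ∷ xs)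
  F-diminishing {u} {xs} {ys} u∉ys xs⊆ys = F-submodular ys (u ∷ xs) (u ∷ ys) xs
    (λ { (here ≡.refl) → ∈-++⁺ʳ ys (here ≡.refl) ; (there p) → ∈-++⁺ˡ p })
    (λ p → [ there , (λ { (here ≡.refl) → here ≡.refl ; (there q) → there (xs⊆ys q) }) ]′ (∈-++⁻ ys p))
    (λ p → xs⊆ys p , there p)
    (λ { p (here ≡.refl) → contradiction p u∉ys ; p (there q) → q })

  F-++ : ∀ xs ys → F (xs ++ ys) ≤ F xs + F ys
  F-++ xs ys = ≤-trans (≤-+ʳ (F-nonNeg (filter (_∈? ys) xs))) (F-submodular xs ys (xs ++ ys) (filter (_∈? ys) xs)
    id id (∈-filter⁻ (_∈? ys)) (∈-filter⁺ (_∈? ys)))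

  ∷-absorb : ∀ {u : A} {xs} → u ∈ xs → (u ∷ xs) ⊆ xs
  ∷-absorb u∈ (here ≡.refl) = u∈
  ∷-absorb u∈ (there p)     = p

  F-absorb : ∀ {u xs} → u ∈ xs → F (u ∷ xs) ≈ F xs
  F-absorb u∈ = F-cong (∷-absorb u∈) there

  -- By diminishing returns an element that raises F by at most τ/κ at S does so at every superset
  -- of S, so the elements of `xs` can be added to `ys` one at a time. Elements already present cost
  -- nothing.
  F-rejected : ∀ {κ τ S ys} xs → 0# ≤ κ → 0# ≤ τ → S ⊆ ys →
    All (λ u → κ * F (u ∷ S) ≤ κ * F S + τ) xs →
    κ * F (xs ++ ys) ≤ κ * F ys + fromℕ (length xs) * τ
  F-rejected {κ} {τ} {S} {ys} [] 0≤κ 0≤τ S⊆ [] =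
    ≤-reflexive (sym (trans (+-congˡ (zeroˡ τ)) (+-identityʳ _)))
  F-rejected {κ} {τ} {S} {ys} (u ∷ xs) 0≤κ 0≤τ S⊆ (r ∷ rs) with u ∈? (xs ++ ys)
  ... | yes u∈ = begin
    κ * F (u ∷ xs ++ ys)                      ≈⟨ *-congˡ (F-absorb u∈) ⟩
    κ * F (xs ++ ys)                          ≤⟨ F-rejected xs 0≤κ 0≤τ S⊆ rs ⟩
    κ * F ys + fromℕ (length xs) * τ          ≤⟨ +-monoʳ-≤ _ (*-monoʳ-≤ 0≤τ (≤-+ˡ 0≤1)) ⟩
    κ * F ys + (1# + fromℕ (length xs)) * τ   ∎
    where open ≤-Reasoning
  ... | no u∉ = +-cancelʳ-≤ (κ * F S) (begin
    κ * F (u ∷ xs ++ ys) + κ * F S            ≈⟨ distribˡ κ _ _ ⟨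
    κ * (F (u ∷ xs ++ ys) + F S)              ≤⟨ *-monoˡ-≤ 0≤κ (F-diminishing u∉ (∈-++⁺ʳ xs ∘ S⊆)) ⟩
    κ * (F (xs ++ ys) + F (u ∷ S))            ≈⟨ distribˡ κ _ _ ⟩
    κ * F (xs ++ ys) + κ * F (u ∷ S)          ≤⟨ +-mono-≤ (F-rejected xs 0≤κ 0≤τ S⊆ rs) r ⟩
    κ * F ys + fromℕ (length xs) * τ + (κ * F S + τ)
      ≈⟨ solve 4 (λ a l t b → a :+ l :* t :+ (b :+ t) := a :+ (con 1 :+ l) :* t :+ b) refl (κ * F ys) (fromℕ (length xs)) τ (κ * F S) ⟩
    κ * F ys + (1# + fromℕ (length xs)) * τ + κ * F S ∎)
    where open ≤-Reasoning

  -- Marginal values at `ys` dominate those at the larger sets met while `xs` is added. Subtraction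
  -- is avoided by placing one copy of `F ys` per element on the left.
  F-marginals : ∀ xs ys → Unique xs →
    F (xs ++ ys) + fromℕ (length xs) * F ys ≤ F ys + sumOf (λ u → F (u ∷ ys)) xs
  F-marginals []       ys _ = ≤-reflexive (+-congˡ (zeroˡ _))
  F-marginals (u ∷ xs) ys us@(_ ∷ us′) = begin
    F (u ∷ xs ++ ys) + (1# + l) * F ys          ≈⟨ solve 3 (λ a l b → a :+ (con 1 :+ l) :* b := (a :+ b) :+ l :* b) refl (F (u ∷ xs ++ ys)) l (F ys) ⟩
    (F (u ∷ xs ++ ys) + F ys) + l * F ys        ≤⟨ +-monoˡ-≤ _ step ⟩
    (F (xs ++ ys) + F (u ∷ ys)) + l * F ys      ≈⟨ solve 3 (λ a b c → a :+ b :+ c := b :+ (a :+ c)) refl (F (xs ++ ys)) (F (u ∷ ys)) (l * F ys) ⟩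
    F (u ∷ ys) + (F (xs ++ ys) + l * F ys)      ≤⟨ +-monoʳ-≤ _ (F-marginals xs ys us′) ⟩
    F (u ∷ ys) + (F ys + s)                     ≈⟨ solve 3 (λ a b c → a :+ (b :+ c) := b :+ (a :+ c)) refl (F (u ∷ ys)) (F ys) s ⟩
    F ys + (F (u ∷ ys) + s)                     ∎
    where
    open ≤-Reasoning
    l = fromℕ (length xs)
    s = sumOf (λ u → F (u ∷ ys)) xs
    step : F (u ∷ xs ++ ys) + F ys ≤ F (xs ++ ys) + F (u ∷ ys)
    step with u ∈? ys
    ... | yes u∈ = ≤-reflexive (+-cong (F-absorb (∈-++⁺ʳ xs u∈)) (sym (F-absorb u∈)))
    ... | no u∉  = F-diminishing (λ p → [ Unique-head-∉ us , u∉ ]′ (∈-++⁻ xs p)) (∈-++⁺ʳ xs)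

  -- The set `l ∪ X` and the union of X with the later sets meet only in X, so submodularity splits
  -- off one set at a time. Dropping the value of the full union shows that the average of
  -- `F (l ++ X)` over m disjoint sets is at least (1 - 1/m) F(X).
  F-disjoint : ∀ Ls X → AllPairs Disjoint Ls →
    fromℕ (length Ls) * F X + F (concat Ls ++ X) ≤ sumOf (λ l → F (l ++ X)) Ls + F X
  F-disjoint [] X _ = ≤-reflexive (+-congʳ (zeroˡ _))
  F-disjoint (l ∷ Ls) X (l∩ ∷ ps) = begin
    (1# + s) * F X + F ((l ++ concat Ls) ++ X)  ≈⟨ solve 3 (λ s x y → (con 1 :+ s) :* x :+ y := s :* x :+ (y :+ x)) refl s (F X) (F ((l ++ concat Ls) ++ X)) ⟩
    s * F X + (F ((l ++ concat Ls) ++ X) + F X) ≤⟨ +-monoʳ-≤ _ (F-submodular (l ++ X) (concat Ls ++ X) ((l ++ concat Ls) ++ X) X ⊆₁ ⊆₂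
                                                     (λ p → ∈-++⁺ʳ l p , ∈-++⁺ʳ (concat Ls) p) inter) ⟩
    s * F X + (F (l ++ X) + F (concat Ls ++ X)) ≈⟨ solve 3 (λ a b c → a :+ (b :+ c) := b :+ (a :+ c)) refl (s * F X) (F (l ++ X)) (F (concat Ls ++ X)) ⟩
    F (l ++ X) + (s * F X + F (concat Ls ++ X)) ≤⟨ +-monoʳ-≤ _ (F-disjoint Ls X ps) ⟩
    F (l ++ X) + (sumOf (λ l → F (l ++ X)) Ls + F X) ≈⟨ +-assoc _ _ _ ⟨
    F (l ++ X) + sumOf (λ l → F (l ++ X)) Ls + F X ∎
    where
    open ≤-Reasoning
    s = fromℕ (length Ls)
    ⊆₁ : ((l ++ concat Ls) ++ X) ⊆ ((l ++ X) ++ (concat Ls ++ X))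
    ⊆₁ p with ∈-++⁻ (l ++ concat Ls) p
    ... | inj₂ q = ∈-++⁺ˡ (∈-++⁺ʳ l q)
    ... | inj₁ q with ∈-++⁻ l q
    ...   | inj₁ r = ∈-++⁺ˡ (∈-++⁺ˡ r)
    ...   | inj₂ r = ∈-++⁺ʳ (l ++ X) (∈-++⁺ˡ r)
    ⊆₂ : ((l ++ X) ++ (concat Ls ++ X)) ⊆ ((l ++ concat Ls) ++ X)
    ⊆₂ p with ∈-++⁻ (l ++ X) p
    ... | inj₁ q with ∈-++⁻ l q
    ...   | inj₁ r = ∈-++⁺ˡ (∈-++⁺ˡ r)
    ...   | inj₂ r = ∈-++⁺ʳ (l ++ concat Ls) r
    ⊆₂ p | inj₂ q with ∈-++⁻ (concat Ls) q
    ...   | inj₁ r = ∈-++⁺ˡ (∈-++⁺ʳ l r)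
    ...   | inj₂ r = ∈-++⁺ʳ (l ++ concat Ls) r
    inter : ∀ {x} → x ∈ (l ++ X) → x ∈ (concat Ls ++ X) → x ∈ X
    inter p q with ∈-++⁻ l p | ∈-++⁻ (concat Ls) q
    ... | inj₂ r | _      = r
    ... | inj₁ _ | inj₂ r = r
    ... | inj₁ r | inj₁ s with ∈-concat⁻′ Ls s
    ...   | l′ , x∈l′ , l′∈ = contradiction x∈l′ (All.lookup l∩ l′∈ _ r)

  -- Refusing a candidate that would lower F replaces the dummy elements of marginal value zero with
  -- which random greedy is usually equipped.
  pick : List A → A → List A
  pick S u = if ⌊ F S ≤? F (u ∷ S) ⌋ then u ∷ S else S

  pick-⊆ : ∀ S u → pick S u ⊆ (u ∷ S)
  pick-⊆ S u with F S ≤? F (u ∷ S)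
  ... | yes _ = id
  ... | no _  = there

  ⊆-pick : ∀ S u → S ⊆ pick S u
  ⊆-pick S u with F S ≤? F (u ∷ S)
  ... | yes _ = there
  ... | no _  = id

  F-pick : ∀ S u → F (u ∷ S) ≤ F (pick S u)
  F-pick S u with F S ≤? F (u ∷ S)
  ... | yes _ = ≤-refl
  ... | no p  = ≰⇒≥ p

  F-pick′ : ∀ S u → F S ≤ F (pick S u)
  F-pick′ S u with F S ≤? F (u ∷ S)
  ... | yes p = p
  ... | no _  = ≤-refl

  length-pick : ∀ S u → length (pick S u) ℕ.≤ suc (length S)
  length-pick S u with F S ≤? F (u ∷ S)
  ... | yes _ = ℕ.≤-refl
  ... | no _  = ℕ.n≤1+n _

  -- A uniform choice of u from M costs in expectation at most a 1/|M| fraction of F(X ∪ S). The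
  -- parts that `pick` adds for different u are disjoint, so `F-disjoint` applies.
  F-pick-disjoint : ∀ M S X → Unique M →
    fromℕ (length M) * F (X ++ S) ≤ sumOf (λ u → F (X ++ pick S u)) M + F (X ++ S)
  F-pick-disjoint M S X us = begin
    fromℕ (length M) * F (X ++ S)                ≤⟨ ≤-+ʳ (F-nonNeg _) ⟩
    fromℕ (length M) * F (X ++ S) + F (concat Ls ++ (X ++ S)) ≈⟨ +-congʳ (*-congʳ (reflexive (≡.cong fromℕ (List.length-map single M)))) ⟨
    fromℕ (length Ls) * F (X ++ S) + F (concat Ls ++ (X ++ S)) ≤⟨ F-disjoint Ls (X ++ S) (disjoint us) ⟩
    sumOf (λ l → F (l ++ (X ++ S))) Ls + F (X ++ S) ≈⟨ +-congʳ (sums M) ⟩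
    sumOf (λ u → F (X ++ pick S u)) M + F (X ++ S) ∎
    where
    open ≤-Reasoning
    single : A → List A
    single u = filter (_∈? pick S u) (u ∷ [])
    Ls = map single M
    single-∈ : ∀ {u x} → x ∈ single u → x ≡ u
    single-∈ {u} p with ∈-filter⁻ (_∈? pick S u) {xs = u ∷ []} p
    ... | here eq , _ = eq
    disjoint : ∀ {M} → Unique M → AllPairs Disjoint (map single M)
    disjoint []        = []
    disjoint {u ∷ _} (x∉ ∷ us) = All.map⁺ (All.map
      (λ {v} u≢v x p q → u≢v (≡.trans (≡.sym (single-∈ {u} p)) (single-∈ {v} q))) x∉) ∷ disjoint us
    eqF : ∀ u → F (single u ++ (X ++ S)) ≈ F (X ++ pick S u)
    eqF u = F-cong to from
      where
      to : (single u ++ (X ++ S)) ⊆ (X ++ pick S u)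
      to p with ∈-++⁻ (single u) p
      ... | inj₁ q = ∈-++⁺ʳ X (proj₂ (∈-filter⁻ (_∈? pick S u) {xs = u ∷ []} q))
      ... | inj₂ q with ∈-++⁻ X q
      ...   | inj₁ r = ∈-++⁺ˡ r
      ...   | inj₂ r = ∈-++⁺ʳ X (⊆-pick S u r)
      from : (X ++ pick S u) ⊆ (single u ++ (X ++ S))
      from p with ∈-++⁻ X p
      ... | inj₁ q = ∈-++⁺ʳ (single u) (∈-++⁺ˡ q)
      ... | inj₂ q with pick-⊆ S u q
      ...   | here ≡.refl = ∈-++⁺ˡ (∈-filter⁺ (_∈? pick S u) (here ≡.refl) q)
      ...   | there r     = ∈-++⁺ʳ (single u) (∈-++⁺ʳ X r)
    sums : ∀ M → sumOf (λ l → F (l ++ (X ++ S))) (map single M) ≈ sumOf (λ u → F (X ++ pick S u)) M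
    sums []      = refl
    sums (u ∷ M) = +-cong (eqF u) (sums M)

  module TopElements (S : List A) where

    private
      g ĝ : A → Carrier
      g u = F (u ∷ S)
      ĝ u = F (pick S u)

    sumOf-↭ : ∀ {xs ys} (h : A → Carrier) → xs ↭ ys → sumOf h xs ≈ sumOf h ys
    sumOf-↭ h ↭-id         = refl
    sumOf-↭ h (prep x p)   = +-congˡ (sumOf-↭ h p)
    sumOf-↭ h (swap {xs} x y p) = trans (solve 3 (λ a b c → a :+ (b :+ c) := b :+ (a :+ c)) refl (h x) (h y) (sumOf h xs))
      (+-congˡ (+-congˡ (sumOf-↭ h p)))
    sumOf-↭ h (↭-then p q) = trans (sumOf-↭ h p) (sumOf-↭ h q)

    -- Members of X inside M are matched with themselves, where `g u ≤ ĝ u`. An unmatched member of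
    -- X contributes at most ϑ, an unmatched member of M at least ϑ; the added copies of ϑ balance
    -- the two sides.
    exchange : ∀ {R ϑ} → All (λ w → g w ≤ ϑ) R → ∀ M X → All (λ u → ϑ ≤ ĝ u) M → Unique X → X ⊆ (M ++ R) →
      sumOf g X + fromℕ (length M) * ϑ ≤ sumOf ĝ M + fromℕ (length X) * ϑ
    exchange {R} {ϑ} R≤ [] [] _ _ _ = ≤-refl
    exchange {R} {ϑ} R≤ [] (x ∷ X) _ (_ ∷ us) X⊆ = begin
      g x + sumOf g X + 0# * ϑ               ≈⟨ +-assoc _ _ _ ⟩
      g x + (sumOf g X + 0# * ϑ)             ≤⟨ +-mono-≤ (All.lookup R≤ (X⊆ (here ≡.refl))) (exchange R≤ [] X [] us (X⊆ ∘ there)) ⟩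
      ϑ + (0# + fromℕ (length X) * ϑ)        ≈⟨ solve 3 (λ a l z → a :+ (z :+ l :* a) := z :+ (con 1 :+ l) :* a) refl ϑ (fromℕ (length X)) 0# ⟩
      0# + (1# + fromℕ (length X)) * ϑ       ∎
      where open ≤-Reasoning
    exchange {R} {ϑ} R≤ (u ∷ M) X (ϑ≤ ∷ ϑ≤s) us X⊆ with u ∈? X
    ... | yes u∈ with ∈⇒↭ u∈
    ...   | X′ , p with Unique-resp-↭ p us
    ...     | us′@(_ ∷ us″) = begin
      sumOf g X + (1# + fromℕ (length M)) * ϑ             ≈⟨ +-congʳ (sumOf-↭ g p) ⟩
      (g u + sumOf g X′) + (1# + fromℕ (length M)) * ϑ    ≈⟨ solve 4 (λ a s l t → (a :+ s) :+ (con 1 :+ l) :* t := (a :+ t) :+ (s :+ l :* t)) refl (g u) (sumOf g X′) (fromℕ (length M)) ϑ ⟩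
      (g u + ϑ) + (sumOf g X′ + fromℕ (length M) * ϑ)     ≤⟨ +-mono-≤ (+-monoˡ-≤ ϑ (F-pick S u)) (exchange R≤ M X′ ϑ≤s us″ X′⊆) ⟩
      (ĝ u + ϑ) + (sumOf ĝ M + fromℕ (length X′) * ϑ)     ≈⟨ solve 4 (λ a s l t → (a :+ t) :+ (s :+ l :* t) := (a :+ s) :+ (con 1 :+ l) :* t) refl (ĝ u) (sumOf ĝ M) (fromℕ (length X′)) ϑ ⟩
      (ĝ u + sumOf ĝ M) + (1# + fromℕ (length X′)) * ϑ    ≈⟨ +-congˡ (*-congʳ (reflexive (≡.cong fromℕ (↭-length p)))) ⟨
      (ĝ u + sumOf ĝ M) + fromℕ (length X) * ϑ            ∎
      where
      open ≤-Reasoning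
      X′⊆ : X′ ⊆ (M ++ R)
      X′⊆ = ⊆-drop (Unique-head-∉ us′) (X⊆ ∘ ∈-resp-↭ (↭-sym p) ∘ there)
    exchange {R} {ϑ} R≤ (u ∷ M) X (ϑ≤ ∷ ϑ≤s) us X⊆ | no u∉ = begin
      sumOf g X + (1# + fromℕ (length M)) * ϑ             ≈⟨ solve 3 (λ s l t → s :+ (con 1 :+ l) :* t := t :+ (s :+ l :* t)) refl (sumOf g X) (fromℕ (length M)) ϑ ⟩
      ϑ + (sumOf g X + fromℕ (length M) * ϑ)              ≤⟨ +-mono-≤ ϑ≤ (exchange R≤ M X ϑ≤s us (⊆-drop u∉ X⊆)) ⟩
      ĝ u + (sumOf ĝ M + fromℕ (length X) * ϑ)            ≈⟨ +-assoc _ _ _ ⟨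
      (ĝ u + sumOf ĝ M) + fromℕ (length X) * ϑ            ∎
      where open ≤-Reasoning

    minimum : ∀ u M → ∃[ w ] w ∈ (u ∷ M) × All (λ x → ĝ w ≤ ĝ x) (u ∷ M)
    minimum u []      = u , here ≡.refl , ≤-refl ∷ []
    minimum u (x ∷ M) with minimum x M
    ... | w , w∈ , w≤ with total (ĝ u) (ĝ w)
    ...   | inj₁ p = u , here ≡.refl , ≤-refl ∷ All.map (≤-trans p) w≤
    ...   | inj₂ p = w , there w∈ , p ∷ w≤

    -- Over a mixture of sets X the coefficient of δ averages to at most |M|,
    -- so that δ cancels.
    threshold : ∀ u M R → All (λ w → All (λ x → g w ≤ g x) (u ∷ M)) R → ∃[ δ ] 0# ≤ δ ×
      (∀ X → Unique X → X ⊆ ((u ∷ M) ++ R) →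
        F (X ++ S) + fromℕ (length (u ∷ M)) * (F S + δ) ≤ F S + fromℕ (length X) * δ + sumOf ĝ (u ∷ M))
    threshold u M R top with minimum u M
    ... | w , w∈ , w≤ = δ , x≤y⇒0≤y-x (F-pick′ S w) , λ X us X⊆ →
      +-cancelʳ-≤ (fromℕ (length X) * F S) (begin
        F (X ++ S) + κ * (F S + δ) + fromℕ (length X) * F S     ≈⟨ solve 3 (λ a b c → a :+ b :+ c := (a :+ c) :+ b) refl _ _ _ ⟩
        (F (X ++ S) + fromℕ (length X) * F S) + κ * (F S + δ)   ≤⟨ +-monoˡ-≤ _ (F-marginals X S us) ⟩
        (F S + sumOf g X) + κ * (F S + δ)                       ≈⟨ +-assoc _ _ _ ⟩
        F S + (sumOf g X + κ * (F S + δ))                       ≈⟨ +-congˡ (+-congˡ (*-congˡ eq)) ⟩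
        F S + (sumOf g X + κ * ĝ w)                             ≤⟨ +-monoʳ-≤ _ (exchange R≤ (u ∷ M) X w≤ us X⊆) ⟩
        F S + (sumOf ĝ (u ∷ M) + fromℕ (length X) * ĝ w)        ≈⟨ +-congˡ (+-congˡ (*-congˡ eq)) ⟨
        F S + (sumOf ĝ (u ∷ M) + fromℕ (length X) * (F S + δ))  ≈⟨ solve 4 (λ a b l d → a :+ (b :+ l :* (a :+ d)) := a :+ l :* d :+ b :+ l :* a) refl (F S) (sumOf ĝ (u ∷ M)) (fromℕ (length X)) δ ⟩
        F S + fromℕ (length X) * δ + sumOf ĝ (u ∷ M) + fromℕ (length X) * F S ∎)
      where
      open ≤-Reasoning
      -- The gain of the weakest member of M. It is nonnegative because `pick` never lowers F.
      δ = ĝ w - F S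
      κ = fromℕ (length (u ∷ M))
      eq : F S + δ ≈ ĝ w
      eq = -‿cancelʳ (F S) (ĝ w)
      R≤ : All (λ y → g y ≤ ĝ w) R
      R≤ = All.map (λ ps → ≤-trans (All.lookup ps w∈) (F-pick S w)) top

-- Random greedy

module NatBounds where
  open import Data.Nat using (_+_; _*_; _^_; _≤_)

  -- (1 + 1/j)^i ≤ 1 + i/j + i²/j² for i ≤ j, multiplied out.
  [1+j]^i-bound : ∀ j i → i ≤ j → suc j ^ i * (j * j) ≤ j ^ i * (j * j + i * j + i * i)
  [1+j]^i-bound j zero    _    = ℕ.≤-reflexive (lemma j)
    where
    lemma : ∀ j → 1 * (j * j) ≡ 1 * (j * j + 0 * j + 0 * 0)
    lemma = solve-∀
  [1+j]^i-bound j (suc i) i<j = begin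
    suc j * suc j ^ i * (j * j)                         ≡⟨ ℕ.*-assoc (suc j) (suc j ^ i) (j * j) ⟩
    suc j * (suc j ^ i * (j * j))                       ≤⟨ ℕ.*-monoʳ-≤ (suc j) ([1+j]^i-bound j i (ℕ.<⇒≤ i<j)) ⟩
    suc j * (j ^ i * (j * j + i * j + i * i))           ≡⟨ lemma₁ j i (j ^ i) ⟩
    j ^ i * (suc j * (j * j + i * j) + i * i * j + i * i) ≤⟨ ℕ.*-monoʳ-≤ (j ^ i) (ℕ.+-monoʳ-≤ (suc j * (j * j + i * j) + i * i * j) (ℕ.*-monoʳ-≤ i (ℕ.<⇒≤ i<j))) ⟩
    j ^ i * (suc j * (j * j + i * j) + i * i * j + i * j) ≤⟨ ℕ.*-monoʳ-≤ (j ^ i) (ℕ.m≤m+n _ j) ⟩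
    j ^ i * (suc j * (j * j + i * j) + i * i * j + i * j + j) ≡⟨ lemma₂ j i (j ^ i) ⟩
    j * j ^ i * (j * j + suc i * j + suc i * suc i)     ∎
    where
    open ℕ.≤-Reasoning
    lemma₁ : ∀ j i p → suc j * (p * (j * j + i * j + i * i)) ≡ p * (suc j * (j * j + i * j) + i * i * j + i * i)
    lemma₁ = solve-∀
    lemma₂ : ∀ j i p → p * (suc j * (j * j + i * j) + i * i * j + i * j + j) ≡ j * p * (j * j + suc i * j + suc i * suc i)
    lemma₂ = solve-∀

  -- At i = j the three summands of the preceding bound coincide; thus 3 takes the place of e.
  [1+j]^j≤3j^j : ∀ j → suc j ^ j ≤ 3 * j ^ j
  [1+j]^j≤3j^j zero      = s≤s z≤n
  [1+j]^j≤3j^j j@(suc _) = ℕ.*-cancelʳ-≤ (suc j ^ j) (3 * j ^ j) (j * j) (begin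
    suc j ^ j * (j * j)               ≤⟨ [1+j]^i-bound j j ℕ.≤-refl ⟩
    j ^ j * (j * j + j * j + j * j)   ≡⟨ lemma j (j ^ j) ⟩
    3 * j ^ j * (j * j)               ∎)
    where
    open ℕ.≤-Reasoning
    lemma : ∀ j p → p * (j * j + j * j + j * j) ≡ 3 * p * (j * j)
    lemma = solve-∀

  -- In closed form i jⁱ⁻¹.
  coefficient : ℕ → ℕ → ℕ
  coefficient j zero    = 0
  coefficient j (suc i) = j * coefficient j i + j ^ i

  coefficient-suc : ∀ j i → coefficient j (suc i) ≡ suc i * j ^ i
  coefficient-suc j zero    = ≡.cong (_+ 1) (ℕ.*-zeroʳ j)
  coefficient-suc j (suc i) = ≡.trans (≡.cong (λ a → j * a + j ^ suc i) (coefficient-suc j i)) (lemma j i (j ^ i))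
    where
    lemma : ∀ j i p → j * (suc i * p) + j * p ≡ suc (suc i) * (j * p)
    lemma = solve-∀

  -- For κ = j + 1 the coefficient is κ jʲ, so this is (1 + 1/j)ʲ ≤ 3 in disguise. It gives H a
  -- weight of at least 1/3 in the initial potential.
  κ^κ≤3coefficient : ∀ j → suc j ^ suc j ≤ 3 * coefficient j (suc j)
  κ^κ≤3coefficient j = begin
    suc j * suc j ^ j             ≤⟨ ℕ.*-monoʳ-≤ (suc j) ([1+j]^j≤3j^j j) ⟩
    suc j * (3 * j ^ j)           ≡⟨ lemma j (j ^ j) ⟩
    3 * (suc j * j ^ j)           ≡⟨ ≡.cong (3 *_) (coefficient-suc j j) ⟨
    3 * coefficient j (suc j)     ∎
    where
    open ℕ.≤-Reasoning
    lemma : ∀ j p → suc j * (3 * p) ≡ 3 * (suc j * p)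
    lemma = solve-∀

open NatBounds

module RandomGreedyAnalysis {c ℓ₁ ℓ₂} {𝕂 : OrderedField c ℓ₁ ℓ₂} {n : ℕ} (𝔽 : SubmodularFunction 𝕂 n) where
  open OrderedField 𝕂 hiding (zero)
  open SubmodularFunction 𝔽
  open OrderedFieldProperties 𝕂
  open SubmodularProperties 𝔽
  open DecMembership (Fin._≟_ {n}) using (_∈?_)

  private
    A : Set
    A = Fin n

  -- A random set given by unnormalised natural weights, which keeps weights and sizes inside the
  -- natural numbers until the final division by the total weight.
  Mixture : Set
  Mixture = List (ℕ × List A)

  total-weight : Mixture → ℕ
  total-weight []             = 0
  total-weight ((w , _) ∷ ws) = w ℕ.+ total-weight ws

  total-size : Mixture → ℕ
  total-size []             = 0
  total-size ((w , X) ∷ ws) = w ℕ.* length X ℕ.+ total-size ws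

  H : Mixture → List A → Carrier
  H []             S = 0#
  H ((w , X) ∷ ws) S = fromℕ w * F (X ++ S) + H ws S

  H-nonNeg : ∀ ws S → 0# ≤ H ws S
  H-nonNeg []             S = ≤-refl
  H-nonNeg ((w , X) ∷ ws) S = +-nonNeg (*-nonNeg (fromℕ-nonNeg w) (F-nonNeg _)) (H-nonNeg ws S)

  Inside : List A → Mixture → Set
  Inside P = All (λ (_ , X) → Unique X × X ⊆ P)

  H-pick : ∀ ws S M → Unique M → fromℕ (length M) * H ws S ≤ sumOf (λ u → H ws (pick S u)) M + H ws S
  H-pick [] S M us = ≤-trans (≤-reflexive (zeroʳ _)) (+-nonNeg (sumOf-nonNeg M) ≤-refl)
    where
    sumOf-nonNeg : ∀ (M : List A) → 0# ≤ sumOf (λ _ → 0#) M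
    sumOf-nonNeg []      = ≤-refl
    sumOf-nonNeg (_ ∷ M) = +-nonNeg ≤-refl (sumOf-nonNeg M)
  H-pick ((w , X) ∷ ws) S M us = begin
    l * (fromℕ w * F (X ++ S) + H ws S)                 ≈⟨ solve 4 (λ l w a b → l :* (w :* a :+ b) := w :* (l :* a) :+ l :* b) refl l (fromℕ w) (F (X ++ S)) (H ws S) ⟩
    fromℕ w * (l * F (X ++ S)) + l * H ws S             ≤⟨ +-mono-≤ (*-monoˡ-≤ (fromℕ-nonNeg w) (F-pick-disjoint M S X us)) (H-pick ws S M us) ⟩
    fromℕ w * (s₁ + F (X ++ S)) + (s₂ + H ws S)         ≈⟨ solve 5 (λ w a b c d → w :* (a :+ b) :+ (c :+ d) := (w :* a :+ c) :+ (w :* b :+ d)) refl (fromℕ w) s₁ (F (X ++ S)) s₂ (H ws S) ⟩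
    (fromℕ w * s₁ + s₂) + (fromℕ w * F (X ++ S) + H ws S) ≈⟨ +-congʳ (trans (sumOf-+ _ _ M) (+-congʳ (sumOf-* (fromℕ w) _ M))) ⟨
    sumOf (λ u → fromℕ w * F (X ++ pick S u) + H ws (pick S u)) M + (fromℕ w * F (X ++ S) + H ws S) ∎
    where
    open ≤-Reasoning
    l = fromℕ (length M)
    s₁ = sumOf (λ u → F (X ++ pick S u)) M
    s₂ = sumOf (λ u → H ws (pick S u)) M

  -- Summing `TopElements.threshold` over the mixture leaves δ times the total size on one side and
  -- δ times κ times the total weight on the other. Since δ is nonnegative, only the mean size has
  -- to be at most κ.
  H-gain : ∀ ws S u M R → Inside ((u ∷ M) ++ R) ws →
    All (λ w → All (λ x → F (w ∷ S) ≤ F (x ∷ S)) (u ∷ M)) R →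
    total-size ws ℕ.≤ total-weight ws ℕ.* suc (length M) →
    H ws S + fromℕ (total-weight ws) * (fromℕ (length M) * F S)
      ≤ fromℕ (total-weight ws) * sumOf (λ x → F (pick S x)) (u ∷ M)
  H-gain ws S u M R ins top size≤ with TopElements.threshold S u M R top
  ... | δ , 0≤δ , bound = +-cancelʳ-≤ (W * (F S + κ * δ)) (begin
    H ws S + W * (fromℕ (length M) * F S) + W * (F S + κ * δ)   ≈⟨ solve 5 (λ h w l f d → h :+ w :* (l :* f) :+ w :* (f :+ (con 1 :+ l) :* d) := h :+ w :* ((con 1 :+ l) :* (f :+ d))) refl (H ws S) W (fromℕ (length M)) (F S) δ ⟩
    H ws S + W * (κ * (F S + δ))                                ≤⟨ mix ws ins ⟩
    W * F S + fromℕ (total-size ws) * δ + W * G                 ≤⟨ +-monoˡ-≤ _ (+-monoʳ-≤ _ (*-monoʳ-≤ 0≤δ (≤-trans (fromℕ-mono size≤) (≤-reflexive (fromℕ-* (total-weight ws) (suc (length M))))))) ⟩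
    W * F S + (W * κ) * δ + W * G                               ≈⟨ solve 5 (λ w f k d g → w :* f :+ (w :* k) :* d :+ w :* g := w :* g :+ w :* (f :+ k :* d)) refl W (F S) κ δ G ⟩
    W * G + W * (F S + κ * δ)                                   ∎)
    where
    open ≤-Reasoning
    W = fromℕ (total-weight ws)
    κ = fromℕ (suc (length M))
    G = sumOf (λ x → F (pick S x)) (u ∷ M)
    mix : ∀ ws → Inside ((u ∷ M) ++ R) ws → H ws S + fromℕ (total-weight ws) * (κ * (F S + δ))
      ≤ fromℕ (total-weight ws) * F S + fromℕ (total-size ws) * δ + fromℕ (total-weight ws) * G
    mix [] [] = ≤-reflexive (trans (trans (+-identityˡ _) (zeroˡ _))
      (sym (trans (+-cong (trans (+-cong (zeroˡ _) (zeroˡ _)) (+-identityˡ _)) (zeroˡ _)) (+-identityˡ _))))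
    mix ((w , X) ∷ ws) ((us , X⊆) ∷ ins) = begin
      (ω * F (X ++ S) + H ws S) + fromℕ (w ℕ.+ total-weight ws) * (κ * (F S + δ)) ≈⟨ +-congˡ (*-congʳ (fromℕ-+ w _)) ⟩
      (ω * F (X ++ S) + H ws S) + (ω + Ω) * (κ * (F S + δ))  ≈⟨ solve 5 (λ w a h o z → (w :* a :+ h) :+ (w :+ o) :* z := w :* (a :+ z) :+ (h :+ o :* z)) refl ω (F (X ++ S)) (H ws S) Ω (κ * (F S + δ)) ⟩
      ω * (F (X ++ S) + κ * (F S + δ)) + (H ws S + Ω * (κ * (F S + δ))) ≤⟨ +-mono-≤ (*-monoˡ-≤ (fromℕ-nonNeg w) (bound X us X⊆)) (mix ws ins) ⟩
      ω * (F S + fromℕ (length X) * δ + G) + (Ω * F S + fromℕ (total-size ws) * δ + Ω * G)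
        ≈⟨ solve 7 (λ w o f l d g s → w :* (f :+ l :* d :+ g) :+ (o :* f :+ s :* d :+ o :* g) := (w :+ o) :* f :+ (w :* l :+ s) :* d :+ (w :+ o) :* g) refl ω Ω (F S) (fromℕ (length X)) δ G (fromℕ (total-size ws)) ⟩
      (ω + Ω) * F S + (ω * fromℕ (length X) + fromℕ (total-size ws)) * δ + (ω + Ω) * G
        ≈⟨ +-cong (+-cong (*-congʳ (fromℕ-+ w _)) (*-congʳ (trans (fromℕ-+ (w ℕ.* length X) _) (+-congʳ (fromℕ-* w (length X)))))) (*-congʳ (fromℕ-+ w _)) ⟨
      fromℕ (w ℕ.+ total-weight ws) * F S + fromℕ (w ℕ.* length X ℕ.+ total-size ws) * δ + fromℕ (w ℕ.+ total-weight ws) * G ∎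
      where
      ω = fromℕ w
      Ω = fromℕ (total-weight ws)

  -- With κ = j + 1 and h = H/W, one iteration of random greedy guarantees (j F + h)/κ as the new
  -- mean of F and j h/κ as that of h. Iterating this linear recursion i times gives (j/κ)ⁱ F + i
  -- jⁱ⁻¹/κⁱ h, which is `potential i` once y is the inverse of the total weight.
  module Potential (ws : Mixture) (j : ℕ) (y : Carrier) (0≤y : 0# ≤ y) where

    private
      W x : Carrier
      W = fromℕ (total-weight ws)
      x = fromℕ (suc j) ⁻¹

      0≤x : 0# ≤ x
      0≤x = ⁻¹-nonNeg (fromℕ-pos j)

      p a : ℕ → Carrier
      p i = fromℕ (j ℕ.^ i)
      a i = fromℕ (coefficient j i)

    potential : ℕ → List A → Carrier
    potential i S = y * x ^ i * (p i * (W * F S) + a i * H ws S)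

    -- The coefficients of F and H are nonnegative, so the two one-step bounds `H-gain` and `H-pick`
    -- can be inserted. M is an arbitrary choice of κ best candidates, which allows any treatment of
    -- ties.
    potential-step : ∀ {P} i S M R → P ⊆ (M ++ R) → length M ≡ suc j → Unique M → Inside P ws →
      All (λ w → All (λ z → F (w ∷ S) ≤ F (z ∷ S)) M) R →
      total-size ws ℕ.≤ total-weight ws ℕ.* suc j →
      fromℕ (suc j) * potential (suc i) S ≤ sumOf (λ u → potential i (pick S u)) M
    potential-step i S (u ∷ M) R P⊆ ≡.refl us ins top size≤ = begin
      κ * (y * (x * x ^ i) * B)               ≈⟨ solve 5 (λ k y x z b → k :* (y :* (x :* z) :* b) := (x :* k) :* (y :* z :* b)) refl κ y x (x ^ i) B ⟩
      (x * κ) * (y * x ^ i * B)               ≈⟨ trans (*-congʳ (⁻¹-inverseˡ (fromℕ-pos j))) (*-identityˡ _) ⟩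
      y * x ^ i * B                           ≤⟨ *-monoˡ-≤ (*-nonNeg 0≤y (^-nonNeg i 0≤x)) main ⟩
      y * x ^ i * (p i * (W * G) + a i * K)   ≈⟨ *-congˡ (trans (sumOf-+ (λ v → p i * (W * F (pick S v))) (λ v → a i * H ws (pick S v)) (u ∷ M))
                                                  (+-cong (trans (sumOf-* (p i) (λ v → W * F (pick S v)) (u ∷ M)) (*-congˡ (sumOf-* W (λ v → F (pick S v)) (u ∷ M)))) (sumOf-* (a i) (λ v → H ws (pick S v)) (u ∷ M)))) ⟨
      y * x ^ i * sumOf (λ v → p i * (W * F (pick S v)) + a i * H ws (pick S v)) (u ∷ M) ≈⟨ sumOf-* (y * x ^ i) (λ v → p i * (W * F (pick S v)) + a i * H ws (pick S v)) (u ∷ M) ⟨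
      sumOf (λ v → potential i (pick S v)) (u ∷ M) ∎
      where
      open ≤-Reasoning
      κ = fromℕ (suc j)
      B = p (suc i) * (W * F S) + a (suc i) * H ws S
      G = sumOf (λ v → F (pick S v)) (u ∷ M)
      K = sumOf (λ v → H ws (pick S v)) (u ∷ M)
      J = fromℕ j
      main : B ≤ p i * (W * G) + a i * K
      main = begin
        p (suc i) * (W * F S) + a (suc i) * H ws S
          ≈⟨ +-cong (*-congʳ (fromℕ-* j (j ℕ.^ i))) (*-congʳ (trans (fromℕ-+ (j ℕ.* coefficient j i) (j ℕ.^ i)) (+-congʳ (fromℕ-* j (coefficient j i))))) ⟩
        (J * p i) * (W * F S) + (J * a i + p i) * H ws S
          ≈⟨ solve 6 (λ J p w f a h → (J :* p) :* (w :* f) :+ (J :* a :+ p) :* h := p :* (h :+ w :* (J :* f)) :+ a :* (J :* h)) refl J (p i) W (F S) (a i) (H ws S) ⟩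
        p i * (H ws S + W * (J * F S)) + a i * (J * H ws S)
          ≤⟨ +-mono-≤ (*-monoˡ-≤ (fromℕ-nonNeg (j ℕ.^ i)) (H-gain ws S u M R (All.map (λ (us , X⊆) → us , λ {z} z∈ → P⊆ (X⊆ z∈)) ins) top size≤))
                      (*-monoˡ-≤ (fromℕ-nonNeg (coefficient j i)) (+-cancelʳ-≤ (H ws S) (≤-trans (≤-reflexive (solve 2 (λ J h → J :* h :+ h := (con 1 :+ J) :* h) refl J (H ws S))) (H-pick ws S (u ∷ M) us)))) ⟩
        p i * (W * G) + a i * K ∎

    potential-zero : ∀ S → y * W ≈ 1# → potential 0 S ≈ F S
    potential-zero S yW≈1 = begin-equality
      y * 1# * ((1# + 0#) * (W * F S) + 0# * H ws S) ≈⟨ *-congˡ (+-cong (*-congʳ fromℕ-1) (zeroˡ _)) ⟩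
      y * 1# * (1# * (W * F S) + 0#)                 ≈⟨ *-cong (*-identityʳ y) (trans (+-identityʳ _) (*-identityˡ _)) ⟩
      y * (W * F S)                                  ≈⟨ *-assoc y W (F S) ⟨
      (y * W) * F S                                  ≈⟨ trans (*-congʳ yW≈1) (*-identityˡ _) ⟩
      F S                                            ∎
      where open ≤-Reasoning

    -- Only the H part is needed: its coefficient κ jʲ/κ^κ is at least 1/3, and the part with `F []`
    -- is nonnegative.
    potential-start : ∀ {v} → y * W ≈ 1# → fromℕ 3 * (W * v) ≤ H ws [] → v ≤ potential (suc j) []
    potential-start {v} yW≈1 3Wv≤H = *-cancelˡ-≤ (fromℕ-pos 2) (begin
      fromℕ 3 * v                           ≈⟨ *-congˡ (trans (*-congʳ yW≈1) (*-identityˡ v)) ⟨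
      fromℕ 3 * ((y * W) * v)               ≈⟨ solve 4 (λ t y w v → t :* ((y :* w) :* v) := y :* (t :* (w :* v))) refl (fromℕ 3) y W v ⟩
      y * (fromℕ 3 * (W * v))               ≤⟨ *-monoˡ-≤ 0≤y 3Wv≤H ⟩
      y * H ws []                           ≈⟨ *-congˡ (trans (*-congʳ (fromℕ-^-inverse (suc j) (suc j) (⁻¹-inverseˡ (fromℕ-pos j)))) (*-identityˡ _)) ⟨
      y * ((x ^ suc j * fromℕ (suc j ℕ.^ suc j)) * H ws []) ≤⟨ *-monoˡ-≤ 0≤y (*-monoʳ-≤ (H-nonNeg ws []) (*-monoˡ-≤ (^-nonNeg (suc j) 0≤x) (≤-trans (fromℕ-mono (κ^κ≤3coefficient j)) (≤-reflexive (fromℕ-* 3 (coefficient j (suc j))))))) ⟩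
      y * ((x ^ suc j * (fromℕ 3 * a (suc j))) * H ws []) ≈⟨ solve 5 (λ y x t a h → y :* ((x :* (t :* a)) :* h) := t :* (y :* x :* (a :* h))) refl y (x ^ suc j) (fromℕ 3) (a (suc j)) (H ws []) ⟩
      fromℕ 3 * (y * x ^ suc j * (a (suc j) * H ws [])) ≤⟨ *-monoˡ-≤ (fromℕ-nonNeg 3) (*-monoˡ-≤ (*-nonNeg 0≤y (^-nonNeg (suc j) 0≤x)) (≤-+ˡ (*-nonNeg (fromℕ-nonNeg (j ℕ.^ suc j)) (*-nonNeg (fromℕ-nonNeg (total-weight ws)) (F-nonNeg []))))) ⟩
      fromℕ 3 * potential (suc j) []        ∎)
      where open ≤-Reasoning

  -- The mixture that random greedy competes with: for each of the disjoint
  -- solutions S the set O₁ with weight e and S ∪ O₁ with weight o.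
  module Comparison (k : ℕ) .{{_ : NonZero k}} (P O : List A) (O-unique : Unique O) (∣O∣≤k : length O ℕ.≤ k) where

    O₁ O₂ : List A
    O₁ = filter (_∈? P) O
    O₂ = filter (¬? ∘ (_∈? P)) O

    private
      o e : ℕ
      o = length O₂
      e = k ℕ.∸ o

      split : ∀ (xs : List A) → length (filter (_∈? P) xs) ℕ.+ length (filter (¬? ∘ (_∈? P)) xs) ≡ length xs
      split []       = ≡.refl
      split (x ∷ xs) with x ∈? P
      ... | yes _ = ≡.cong suc (split xs)
      ... | no _  = ≡.trans (ℕ.+-suc _ _) (≡.cong suc (split xs))

      ∣O₁∣+o≤k : length O₁ ℕ.+ o ℕ.≤ k
      ∣O₁∣+o≤k = ℕ.≤-trans (ℕ.≤-reflexive (split O)) ∣O∣≤k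

      e+o≡k : e ℕ.+ o ≡ k
      e+o≡k = ℕ.m∸n+n≡m (ℕ.≤-trans (ℕ.m≤n+m o (length O₁)) ∣O₁∣+o≤k)

      ∣O₁∣≤e : length O₁ ℕ.≤ e
      ∣O₁∣≤e = ℕ.m+n≤o⇒m≤o∸n (length O₁) ∣O₁∣+o≤k

    -- The union of S and O₁ without repetitions, because sizes are measured as lengths of lists.
    join : List A → List A
    join S = S ++ filter (¬? ∘ (_∈? S)) O₁

    mixture : List (List A) → Mixture
    mixture []       = []
    mixture (S ∷ Ls) = (e , O₁) ∷ (o , join S) ∷ mixture Ls

    mixture-weight : ∀ Ls → total-weight (mixture Ls) ≡ length Ls ℕ.* k
    mixture-weight []       = ≡.refl
    mixture-weight (S ∷ Ls) = ≡.trans (≡.sym (ℕ.+-assoc e o _)) (≡.cong₂ ℕ._+_ e+o≡k (mixture-weight Ls))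

    private
      O₁⊆P : O₁ ⊆ P
      O₁⊆P p = proj₂ (∈-filter⁻ (_∈? P) {xs = O} p)

      O₁-unique : Unique O₁
      O₁-unique = Unique.filter⁺ (_∈? P) O-unique

      join-⊆ : ∀ S → join S ⊆ (S ++ O₁)
      join-⊆ S p with ∈-++⁻ S p
      ... | inj₁ q = ∈-++⁺ˡ q
      ... | inj₂ q = ∈-++⁺ʳ S (proj₁ (∈-filter⁻ (¬? ∘ (_∈? S)) {xs = O₁} q))

      ⊆-join : ∀ S → (S ++ O₁) ⊆ join S
      ⊆-join S {x} p with ∈-++⁻ S p
      ... | inj₁ q = ∈-++⁺ˡ q
      ... | inj₂ q with x ∈? S
      ...   | yes r = ∈-++⁺ˡ r
      ...   | no r  = ∈-++⁺ʳ S (∈-filter⁺ (¬? ∘ (_∈? S)) q r)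

    mixture-inside : ∀ Ls → All (λ S → Unique S × S ⊆ P) Ls → Inside P (mixture Ls)
    mixture-inside []       []                = []
    mixture-inside (S ∷ Ls) ((us , S⊆) ∷ ps) =
      (O₁-unique , O₁⊆P) ∷ (Unique.++⁺ us (Unique.filter⁺ (¬? ∘ (_∈? S)) O₁-unique)
        (λ (p , q) → proj₂ (∈-filter⁻ (¬? ∘ (_∈? S)) {xs = O₁} q) p) , join⊆P) ∷ mixture-inside Ls ps
      where
      join⊆P : join S ⊆ P
      join⊆P p with ∈-++⁻ S (join-⊆ S p)
      ... | inj₁ q = S⊆ q
      ... | inj₂ q = O₁⊆P q

    -- From |O₁| ≤ e and |S| ≤ k each S contributes at most e² + o (k + e), which equals k² since e
    -- + o = k. The mean size is therefore at most k even if S ∪ O₁ has more than k elements.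
    mixture-size : ∀ Ls → All (λ S → length S ℕ.≤ k) Ls → total-size (mixture Ls) ℕ.≤ length Ls ℕ.* k ℕ.* k
    mixture-size []       []        = z≤n
    mixture-size (S ∷ Ls) (S≤ ∷ ps) = begin
      e ℕ.* length O₁ ℕ.+ (o ℕ.* length (join S) ℕ.+ total-size (mixture Ls))
        ≤⟨ ℕ.+-mono-≤ (ℕ.*-monoʳ-≤ e ∣O₁∣≤e) (ℕ.+-mono-≤ (ℕ.*-monoʳ-≤ o join≤) (mixture-size Ls ps)) ⟩
      e ℕ.* e ℕ.+ (o ℕ.* (k ℕ.+ e) ℕ.+ length Ls ℕ.* k ℕ.* k)  ≡⟨ ≡.cong (λ k′ → e ℕ.* e ℕ.+ (o ℕ.* (k′ ℕ.+ e) ℕ.+ length Ls ℕ.* k ℕ.* k)) e+o≡k ⟨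
      e ℕ.* e ℕ.+ (o ℕ.* (e ℕ.+ o ℕ.+ e) ℕ.+ length Ls ℕ.* k ℕ.* k)  ≡⟨ lemma e o (length Ls ℕ.* k ℕ.* k) ⟩
      (e ℕ.+ o) ℕ.* (e ℕ.+ o) ℕ.+ length Ls ℕ.* k ℕ.* k ≡⟨ ≡.cong (λ k′ → k′ ℕ.* k′ ℕ.+ length Ls ℕ.* k ℕ.* k) e+o≡k ⟩
      k ℕ.* k ℕ.+ length Ls ℕ.* k ℕ.* k              ≡⟨ ℕ.*-distribʳ-+ k k (length Ls ℕ.* k) ⟨
      (k ℕ.+ length Ls ℕ.* k) ℕ.* k                  ∎
      where
      open ℕ.≤-Reasoning
      join≤ : length (join S) ℕ.≤ k ℕ.+ e
      join≤ = ℕ.≤-trans (ℕ.≤-reflexive (List.length-++ S)) (ℕ.+-mono-≤ S≤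
        (ℕ.≤-trans (List.length-filter (¬? ∘ (_∈? S)) O₁) ∣O₁∣≤e))
      lemma : ∀ e o s → e ℕ.* e ℕ.+ (o ℕ.* (e ℕ.+ o ℕ.+ e) ℕ.+ s) ≡ (e ℕ.+ o) ℕ.* (e ℕ.+ o) ℕ.+ s
      lemma = solve-∀

    module _ {b τ v : Carrier} (0≤τ : 0# ≤ τ) (b≤v : b ≤ v) (τ≤v : τ ≤ v) where

      -- An element of O inside P may owe its membership to another set of the group; rejection by S
      -- itself is required only outside P.
      Accepted : List A → Set (ℓ₂)
      Accepted S = F S ≤ b × All (λ u → u ∈ P ⊎ fromℕ k * F (u ∷ S) ≤ fromℕ k * F S + τ) O

      private
        K E U : Carrier
        K = fromℕ k
        E = fromℕ e
        U = fromℕ o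

        K≈ : K ≈ E + U
        K≈ = trans (reflexive (≡.cong fromℕ (≡.sym e+o≡k))) (fromℕ-+ e o)

        0<K : 0# < K
        0<K = fromℕ-pos′ k

        -- The two bounds are averaged with weights e and o. The error F(S) occurs only with weight
        -- e, whereas o τ / k occurs in both; altogether the loss is (e F(S) + o τ)/k, a mean of
        -- quantities that are at most v.
        component : ∀ S → Accepted S → K * F (S ++ O) ≤ (E * F (O₁ ++ []) + U * F (join S ++ [])) + K * v
        component S (FS≤b , acc) = *-cancelˡ-≤ 0<K (begin
          K * (K * X)                             ≈⟨ *-congʳ K≈ ⟩
          (E + U) * (K * X)                       ≈⟨ distribʳ (K * X) E U ⟩
          E * (K * X) + U * (K * X)               ≤⟨ +-mono-≤ (*-monoˡ-≤ (fromℕ-nonNeg e) bound₁) (*-monoˡ-≤ (fromℕ-nonNeg o) bound₂) ⟩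
          E * (K * a + (K * F S + U * τ)) + U * (K * d + U * τ)
            ≈⟨ solve 7 (λ E U K a f t d → E :* (K :* a :+ (K :* f :+ U :* t)) :+ U :* (K :* d :+ U :* t) := K :* (E :* a :+ U :* d) :+ (K :* (E :* f) :+ (E :+ U) :* (U :* t))) refl E U K a (F S) τ d ⟩
          K * (E * a + U * d) + (K * (E * F S) + (E + U) * (U * τ)) ≈⟨ +-congˡ (+-congˡ (*-congʳ (sym K≈))) ⟩
          K * (E * a + U * d) + (K * (E * F S) + K * (U * τ)) ≤⟨ +-monoʳ-≤ _ (+-mono-≤ (*-monoˡ-≤ (0<⇒0≤ 0<K) (*-monoˡ-≤ (fromℕ-nonNeg e) (≤-trans FS≤b b≤v)))
                                                                   (*-monoˡ-≤ (0<⇒0≤ 0<K) (*-monoˡ-≤ (fromℕ-nonNeg o) τ≤v))) ⟩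
          K * (E * a + U * d) + (K * (E * v) + K * (U * v)) ≈⟨ solve 5 (λ K Y E U v → K :* Y :+ (K :* (E :* v) :+ K :* (U :* v)) := K :* (Y :+ (E :+ U) :* v)) refl K (E * a + U * d) E U v ⟩
          K * ((E * a + U * d) + (E + U) * v)     ≈⟨ *-congˡ (+-congˡ (*-congʳ (sym K≈))) ⟩
          K * ((E * a + U * d) + K * v)           ∎)
          where
          open ≤-Reasoning
          X = F (S ++ O)
          a = F (O₁ ++ [])
          d = F (join S ++ [])
          rejected : All (λ u → K * F (u ∷ S) ≤ K * F S + τ) O₂
          rejected = All.tabulate λ {u} u∈ → let (u∈O , u∉P) = ∈-filter⁻ (¬? ∘ (_∈? P)) {xs = O} u∈ in
            [ (λ u∈P → contradiction u∈P u∉P) , id ]′ (All.lookup acc u∈O)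
          O⊆ : ∀ {x} → x ∈ O → x ∈ O₁ ⊎ x ∈ O₂
          O⊆ {x} p with x ∈? P
          ... | yes q = inj₁ (∈-filter⁺ (_∈? P) p q)
          ... | no q  = inj₂ (∈-filter⁺ (¬? ∘ (_∈? P)) p q)
          O₁⊆O : O₁ ⊆ O
          O₁⊆O p = proj₁ (∈-filter⁻ (_∈? P) {xs = O} p)
          O₂⊆O : O₂ ⊆ O
          O₂⊆O p = proj₁ (∈-filter⁻ (¬? ∘ (_∈? P)) {xs = O} p)
          -- Subadditivity detaches O₁ from O₂ ∪ S at the price of F(S); the second bound keeps S
          -- and pays only for the rejected elements.
          bound₁ : K * X ≤ K * a + (K * F S + U * τ)
          bound₁ = begin
            K * X                               ≈⟨ *-congˡ (F-cong to from) ⟩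
            K * F ((O₁ ++ []) ++ (O₂ ++ S))     ≤⟨ *-monoˡ-≤ (0<⇒0≤ 0<K) (F-++ (O₁ ++ []) (O₂ ++ S)) ⟩
            K * (a + F (O₂ ++ S))               ≈⟨ distribˡ K a _ ⟩
            K * a + K * F (O₂ ++ S)             ≤⟨ +-monoʳ-≤ _ (F-rejected O₂ (0<⇒0≤ 0<K) 0≤τ id rejected) ⟩
            K * a + (K * F S + U * τ)           ∎
            where
            to : (S ++ O) ⊆ ((O₁ ++ []) ++ (O₂ ++ S))
            to p with ∈-++⁻ S p
            ... | inj₁ q = ∈-++⁺ʳ (O₁ ++ []) (∈-++⁺ʳ O₂ q)
            ... | inj₂ q with O⊆ q
            ...   | inj₁ r = ∈-++⁺ˡ (∈-++⁺ˡ r)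
            ...   | inj₂ r = ∈-++⁺ʳ (O₁ ++ []) (∈-++⁺ˡ r)
            from : ((O₁ ++ []) ++ (O₂ ++ S)) ⊆ (S ++ O)
            from p with ∈-++⁻ (O₁ ++ []) p
            ... | inj₁ q = ∈-++⁺ʳ S (O₁⊆O ([ id , (λ ()) ]′ (∈-++⁻ O₁ q)))
            ... | inj₂ q with ∈-++⁻ O₂ q
            ...   | inj₁ r = ∈-++⁺ʳ S (O₂⊆O r)
            ...   | inj₂ r = ∈-++⁺ˡ r
          bound₂ : K * X ≤ K * d + U * τ
          bound₂ = begin
            K * X                               ≈⟨ *-congˡ (F-cong to from) ⟩
            K * F (O₂ ++ (join S ++ []))        ≤⟨ F-rejected O₂ (0<⇒0≤ 0<K) 0≤τ (∈-++⁺ˡ ∘ ∈-++⁺ˡ) rejected ⟩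
            K * d + U * τ                       ∎
            where
            to : (S ++ O) ⊆ (O₂ ++ (join S ++ []))
            to p with ∈-++⁻ S p
            ... | inj₁ q = ∈-++⁺ʳ O₂ (∈-++⁺ˡ (⊆-join S (∈-++⁺ˡ q)))
            ... | inj₂ q with O⊆ q
            ...   | inj₁ r = ∈-++⁺ʳ O₂ (∈-++⁺ˡ (⊆-join S (∈-++⁺ʳ S r)))
            ...   | inj₂ r = ∈-++⁺ˡ r
            from : (O₂ ++ (join S ++ [])) ⊆ (S ++ O)
            from p with ∈-++⁻ O₂ p
            ... | inj₁ q = ∈-++⁺ʳ S (O₂⊆O q)
            ... | inj₂ q with ∈-++⁻ S (join-⊆ S ([ id , (λ ()) ]′ (∈-++⁻ (join S) q)))
            ...   | inj₁ r = ∈-++⁺ˡ r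
            ...   | inj₂ r = ∈-++⁺ʳ S (O₁⊆O r)

        components : ∀ Ls → All Accepted Ls →
          K * sumOf (λ S → F (S ++ O)) Ls ≤ H (mixture Ls) [] + fromℕ (length Ls) * (K * v)
        components []       []         = ≤-reflexive (trans (zeroʳ K) (sym (trans (+-identityˡ _) (zeroˡ _))))
        components (S ∷ Ls) (acc ∷ as) = begin
          K * (F (S ++ O) + s)                   ≈⟨ distribˡ K _ s ⟩
          K * F (S ++ O) + K * s                 ≤⟨ +-mono-≤ (component S acc) (components Ls as) ⟩
          ((a + d) + K * v) + (h + l * (K * v))  ≈⟨ solve 5 (λ a d h l w → ((a :+ d) :+ w) :+ (h :+ l :* w) := (a :+ (d :+ h)) :+ (con 1 :+ l) :* w) refl a d h l (K * v) ⟩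
          (a + (d + h)) + (1# + l) * (K * v)     ∎
          where
          open ≤-Reasoning
          s = sumOf (λ S → F (S ++ O)) Ls
          a = E * F (O₁ ++ [])
          d = U * F (join S ++ [])
          h = H (mixture Ls) []
          l = fromℕ (length Ls)

      -- Of the four copies of v in the hypothesis one pays for the loss in `components`, and the
      -- summand `F O` pays for the one in `F-disjoint`. Three copies remain.
      mixture-value : ∀ Ls → AllPairs Disjoint Ls → All Accepted Ls →
        fromℕ 4 * (fromℕ (length Ls) * v) + F O ≤ fromℕ (length Ls) * F O →
        fromℕ 3 * (fromℕ (total-weight (mixture Ls)) * v) ≤ H (mixture Ls) []
      mixture-value Ls dis acc 4mv≤ = +-cancelʳ-≤ (K * F O + l * (K * v)) (begin
        fromℕ 3 * (fromℕ (total-weight (mixture Ls)) * v) + (K * F O + l * (K * v))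
          ≈⟨ +-congʳ (*-congˡ (*-congʳ (trans (reflexive (≡.cong fromℕ (mixture-weight Ls))) (fromℕ-* (length Ls) k)))) ⟩
        fromℕ 3 * ((l * K) * v) + (K * F O + l * (K * v)) ≈⟨ solve 5 (λ t l K v f → t :* ((l :* K) :* v) :+ (K :* f :+ l :* (K :* v)) := K :* ((con 1 :+ t) :* (l :* v) :+ f)) refl (fromℕ 3) l K v (F O) ⟩
        K * (fromℕ 4 * (l * v) + F O)              ≤⟨ *-monoˡ-≤ (0<⇒0≤ 0<K) 4mv≤ ⟩
        K * (l * F O)                              ≤⟨ *-monoˡ-≤ (0<⇒0≤ 0<K) (≤-trans (≤-+ʳ (F-nonNeg _)) (F-disjoint Ls O dis)) ⟩
        K * (sumOf (λ S → F (S ++ O)) Ls + F O)    ≈⟨ distribˡ K _ (F O) ⟩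
        K * sumOf (λ S → F (S ++ O)) Ls + K * F O  ≤⟨ +-monoˡ-≤ _ (components Ls acc) ⟩
        (h + l * (K * v)) + K * F O                ≈⟨ solve 3 (λ a b c → (a :+ b) :+ c := a :+ (c :+ b)) refl h (l * (K * v)) (K * F O) ⟩
        h + (K * F O + l * (K * v))                ∎)
        where
        open ≤-Reasoning
        l = fromℕ (length Ls)
        h = H (mixture Ls) []

  -- Meant for an empty pool, where random greedy performs no iteration.
  H-empty : ∀ ws → Inside [] ws → H ws [] ≤ fromℕ (total-weight ws) * F []
  H-empty [] [] = ≤-reflexive (sym (zeroˡ _))
  H-empty ((w , []) ∷ ws) (_ ∷ ins) = begin
    fromℕ w * F [] + H ws []                            ≤⟨ +-monoʳ-≤ _ (H-empty ws ins) ⟩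
    fromℕ w * F [] + fromℕ (total-weight ws) * F []     ≈⟨ distribʳ (F []) _ _ ⟨
    (fromℕ w + fromℕ (total-weight ws)) * F []          ≈⟨ *-congʳ (fromℕ-+ w _) ⟨
    fromℕ (w ℕ.+ total-weight ws) * F []                ∎
    where open ≤-Reasoning
  H-empty ((w , x ∷ X) ∷ ws) ((_ , X⊆) ∷ _) with () ← X⊆ (here ≡.refl)

  -- Controls the mean size when the pool has fewer than k elements and its length takes over the
  -- role of k.
  size≤weight*length : ∀ {P} ws → Inside P ws → total-size ws ℕ.≤ total-weight ws ℕ.* length P
  size≤weight*length [] [] = z≤n
  size≤weight*length {P} ((w , X) ∷ ws) ((us , X⊆) ∷ ins) = ℕ.≤-trans
    (ℕ.+-mono-≤ (ℕ.*-monoʳ-≤ w (Unique-⊆⇒length-≤ us X⊆)) (size≤weight*length ws ins))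
    (ℕ.≤-reflexive (≡.sym (ℕ.*-distribʳ-+ (length P) w (total-weight ws))))

-- Lists as subsets of the ground set

module _ {n : ℕ} where

  toSet : List (Fin n) → Subset n
  toSet xs = ⋃ (map ⁅_⁆ xs)

  ∈-toSet⁺ : ∀ {u xs} → u ∈ xs → u ∈ˢ toSet xs
  ∈-toSet⁺ {u} (here ≡.refl) = x∈p∪q⁺ (inj₁ (x∈⁅x⁆ u))
  ∈-toSet⁺ (there p)         = x∈p∪q⁺ (inj₂ (∈-toSet⁺ p))

  ∈-toSet⁻ : ∀ {u} xs → u ∈ˢ toSet xs → u ∈ xs
  ∈-toSet⁻ []       p = contradiction p ∉⊥
  ∈-toSet⁻ (x ∷ xs) p with x∈p∪q⁻ ⁅ x ⁆ (toSet xs) p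
  ... | inj₁ q = here (x∈⁅y⁆⇒x≡y x q)
  ... | inj₂ q = there (∈-toSet⁻ xs q)

elements : ∀ {n} → Subset n → List (Fin n)
elements []            = []
elements (inside ∷ p)  = zero ∷ map suc (elements p)
elements (outside ∷ p) = map suc (elements p)

length-elements : ∀ {n} (p : Subset n) → length (elements p) ≡ ∣ p ∣
length-elements []            = ≡.refl
length-elements (inside ∷ p)  = ≡.cong ℕ.suc (≡.trans (List.length-map suc (elements p)) (length-elements p))
length-elements (outside ∷ p) = ≡.trans (List.length-map suc (elements p)) (length-elements p)

elements-unique : ∀ {n} (p : Subset n) → Unique (elements p)
elements-unique []            = []
elements-unique (inside ∷ p)  = ∉-Unique zero∉ (Unique.map⁺ Fin.suc-injective (elements-unique p))
  where
  zero∉ : zero ∉ map suc (elements p)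
  zero∉ q with ∈-map⁻ suc q
  ... | _ , _ , ()
elements-unique (outside ∷ p) = Unique.map⁺ Fin.suc-injective (elements-unique p)

∈-elements⁺ : ∀ {n} {u : Fin n} {p} → u ∈ˢ p → u ∈ elements p
∈-elements⁺ {p = inside ∷ p}  here      = here ≡.refl
∈-elements⁺ {p = inside ∷ p}  (there q) = there (∈-map⁺ suc (∈-elements⁺ q))
∈-elements⁺ {p = outside ∷ p} (there q) = ∈-map⁺ suc (∈-elements⁺ q)

∈-elements⁻ : ∀ {n} {u : Fin n} p → u ∈ elements p → u ∈ˢ p
∈-elements⁻ (inside ∷ p) (here ≡.refl) = here
∈-elements⁻ (inside ∷ p) (there q) with ∈-map⁻ suc q
... | _ , r , ≡.refl = there (∈-elements⁻ p r)
∈-elements⁻ (outside ∷ p) q with ∈-map⁻ suc q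
... | _ , r , ≡.refl = there (∈-elements⁻ p r)

toSet-elements : ∀ {n} (p : Subset n) → toSet (elements p) ≡ p
toSet-elements p = ⊆-antisym (∈-elements⁻ p ∘ ∈-toSet⁻ (elements p)) (∈-toSet⁺ ∘ ∈-elements⁺)

∣toSet∣≤length : ∀ {n} (xs : List (Fin n)) → ∣ toSet xs ∣ ℕ.≤ length xs
∣toSet∣≤length xs = ℕ.≤-trans (ℕ.≤-reflexive (≡.sym (length-elements (toSet xs))))
  (Unique-⊆⇒length-≤ (elements-unique (toSet xs)) (∈-toSet⁻ xs ∘ ∈-elements⁻ (toSet xs)))

-- The multilinear extension at sets

module MultilinearProperties {c ℓ₁ ℓ₂} (𝕂 : OrderedField c ℓ₁ ℓ₂) where
  open OrderedField 𝕂 hiding (zero)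
  open OrderedFieldProperties 𝕂
  open Streaming 𝕂

  private
    Σ-++ : ∀ xs ys → Σ[ xs ++ ys ] ≈ Σ[ xs ] + Σ[ ys ]
    Σ-++ []       ys = sym (+-identityˡ _)
    Σ-++ (x ∷ xs) ys = trans (+-congˡ (Σ-++ xs ys)) (sym (+-assoc x _ _))

    factor : ∀ {n} s (f : Subset (ℕ.suc n) → Carrier) (x : Fin (ℕ.suc n) → Carrier) As →
      Σ[ map (λ A → f A * Π[ map (λ u → if lookup A u then x u else 1# - x u) (allFin (ℕ.suc n)) ]) (map (s ∷_) As) ]
        ≈ (if s then x zero else 1# - x zero) *
          Σ[ map (λ A → f (s ∷ A) * Π[ map (λ u → if lookup A u then x (suc u) else 1# - x (suc u)) (allFin n) ]) As ]
    factor s f x []       = sym (zeroʳ _)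
    factor {n} s f x (A ∷ As) = trans (+-cong first (factor s f x As)) (sym (distribˡ _ _ _))
      where
      h = if s then x zero else 1# - x zero
      Q = Π[ map (λ u → if lookup A u then x (suc u) else 1# - x (suc u)) (allFin n) ]
      tail : Π[ map (λ u → if lookup (s ∷ A) u then x u else 1# - x u) (tabulate suc) ] ≡ Q
      tail = ≡.cong Π[_] (≡.trans (List.map-tabulate suc (λ u → if lookup (s ∷ A) u then x u else 1# - x u))
        (≡.sym (List.map-tabulate id (λ u → if lookup A u then x (suc u) else 1# - x (suc u)))))
      first : f (s ∷ A) * (h * Π[ map (λ u → if lookup (s ∷ A) u then x u else 1# - x u) (tabulate suc) ]) ≈ h * (f (s ∷ A) * Q)
      first = trans (*-congˡ (*-congˡ (reflexive tail)))
        (solve 3 (λ a b c → a :* (b :* c) := b :* (a :* c)) refl (f (s ∷ A)) h Q)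

  -- Conditioning on whether the element `zero` belongs to the random set.
  multilinear-suc : ∀ {n} (f : Subset (ℕ.suc n) → Carrier) x → multilinear f x ≈
    (1# - x zero) * multilinear (f ∘ (outside ∷_)) (x ∘ suc) + x zero * multilinear (f ∘ (inside ∷_)) (x ∘ suc)
  multilinear-suc {n} f x = trans (reflexive (≡.cong Σ[_] (List.map-++ _ (map (outside ∷_) (subsets n)) _)))
    (trans (Σ-++ (map _ (map (outside ∷_) (subsets n))) _)
      (+-cong (factor outside f x (subsets n)) (factor inside f x (subsets n))))

  multilinear-indicator : ∀ {n} (f : Subset n → Carrier) x B →
    (∀ u → x u ≈ (if lookup B u then 1# else 0#)) → multilinear f x ≈ f B
  multilinear-indicator {ℕ.zero} f x [] eq = trans (+-identityʳ _) (*-identityʳ _)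
  multilinear-indicator {ℕ.suc n} f x (s ∷ B) eq = trans (multilinear-suc f x)
    (trans (+-cong (*-congˡ (multilinear-indicator (f ∘ (outside ∷_)) (x ∘ suc) B (eq ∘ suc)))
                   (*-congˡ (multilinear-indicator (f ∘ (inside ∷_)) (x ∘ suc) B (eq ∘ suc))))
           (last s (eq zero)))
    where
    last : ∀ s → x zero ≈ (if s then 1# else 0#) →
      (1# - x zero) * f (outside ∷ B) + x zero * f (inside ∷ B) ≈ f (s ∷ B)
    last true  e = trans (+-cong (trans (*-congʳ (trans (+-congˡ (-‿cong e)) (-‿inverseʳ 1#))) (zeroˡ _))
      (trans (*-congʳ e) (*-identityˡ _))) (+-identityˡ _)
    last false e = trans (+-cong (trans (*-congʳ (trans (sym (+-identityˡ _)) (trans (+-congʳ (sym e)) (-‿cancelʳ (x zero) 1#)))) (*-identityˡ _))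
      (trans (*-congʳ e) (zeroˡ _))) (+-identityʳ _)

module OracleProperties {c ℓ₁ ℓ₂} (𝕂 : OrderedField c ℓ₁ ℓ₂) (m : ℕ) (I : Streaming.Instance 𝕂) where
  open OrderedField 𝕂 hiding (zero)
  open OrderedFieldProperties 𝕂
  open MultilinearProperties 𝕂
  open Streaming 𝕂
  open Instance I
  open Run m I

  private
    A : Set
    A = Fin n

  -- The program writes 1 as `real (lit 1)`, whose value is `1# + 0#`; it agrees with `1#` only up
  -- to the equality of the field.
  one : Carrier
  one = fromℕ 1

  ones : List A → List Carrier
  ones = map (λ _ → one)

  opaque
    F : List A → Carrier
    F xs = multilinear f (point (List.zip xs (ones xs)))

    F≡ : ∀ xs → F xs ≡ multilinear f (point (List.zip xs (ones xs)))
    F≡ xs = ≡.refl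

  oracle-F : ∀ xs → oracle (List.zip xs (ones xs)) ≡ just (F xs)
  oracle-F xs rewrite F≡ xs with All.all? (λ (_ , x) → 0# ≤? x ×-dec x ≤? 1#) (List.zip xs (ones xs))
  ... | yes _ = ≡.refl
  ... | no ¬p = contradiction (bounded xs) ¬p
    where
    bounded : ∀ xs → All (λ (_ , x) → 0# ≤ x × x ≤ 1#) (List.zip xs (ones xs))
    bounded []       = []
    bounded (_ ∷ xs) = (fromℕ-nonNeg 1 , ≤-reflexive fromℕ-1) ∷ bounded xs

  F≈f : ∀ xs → F xs ≈ f (toSet xs)
  F≈f xs = trans (reflexive (F≡ xs)) (multilinear-indicator f _ (toSet xs) indicator)
    where
    point-∈ : ∀ {u xs} → u ∈ xs → point (List.zip xs (ones xs)) u ≈ 1#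
    point-∈ {u} {x ∷ xs} p with u Fin.≟ x
    ... | yes _ = fromℕ-1
    ... | no u≢x with p
    ...   | here eq  = contradiction eq u≢x
    ...   | there q = point-∈ q
    point-∉ : ∀ {u} xs → u ∉ xs → point (List.zip xs (ones xs)) u ≈ 0#
    point-∉ []           p = refl
    point-∉ {u} (x ∷ xs) p with u Fin.≟ x
    ... | yes eq = contradiction (here eq) p
    ... | no _   = point-∉ xs (p ∘ there)
    indicator : ∀ u → point (List.zip xs (ones xs)) u ≈ (if lookup (toSet xs) u then 1# else 0#)
    indicator u with lookup (toSet xs) u in eq
    ... | true  = point-∈ (∈-toSet⁻ xs (lookup⇒[]= u (toSet xs) eq))
    ... | false = point-∉ xs λ p → contradiction (≡.trans (≡.sym eq) ([]=⇒lookup (∈-toSet⁺ p))) λ ()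

  submodularFunction : SubmodularFunction 𝕂 n
  submodularFunction = record
    { F            = F
    ; F-nonNeg     = λ xs → ≤-trans (nonNegative (toSet xs)) (≤-reflexive (sym (F≈f xs)))
    ; F-cong       = λ {xs} {ys} xs⊆ys ys⊆xs → trans (F≈f xs) (trans
        (reflexive (≡.cong f (⊆-antisym (∈-toSet⁺ ∘ xs⊆ys ∘ ∈-toSet⁻ xs) (∈-toSet⁺ ∘ ys⊆xs ∘ ∈-toSet⁻ ys)))) (sym (F≈f ys)))
    ; F-submodular = λ xs ys zs ws zs⊆ ⊆zs ws⊆ ⊆ws → begin
        F zs + F ws                                           ≈⟨ +-cong (F≈f zs) (F≈f ws) ⟩
        f (toSet zs) + f (toSet ws)                           ≈⟨ reflexive (≡.cong₂ (λ p q → f p + f q)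
          (⊆-antisym
            (λ {x} p → [ (λ q → x∈p∪q⁺ (inj₁ (∈-toSet⁺ q))) , (λ q → x∈p∪q⁺ (inj₂ (∈-toSet⁺ q))) ]′ (∈-++⁻ xs (zs⊆ (∈-toSet⁻ zs p))))
            (λ {x} p → [ (λ q → ∈-toSet⁺ (⊆zs (∈-++⁺ˡ (∈-toSet⁻ xs q)))) , (λ q → ∈-toSet⁺ (⊆zs (∈-++⁺ʳ xs (∈-toSet⁻ ys q)))) ]′ (x∈p∪q⁻ (toSet xs) (toSet ys) p)))
          (⊆-antisym
            (λ {x} p → let (q , r) = ws⊆ (∈-toSet⁻ ws p) in x∈p∩q⁺ (∈-toSet⁺ q , ∈-toSet⁺ r))
            (λ {x} p → let (q , r) = x∈p∩q⁻ (toSet xs) (toSet ys) p in ∈-toSet⁺ (⊆ws (∈-toSet⁻ xs q) (∈-toSet⁻ ys r))))) ⟩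
        f (toSet xs ∪ toSet ys) + f (toSet xs ∩ toSet ys)     ≤⟨ submodular (toSet xs) (toSet ys) ⟩
        f (toSet xs) + f (toSet ys)                           ≈⟨ +-cong (F≈f xs) (F≈f ys) ⟨
        F xs + F ys                                           ∎
    }
    where open ≤-Reasoning

-- Logarithms and geometric thresholds

n≤2^⌈log₂n⌉ : ∀ n → n ℕ.≤ 2 ℕ.^ ⌈log₂ n ⌉
n≤2^⌈log₂n⌉ = ℕ.<-rec _ go
  where
  n≤2⌈n/2⌉ : ∀ n → n ℕ.≤ 2 ℕ.* ℕ.⌈ n /2⌉
  n≤2⌈n/2⌉ n = begin
    n                                ≡⟨ ℕ.⌊n/2⌋+⌈n/2⌉≡n n ⟨
    ℕ.⌊ n /2⌋ ℕ.+ ℕ.⌈ n /2⌉          ≤⟨ ℕ.+-monoˡ-≤ _ (ℕ.⌊n/2⌋≤⌈n/2⌉ n) ⟩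
    ℕ.⌈ n /2⌉ ℕ.+ ℕ.⌈ n /2⌉          ≡⟨ ≡.cong (ℕ.⌈ n /2⌉ ℕ.+_) (ℕ.+-identityʳ _) ⟨
    2 ℕ.* ℕ.⌈ n /2⌉                  ∎
    where open ℕ.≤-Reasoning
  go : ∀ n → (∀ {m} → m ℕ.< n → m ℕ.≤ 2 ℕ.^ ⌈log₂ m ⌉) → n ℕ.≤ 2 ℕ.^ ⌈log₂ n ⌉
  go zero            rec = z≤n
  go (suc zero)      rec = s≤s z≤n
  go n@(suc (suc m)) rec = begin
    n                                     ≤⟨ n≤2⌈n/2⌉ n ⟩
    2 ℕ.* ℕ.⌈ n /2⌉                       ≤⟨ ℕ.*-monoʳ-≤ 2 (rec (ℕ.⌈n/2⌉<n m)) ⟩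
    2 ℕ.* 2 ℕ.^ ⌈log₂ ℕ.⌈ n /2⌉ ⌉         ≡⟨ ≡.cong (λ l → 2 ℕ.* 2 ℕ.^ l) (⌈log₂⌈n/2⌉⌉≡⌈log₂n⌉∸1 n) ⟩
    2 ℕ.^ suc (⌈log₂ n ⌉ ℕ.∸ 1)           ≡⟨ ≡.cong (2 ℕ.^_) (ℕ.m+[n∸m]≡n (⌈log₂⌉-mono-≤ {2} {n} (s≤s (s≤s z≤n)))) ⟩
    2 ℕ.^ ⌈log₂ n ⌉                       ∎
    where open ℕ.≤-Reasoning

module Thresholds {c ℓ₁ ℓ₂} (𝕂 : OrderedField c ℓ₁ ℓ₂) (w : ℕ) where
  open OrderedField 𝕂 hiding (zero)
  open OrderedFieldProperties 𝕂 hiding (_^_)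

  r : Carrier
  r = fromℕ (suc w) * fromℕ w ⁻¹

  -- The threshold of the group with index d.
  scale : Carrier → ℕ → Carrier
  scale τ zero    = τ
  scale τ (suc d) = scale τ d * r

  scale-suc : ∀ τ d → scale (τ * r) d ≡ scale τ (suc d)
  scale-suc τ zero    = ≡.refl
  scale-suc τ (suc d) = ≡.cong (_* r) (scale-suc τ d)

  scale-+ : ∀ τ a d → scale (scale τ a) d ≡ scale τ (d ℕ.+ a)
  scale-+ τ a zero    = ≡.refl
  scale-+ τ a (suc d) = ≡.cong (_* r) (scale-+ τ a d)

  module _ {{_ : NonZero w}} where

    private
      0<w : 0# < fromℕ w
      0<w = fromℕ-pos′ w

      W : Carrier
      W = fromℕ w

    wr≈1+w : W * r ≈ fromℕ (suc w)
    wr≈1+w = begin-equality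
      W * (fromℕ (suc w) * W ⁻¹) ≈⟨ solve 3 (λ a b c → a :* (b :* c) := (c :* a) :* b) refl W (fromℕ (suc w)) (W ⁻¹) ⟩
      (W ⁻¹ * W) * fromℕ (suc w) ≈⟨ trans (*-congʳ (⁻¹-inverseˡ 0<w)) (*-identityˡ _) ⟩
      fromℕ (suc w)              ∎
      where open ≤-Reasoning

    1≤r : 1# ≤ r
    1≤r = *-cancelˡ-≤ 0<w (begin
      W * 1#          ≈⟨ *-identityʳ W ⟩
      W               ≤⟨ ≤-+ˡ 0≤1 ⟩
      fromℕ (suc w)   ≈⟨ wr≈1+w ⟨
      W * r           ∎)
      where open ≤-Reasoning

    0≤r : 0# ≤ r
    0≤r = ≤-trans 0≤1 1≤r

    ≤-*r : ∀ {x} → 0# ≤ x → x ≤ x * r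
    ≤-*r {x} 0≤x = ≤-trans (≤-reflexive (sym (*-identityʳ x))) (*-monoˡ-≤ 0≤x 1≤r)

    <-*r : ∀ {x} → 0# < x → x < x * r
    <-*r {x} 0<x xr≤x = 0<x (+-cancelʳ-≤ (W * x) (begin
      x + W * x            ≈⟨ solve 2 (λ a b → a :+ b :* a := a :* (con 1 :+ b)) refl x W ⟩
      x * fromℕ (suc w)    ≈⟨ *-congˡ wr≈1+w ⟨
      x * (W * r)          ≈⟨ solve 3 (λ a b c → a :* (b :* c) := b :* (a :* c)) refl x W r ⟩
      W * (x * r)          ≤⟨ *-monoˡ-≤ (0<⇒0≤ 0<w) xr≤x ⟩
      W * x                ≈⟨ +-identityˡ _ ⟨
      0# + W * x           ∎))
      where open ≤-Reasoning

    scale-nonNeg : ∀ {τ} d → 0# ≤ τ → 0# ≤ scale τ d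
    scale-nonNeg zero    0≤τ = 0≤τ
    scale-nonNeg (suc d) 0≤τ = *-nonNeg (scale-nonNeg d 0≤τ) 0≤r

    scale-mono : ∀ {τ d d′} → 0# ≤ τ → d ℕ.≤′ d′ → scale τ d ≤ scale τ d′
    scale-mono 0≤τ (ℕ.≤′-reflexive ≡.refl) = ≤-refl
    scale-mono 0≤τ (ℕ.≤′-step {n = d′} d≤d′) = ≤-trans (scale-mono 0≤τ d≤d′) (≤-*r (scale-nonNeg d′ 0≤τ))

    -- Bernoulli's inequality rᵈ ≥ 1 + d/w multiplied by w τ. At d = w it shows that w consecutive
    -- thresholds double the value.
    scale-bernoulli : ∀ {τ} d → 0# ≤ τ → fromℕ (w ℕ.+ d) * τ ≤ W * scale τ d
    scale-bernoulli {τ} zero    0≤τ = ≤-reflexive (*-congʳ (reflexive (≡.cong fromℕ (ℕ.+-identityʳ w))))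
    scale-bernoulli {τ} (suc d) 0≤τ = *-cancelˡ-≤ 0<w (begin
      W * (fromℕ (w ℕ.+ suc d) * τ)          ≈⟨ *-congˡ (*-congʳ (fromℕ-+ w (suc d))) ⟩
      W * ((W + (1# + δ)) * τ)               ≤⟨ ≤-+ʳ (*-nonNeg (fromℕ-nonNeg d) 0≤τ) ⟩
      W * ((W + (1# + δ)) * τ) + δ * τ       ≈⟨ solve 3 (λ w d t → w :* ((w :+ (con 1 :+ d)) :* t) :+ d :* t := ((w :+ d) :* t) :* (con 1 :+ w)) refl W δ τ ⟩
      ((W + δ) * τ) * fromℕ (suc w)          ≈⟨ *-cong (*-congʳ (fromℕ-+ w d)) wr≈1+w ⟨
      (fromℕ (w ℕ.+ d) * τ) * (W * r)        ≤⟨ *-monoʳ-≤ (*-nonNeg (0<⇒0≤ 0<w) 0≤r) (scale-bernoulli d 0≤τ) ⟩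
      (W * scale τ d) * (W * r)              ≈⟨ solve 3 (λ w s r → (w :* s) :* (w :* r) := w :* (w :* (s :* r))) refl W (scale τ d) r ⟩
      W * (W * (scale τ d * r))              ∎)
      where
      open ≤-Reasoning
      δ = fromℕ d

    scale-double : ∀ {τ} → 0# ≤ τ → τ + τ ≤ scale τ w
    scale-double {τ} 0≤τ = *-cancelˡ-≤ 0<w (begin
      W * (τ + τ)             ≈⟨ solve 2 (λ w t → w :* (t :+ t) := (w :+ w) :* t) refl W τ ⟩
      (W + W) * τ             ≈⟨ *-congʳ (fromℕ-+ w w) ⟨
      fromℕ (w ℕ.+ w) * τ     ≤⟨ scale-bernoulli w 0≤τ ⟩
      W * scale τ w           ∎)
      where open ≤-Reasoning

    scale-2^ : ∀ {τ} l → 0# ≤ τ → fromℕ (2 ℕ.^ l) * τ ≤ scale τ (l ℕ.* w)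
    scale-2^ {τ} zero    0≤τ = ≤-reflexive (trans (*-congʳ fromℕ-1) (*-identityˡ τ))
    scale-2^ {τ} (suc l) 0≤τ = begin
      fromℕ (2 ℕ.^ l ℕ.+ (2 ℕ.^ l ℕ.+ 0)) * τ          ≈⟨ *-congʳ (trans (fromℕ-+ (2 ℕ.^ l) _) (+-congˡ (reflexive (≡.cong fromℕ (ℕ.+-identityʳ (2 ℕ.^ l)))))) ⟩
      (fromℕ (2 ℕ.^ l) + fromℕ (2 ℕ.^ l)) * τ          ≈⟨ distribʳ τ _ _ ⟩
      fromℕ (2 ℕ.^ l) * τ + fromℕ (2 ℕ.^ l) * τ        ≤⟨ +-mono-≤ (scale-2^ l 0≤τ) (scale-2^ l 0≤τ) ⟩
      scale τ (l ℕ.* w) + scale τ (l ℕ.* w)            ≤⟨ scale-double (scale-nonNeg (l ℕ.* w) 0≤τ) ⟩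
      scale (scale τ (l ℕ.* w)) w                      ≡⟨ scale-+ τ (l ℕ.* w) w ⟩
      scale τ (w ℕ.+ l ℕ.* w)                          ∎
      where open ≤-Reasoning

    -- The factor k + 1 instead of k yields a strict inequality k τ < `scale τ D` for positive τ,
    -- where D is the exponent on the right. No element of value at most τ can then reach the
    -- threshold with index D.
    scale-log : ∀ {τ} k → 0# ≤ τ → fromℕ (suc k) * τ ≤ scale τ (⌈log₂ suc k ⌉ ℕ.* w)
    scale-log k 0≤τ = ≤-trans (*-monoʳ-≤ 0≤τ (fromℕ-mono (n≤2^⌈log₂n⌉ (suc k)))) (scale-2^ ⌈log₂ suc k ⌉ 0≤τ)

-- The algorithm

module Program (w : ℕ) where
  open Syntax 6

  -- Array 0 of the naturals and array 1 of the reals hold registers.  The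
  -- element arrays are 0 the best set, 1 the set that is queried (with a
  -- parallel real array 0 of ones), 2 the stored elements with their tags in
  -- the natural array 1, 3 a buffer for them, 4 the pool of random greedy,
  -- 5 and 6 its candidates and the candidates put aside; during the stream
  -- 6 holds the current element.  Tag d w + i stands for the i-th set of the
  -- group with index d.  Thresholds are multiplied by k: τ̂ belongs to group 0
  -- and τ̌ to the group being processed.
  𝑡 𝑖 𝑠 𝑤 𝑘 : Exp nat
  𝑡 = ⟨ 0F ⟩ lit 0
  𝑖 = ⟨ 0F ⟩ lit 1
  𝑠 = ⟨ 0F ⟩ lit 2
  𝑤 = ⟨ 0F ⟩ lit 3
  𝑘 = ⟨ 0F ⟩ lit 4

  𝑏 τ̂ τ̌ 𝑣 𝑥 𝑦 𝑟 : Exp real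
  𝑏 = ⟨ 1F ⟩ lit 0
  τ̂ = ⟨ 1F ⟩ lit 1
  τ̌ = ⟨ 1F ⟩ lit 2
  𝑣 = ⟨ 1F ⟩ lit 3
  𝑥 = ⟨ 1F ⟩ lit 4
  𝑦 = ⟨ 1F ⟩ lit 5
  𝑟 = ⟨ 1F ⟩ lit 6

  top : ∀ {s} → Array s → Exp s
  top a = ⟨ a ⟩ lit 0

  nonempty : ∀ s → Array s → Test
  nonempty s a = lit 1 ≤ⁿ len s a

  pushQ : Exp elem → Cmd
  pushQ u = push elem 1F u ⨾ push real 0F (real (lit 1))

  popQ : Cmd
  popQ = pop elem 1F ⨾ pop real 0F

  clearQ : Cmd
  clearQ = while (nonempty real 0F) popQ

  evaluate : Exp nat → Cmd
  evaluate reg = query 2F 1F 0F ⨾ set real 1F reg (top 2F) ⨾ pop real 2F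

  improve : Cmd
  improve =
    cond (𝑦 ≤ʳ 𝑏) skip
      (set real 1F (lit 0) 𝑦
        ⨾ while (nonempty elem 0F) (pop elem 0F)
        ⨾ while (nonempty elem 1F) (push elem 0F (top 1F) ⨾ popQ))
    ⨾ clearQ

  dropEntry : Cmd
  dropEntry = pop elem 2F ⨾ pop nat 1F

  restore : Cmd
  restore = while (nonempty elem 3F)
    (push elem 2F (top 3F) ⨾ push nat 1F (top 2F) ⨾ pop elem 3F ⨾ pop nat 2F)

  build : Cmd
  build =
    while (nonempty elem 2F)
      (cond (top 1F ≤ⁿ 𝑡 ⊕ 𝑖 & 𝑡 ⊕ 𝑖 ≤ⁿ top 1F) (pushQ (top 2F)) skip
        ⨾ push elem 3F (top 2F) ⨾ push nat 2F (top 1F) ⨾ dropEntry)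
    ⨾ restore

  prune : Cmd
  prune =
    while (nonempty elem 2F)
      (cond (𝑠 ≤ⁿ top 1F) (push elem 3F (top 2F) ⨾ push nat 2F (top 1F ⊖ 𝑠)) skip ⨾ dropEntry)
    ⨾ restore

  -- Groups are numbered consecutively, so a large jump of the best value
  -- restarts the numbering instead of stepping through all thresholds.
  reset : Cmd
  reset = cond (real 𝑘 *ʳ τ̂ ≤ʳ 𝑏) (set real 1F (lit 1) (𝑏 *ʳ 𝑟) ⨾ while (nonempty elem 2F) dropEntry) skip

  realign : Cmd
  realign = cond (𝑏 ≤ʳ real (lit 0)) skip
    (reset
      ⨾ set nat 0F (lit 2) (lit 0)
      ⨾ while (τ̂ ≤ʳ 𝑏) (set real 1F (lit 1) (τ̂ *ʳ 𝑟) ⨾ set nat 0F (lit 2) (𝑠 ⊕ 𝑤))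
      ⨾ prune)

  try : Cmd
  try =
    build ⨾ evaluate (lit 4) ⨾ pushQ (top 6F) ⨾ evaluate (lit 5)
    ⨾ cond (real 𝑘 *ʳ 𝑥 +ʳ τ̌ ≤ʳ real 𝑘 *ʳ 𝑦)
        -- An acceptance sets 𝑖 to w and so ends the loop over the sets of the group, which keeps
        -- these sets disjoint.
        (improve ⨾ push elem 2F (top 6F) ⨾ push nat 1F (𝑡 ⊕ 𝑖) ⨾ set nat 0F (lit 1) 𝑤)
        (clearQ ⨾ set nat 0F (lit 1) (𝑖 ⊕ lit 1))

  guess : Cmd
  guess =
    set real 1F (lit 2) τ̂ ⨾ set nat 0F (lit 0) (lit 0)
    ⨾ while (τ̌ ≤ʳ real 𝑘 *ʳ 𝑣)
        (set nat 0F (lit 1) (lit 0)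
          ⨾ while (𝑖 ⊕ lit 1 ≤ⁿ 𝑤) try
          ⨾ set real 1F (lit 2) (τ̌ *ʳ 𝑟) ⨾ set nat 0F (lit 0) (𝑡 ⊕ 𝑤))

  arrive : Cmd
  arrive =
    read 6F ⨾ pushQ (top 6F) ⨾ evaluate (lit 5) ⨾ set real 1F (lit 3) 𝑦 ⨾ improve
    -- If {u} has value 0, every set rejects u by subadditivity. The test also protects `guess`,
    -- whose loop would not end for τ̂ = 0 and 𝑣 = 0.
    ⨾ cond (𝑣 ≤ʳ real (lit 0)) skip (realign ⨾ guess)
    ⨾ pop elem 6F

  collect : Cmd
  collect = while (nonempty elem 2F)
    (cond (top 1F ⊕ lit 1 ≤ⁿ 𝑤) (push elem 4F (top 2F)) skip ⨾ dropEntry)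

  -- One comparison in the search for a maximum: the best candidate so far stays on top of array 5,
  -- and the loser is written below it.
  bubble : Cmd
  bubble =
    pushQ (top 4F) ⨾ evaluate (lit 4) ⨾ popQ
    ⨾ pushQ (top 5F) ⨾ evaluate (lit 5) ⨾ popQ
    ⨾ cond (𝑥 ≤ʳ 𝑦) (push elem 5F (top 5F) ⨾ set elem 5F (lit 1) (top 4F)) (push elem 5F (top 4F))
    ⨾ pop elem 4F

  take : Cmd
  take = evaluate (lit 4) ⨾ pushQ (top 5F) ⨾ evaluate (lit 5) ⨾ cond (𝑥 ≤ʳ 𝑦) skip popQ

  -- A uniform choice among the κ best candidates by successive maxima: with 𝑖 candidates still
  -- eligible the present maximum is chosen with probability 1/𝑖 and put aside otherwise.
  round : Cmd
  round =
    push elem 5F (top 4F) ⨾ pop elem 4F ⨾ while (nonempty elem 4F) bubble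
    ⨾ flip 3F (inv (real 𝑖))
    ⨾ cond (lit 1 ≤ⁿ top 3F)
        (pop nat 3F ⨾ take ⨾ set nat 0F (lit 1) (lit 0))
        (pop nat 3F ⨾ push elem 6F (top 5F) ⨾ pop elem 5F ⨾ set nat 0F (lit 1) (𝑖 ⊖ lit 1))
    ⨾ while (nonempty elem 5F) (push elem 4F (top 5F) ⨾ pop elem 5F)

  greedy : Cmd
  greedy =
    -- The minimum of k and the size of the pool. Running k iterations would take time exponential
    -- in the bit length of k.
    set nat 0F (lit 2) (𝑘 ⊖ (𝑘 ⊖ len elem 4F)) ⨾ set nat 0F (lit 0) 𝑠
    ⨾ while (lit 1 ≤ⁿ 𝑡)
        (set nat 0F (lit 1) 𝑠 ⨾ while (lit 1 ≤ⁿ 𝑖) round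
          ⨾ while (nonempty elem 6F) (push elem 4F (top 6F) ⨾ pop elem 6F)
          ⨾ set nat 0F (lit 0) (𝑡 ⊖ lit 1))

  initialise : Cmd
  initialise =
    push nat 0F (lit w) ⨾ push nat 0F (lit 0) ⨾ push nat 0F (lit 0) ⨾ push nat 0F (lit 0)
    ⨾ push real 1F (real (lit (suc w)) *ʳ inv (real (lit w)))
    ⨾ push real 1F (real (lit 0)) ⨾ push real 1F (real (lit 0)) ⨾ push real 1F (real (lit 0))
    ⨾ push real 1F (real (lit 0)) ⨾ push real 1F (real (lit 0)) ⨾ query 1F 1F 0F

  program : Cmd
  program = initialise ⨾ while more arrive ⨾ collect ⨾ greedy ⨾ evaluate (lit 5) ⨾ improve

-- Entries tagged with the index of their set

members : ∀ {a} {A : Set a} → ℕ → List (ℕ × A) → List A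
members t []             = []
members t ((j , u) ∷ es) with j ℕ.≟ t
... | yes _ = u ∷ members t es
... | no _  = members t es

shift : ∀ {a} {A : Set a} → ℕ → List (ℕ × A) → List (ℕ × A)
shift s []             = []
shift s ((j , u) ∷ es) with s ℕ.≤? j
... | yes _ = (j ℕ.∸ s , u) ∷ shift s es
... | no _  = shift s es

below : ∀ {a} {A : Set a} → ℕ → List (ℕ × A) → List A
below s []             = []
below s ((j , u) ∷ es) with suc j ℕ.≤? s
... | yes _ = u ∷ below s es
... | no _  = below s es

⌊⌋-true : ∀ {p} {P : Set p} (d : Dec P) → P → ⌊ d ⌋ ≡ true
⌊⌋-true (yes _) _ = ≡.refl
⌊⌋-true (no ¬p) p = contradiction p ¬p

⌊⌋-false : ∀ {p} {P : Set p} (d : Dec P) → ¬ P → ⌊ d ⌋ ≡ false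
⌊⌋-false (yes p) ¬p = contradiction p ¬p
⌊⌋-false (no _)  _  = ≡.refl

module _ {a} {A : Set a} where

  ʳ++-⊆ : ∀ (xs : List A) {ys} → (xs ʳ++ ys) ⊆ (xs ++ ys)
  ʳ++-⊆ []       p = p
  ʳ++-⊆ (x ∷ xs) {ys} p with ∈-++⁻ xs (ʳ++-⊆ xs p)
  ... | inj₁ q           = there (∈-++⁺ˡ q)
  ... | inj₂ (here eq)   = here eq
  ... | inj₂ (there q)   = there (∈-++⁺ʳ xs q)

  ⊆-ʳ++ : ∀ (xs : List A) {ys} → (xs ++ ys) ⊆ (xs ʳ++ ys)
  ⊆-ʳ++ []       p = p
  ⊆-ʳ++ (x ∷ xs) {ys} (here eq) = ⊆-ʳ++ xs (∈-++⁺ʳ xs (here eq))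
  ⊆-ʳ++ (x ∷ xs) {ys} (there p) with ∈-++⁻ xs p
  ... | inj₁ q = ⊆-ʳ++ xs (∈-++⁺ˡ q)
  ... | inj₂ q = ⊆-ʳ++ xs (∈-++⁺ʳ xs (there q))

  ʳ++-involutive : ∀ (xs : List A) → (xs ʳ++ []) ʳ++ [] ≡ xs
  ʳ++-involutive xs = ≡.trans (List.ʳ++-ʳ++ xs) (List.++-identityʳ xs)

  All-ʳ++⁺ : ∀ {p} {P : A → Set p} {xs ys} → All P xs → All P ys → All P (xs ʳ++ ys)
  All-ʳ++⁺ []         pys = pys
  All-ʳ++⁺ (px ∷ pxs) pys = All-ʳ++⁺ pxs (px ∷ pys)

  length-members : ∀ t (es : List (ℕ × A)) → length (members t es) ℕ.≤ length es
  length-members t []             = z≤n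
  length-members t ((j , u) ∷ es) with j ℕ.≟ t
  ... | yes _ = s≤s (length-members t es)
  ... | no _  = ℕ.m≤n⇒m≤1+n (length-members t es)

  length-shift : ∀ s (es : List (ℕ × A)) → length (shift s es) ℕ.≤ length es
  length-shift s []             = z≤n
  length-shift s ((j , u) ∷ es) with s ℕ.≤? j
  ... | yes _ = s≤s (length-shift s es)
  ... | no _  = ℕ.m≤n⇒m≤1+n (length-shift s es)

≡-test : ∀ i {j} → i ≡ j → ⌊ i ℕ.≤? j ⌋ ∧ ⌊ j ℕ.≤? i ⌋ ≡ true
≡-test i ≡.refl rewrite ⌊⌋-true (i ℕ.≤? i) ℕ.≤-refl = ≡.refl

≢-test : ∀ i j → ¬ (i ≡ j) → ⌊ i ℕ.≤? j ⌋ ∧ ⌊ j ℕ.≤? i ⌋ ≡ false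
≢-test i j i≢j with i ℕ.≤? j
... | no _ = ≡.refl
... | yes i≤j with j ℕ.≤? i
...   | no _    = ≡.refl
...   | yes j≤i = contradiction (ℕ.≤-antisym i≤j j≤i) i≢j

-- Step counts

opaque
  realignCost : ℕ → ℕ → ℕ
  realignCost L D = 13 ℕ.+ L ℕ.* 21 ℕ.+ D ℕ.* 4

  tryCost : ℕ → ℕ
  tryCost L = 36 ℕ.+ L ℕ.* 33

  guessCost : ℕ → ℕ → ℕ
  guessCost L w = w ℕ.* tryCost L ℕ.+ 8

  realign-time : ∀ L D T → 5 ℕ.+ (L ℕ.* 4 ℕ.+ suc (3 ℕ.+ (D ℕ.* 4 ℕ.+ suc (suc (L ℕ.* 9 ℕ.+ suc (L ℕ.* 8 ℕ.+ suc T))))))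
    ≡ realignCost L D ℕ.+ T
  realign-time = lemma
    where
    lemma : ∀ L D T → 5 ℕ.+ (L ℕ.* 4 ℕ.+ suc (3 ℕ.+ (D ℕ.* 4 ℕ.+ suc (suc (L ℕ.* 9 ℕ.+ suc (L ℕ.* 8 ℕ.+ suc T))))))
      ≡ 13 ℕ.+ L ℕ.* 21 ℕ.+ D ℕ.* 4 ℕ.+ T
    lemma = solve-∀

  try-time : ∀ L X Y → 2 ℕ.+ (suc (L ℕ.* 13 ℕ.+ suc (L ℕ.* 8 ℕ.+ suc (16 ℕ.+ (2 ℕ.+ (5 ℕ.+ (L ℕ.* 2 ℕ.+ suc (L ℕ.* 6 ℕ.+ suc (L ℕ.* 4 ℕ.+ suc (5 ℕ.+ (X ℕ.+ Y)))))))))))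
    ≡ tryCost L ℕ.+ X ℕ.+ Y
  try-time = lemma
    where
    lemma : ∀ L X Y → 2 ℕ.+ (suc (L ℕ.* 13 ℕ.+ suc (L ℕ.* 8 ℕ.+ suc (16 ℕ.+ (2 ℕ.+ (5 ℕ.+ (L ℕ.* 2 ℕ.+ suc (L ℕ.* 6 ℕ.+ suc (L ℕ.* 4 ℕ.+ suc (5 ℕ.+ (X ℕ.+ Y)))))))))))
      ≡ 36 ℕ.+ L ℕ.* 33 ℕ.+ X ℕ.+ Y
    lemma = solve-∀

  guess-time : ∀ L w Y Z → 4 ℕ.+ (w ℕ.* tryCost L ℕ.+ suc (3 ℕ.+ (Y ℕ.+ Z))) ≡ guessCost L w ℕ.+ Y ℕ.+ Z
  guess-time L w = lemma (w ℕ.* tryCost L)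
    where
    lemma : ∀ X Y Z → 4 ℕ.+ (X ℕ.+ suc (3 ℕ.+ (Y ℕ.+ Z))) ≡ X ℕ.+ 8 ℕ.+ Y ℕ.+ Z
    lemma = solve-∀

  arriveCost : ℕ → ℕ → ℕ → ℕ
  arriveCost L w D = 33 ℕ.+ L ℕ.* 12 ℕ.+ realignCost L D ℕ.+ D ℕ.* guessCost L w

  arrive-time : ∀ L w D T → 8 ℕ.+ (5 ℕ.+ (3 ℕ.+ (5 ℕ.+ (L ℕ.* 2 ℕ.+ suc (L ℕ.* 6 ℕ.+ suc (L ℕ.* 4 ℕ.+ suc
    (3 ℕ.+ (realignCost L D ℕ.+ (4 ℕ.+ (D ℕ.* guessCost L w ℕ.+ suc (1 ℕ.+ T))))))))))) ≡ arriveCost L w D ℕ.+ T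
  arrive-time L w D T = lemma L (realignCost L D) (D ℕ.* guessCost L w) T
    where
    lemma : ∀ L R G T → 8 ℕ.+ (5 ℕ.+ (3 ℕ.+ (5 ℕ.+ (L ℕ.* 2 ℕ.+ suc (L ℕ.* 6 ℕ.+ suc (L ℕ.* 4 ℕ.+ suc
      (3 ℕ.+ (R ℕ.+ (4 ℕ.+ (G ℕ.+ suc (1 ℕ.+ T))))))))))) ≡ 33 ℕ.+ L ℕ.* 12 ℕ.+ R ℕ.+ G ℕ.+ T
    lemma = solve-∀

module _ {a} {A : Set a} where

  ʳ++-↭ : ∀ (xs ys : List A) → xs ʳ++ ys ↭ xs ++ ys
  ʳ++-↭ xs ys = ↭-trans (↭-reflexive (List.ʳ++-defn xs)) (++⁺ʳ ys (↭-reverse xs))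

  length-below : ∀ s (es : List (ℕ × A)) → length (below s es) ℕ.≤ length es
  length-below s []             = z≤n
  length-below s ((j , u) ∷ es) with suc j ℕ.≤? s
  ... | yes _ = s≤s (length-below s es)
  ... | no _  = ℕ.m≤n⇒m≤1+n (length-below s es)

opaque
  roundCost : ℕ → ℕ
  roundCost L = 36 ℕ.+ L ℕ.* 39

  greedyCost : ℕ → ℕ
  greedyCost L = L ℕ.* roundCost L ℕ.+ (8 ℕ.+ L ℕ.* 4)

  round-time : ∀ L X Y → 6 ℕ.+ (L ℕ.* 35 ℕ.+ suc (2 ℕ.+ (26 ℕ.+ (L ℕ.* 4 ℕ.+ suc (X ℕ.+ Y))))) ≡ roundCost L ℕ.+ X ℕ.+ Y
  round-time = lemma
    where
    lemma : ∀ L X Y → 6 ℕ.+ (L ℕ.* 35 ℕ.+ suc (2 ℕ.+ (26 ℕ.+ (L ℕ.* 4 ℕ.+ suc (X ℕ.+ Y))))) ≡ 36 ℕ.+ L ℕ.* 39 ℕ.+ X ℕ.+ Y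
    lemma = solve-∀

  greedy-time : ∀ L X Y → 4 ℕ.+ (L ℕ.* roundCost L ℕ.+ suc (1 ℕ.+ (L ℕ.* 4 ℕ.+ suc (1 ℕ.+ (X ℕ.+ Y))))) ≡ greedyCost L ℕ.+ X ℕ.+ Y
  greedy-time L = lemma L (L ℕ.* roundCost L)
    where
    lemma : ∀ L R X Y → 4 ℕ.+ (R ℕ.+ suc (1 ℕ.+ (L ℕ.* 4 ℕ.+ suc (1 ℕ.+ (X ℕ.+ Y))))) ≡ R ℕ.+ (8 ℕ.+ L ℕ.* 4) ℕ.+ X ℕ.+ Y
    lemma = solve-∀

opaque
  unfolding greedyCost arriveCost

  finishCost : ℕ → ℕ
  finishCost L = 30 ℕ.+ L ℕ.* 20 ℕ.+ L ℕ.* greedyCost L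

  finish-time : ∀ L → L ℕ.* 7 ℕ.+ suc (1 ℕ.+ (4 ℕ.+ (L ℕ.* greedyCost L ℕ.+ suc (6 ℕ.+ (5 ℕ.+ (L ℕ.* 2 ℕ.+ suc (L ℕ.* 6 ℕ.+ suc (L ℕ.* 4 ℕ.+ suc 0)))))))) ℕ.≤ finishCost L
  finish-time L = ℕ.≤-trans (ℕ.≤-reflexive (lemma L (L ℕ.* greedyCost L))) (ℕ.+-monoˡ-≤ (L ℕ.* greedyCost L) (ℕ.+-mono-≤ (ℕ.m≤m+n 21 9) (ℕ.*-monoʳ-≤ L (ℕ.m≤m+n 19 1))))
    where
    lemma : ∀ L G → L ℕ.* 7 ℕ.+ suc (1 ℕ.+ (4 ℕ.+ (G ℕ.+ suc (6 ℕ.+ (5 ℕ.+ (L ℕ.* 2 ℕ.+ suc (L ℕ.* 6 ℕ.+ suc (L ℕ.* 4 ℕ.+ suc 0)))))))) ≡ 21 ℕ.+ L ℕ.* 19 ℕ.+ G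
    lemma = solve-∀

-- Tagged entries under insertion, shift and counting

module _ {a} {A : Set a} where

  members-≡ : ∀ t (u : A) es → members t ((t , u) ∷ es) ≡ u ∷ members t es
  members-≡ t u es with t ℕ.≟ t
  ... | yes _  = ≡.refl
  ... | no t≢t = contradiction ≡.refl t≢t

  members-≢ : ∀ {t t′} (u : A) es → t′ ≢ t → members t ((t′ , u) ∷ es) ≡ members t es
  members-≢ {t} {t′} u es t′≢t with t′ ℕ.≟ t
  ... | yes t′≡t = contradiction t′≡t t′≢t
  ... | no _     = ≡.refl

  members-shift : ∀ s t (es : List (ℕ × A)) → members t (shift s es) ≡ members (t ℕ.+ s) es
  members-shift s t []             = ≡.refl
  members-shift s t ((j , u) ∷ es) with s ℕ.≤? j | j ℕ.≟ t ℕ.+ s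
  ... | yes s≤j | yes ≡.refl with (t ℕ.+ s) ℕ.∸ s ℕ.≟ t
  ...   | yes _ = ≡.cong (u ∷_) (members-shift s t es)
  ...   | no ≢t = contradiction (ℕ.m+n∸n≡m t s) ≢t
  members-shift s t ((j , u) ∷ es) | yes s≤j | no j≢ with j ℕ.∸ s ℕ.≟ t
  ...   | yes ≡.refl = contradiction (≡.sym (ℕ.m∸n+n≡m s≤j)) j≢
  ...   | no _       = members-shift s t es
  members-shift s t ((j , u) ∷ es) | no s≰j | yes ≡.refl = contradiction (ℕ.m≤n+m s t) s≰j
  members-shift s t ((j , u) ∷ es) | no s≰j | no _       = members-shift s t es

  All-shift : ∀ {N} s {es : List (ℕ × A)} → All (λ e → proj₁ e ℕ.< N) es → All (λ e → proj₁ e ℕ.< N) (shift s es)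
  All-shift s {[]}           []         = []
  All-shift s {(j , u) ∷ es} (j< ∷ js<) with s ℕ.≤? j
  ... | yes _ = ℕ.≤-<-trans (ℕ.m∸n≤m j s) j< ∷ All-shift s js<
  ... | no _  = All-shift s js<

  count : ℕ → List (ℕ × A) → ℕ
  count zero    es = 0
  count (suc N) es = length (members N es) ℕ.+ count N es

  private
    count-mono : ∀ N e es → count N es ℕ.≤ count N (e ∷ es)
    count-mono zero    e es = z≤n
    count-mono (suc N) (j , u) es with j ℕ.≟ N
    ... | yes _ = ℕ.+-mono-≤ (ℕ.n≤1+n _) (count-mono N (j , u) es)
    ... | no _  = ℕ.+-monoʳ-≤ _ (count-mono N (j , u) es)

    count-suc : ∀ N {j u} es → j ℕ.< N → suc (count N es) ℕ.≤ count N ((j , u) ∷ es)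
    count-suc (suc N) {j} {u} es (s≤s j≤N) with j ℕ.≟ N
    ... | yes _ = s≤s (ℕ.+-monoʳ-≤ _ (count-mono N (j , u) es))
    ... | no ≢N = ℕ.≤-trans (ℕ.≤-reflexive (≡.sym (ℕ.+-suc _ _))) (ℕ.+-monoʳ-≤ _ (count-suc N es (ℕ.≤∧≢⇒< j≤N ≢N)))

    length≤count : ∀ N es → All (λ e → proj₁ e ℕ.< N) es → length es ℕ.≤ count N es
    length≤count N []       []         = z≤n
    length≤count N (e ∷ es) (j< ∷ js<) = ℕ.≤-trans (s≤s (length≤count N es js<)) (count-suc N es j<)

    count≤ : ∀ N es {K} → (∀ t → length (members t es) ℕ.≤ K) → count N es ℕ.≤ N ℕ.* K
    count≤ zero    es ≤K = z≤n
    count≤ (suc N) es ≤K = ℕ.+-mono-≤ (≤K N) (count≤ N es ≤K)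

  -- Counting tag by tag turns the bound on single sets into one on the whole store; the bound on
  -- the tags leaves only N sets to count.
  length-entries : ∀ N es {K} → All (λ e → proj₁ e ℕ.< N) es → (∀ t → length (members t es) ℕ.≤ K) → length es ℕ.≤ N ℕ.* K
  length-entries N es tags ≤K = ℕ.≤-trans (length≤count N es tags) (count≤ N es ≤K)

private
  d*w+i-< : ∀ {w d d′ i i′} → d ℕ.< d′ → i ℕ.< w → d ℕ.* w ℕ.+ i ℕ.< d′ ℕ.* w ℕ.+ i′
  d*w+i-< {w} {d} {d′} {i} {i′} d<d′ i<w = begin-strict
    d ℕ.* w ℕ.+ i   <⟨ ℕ.+-monoʳ-< (d ℕ.* w) i<w ⟩
    d ℕ.* w ℕ.+ w   ≡⟨ ℕ.+-comm (d ℕ.* w) w ⟩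
    suc d ℕ.* w     ≤⟨ ℕ.*-monoˡ-≤ w d<d′ ⟩
    d′ ℕ.* w        ≤⟨ ℕ.m≤m+n _ i′ ⟩
    d′ ℕ.* w ℕ.+ i′ ∎
    where open ℕ.≤-Reasoning

-- Uniqueness of division by w with remainder. Thanks to it an insertion into one group leaves all
-- other groups unchanged.
d≢d′⇒d*w+i≢d′*w+i′ : ∀ {w d d′ i i′} → i ℕ.< w → i′ ℕ.< w → d ≢ d′ → d ℕ.* w ℕ.+ i ≢ d′ ℕ.* w ℕ.+ i′
d≢d′⇒d*w+i≢d′*w+i′ {w} {d} {d′} {i} {i′} i<w i′<w d≢d′ eq with ℕ.<-cmp d d′
... | tri< d<d′ _ _ = ℕ.<⇒≢ (d*w+i-< d<d′ i<w) eq
... | tri≈ _ d≡d′ _ = d≢d′ d≡d′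
... | tri> _ _ d′<d = ℕ.<⇒≢ (d*w+i-< d′<d i′<w) (≡.sym eq)

-- The invariant of the stream

module StreamInvariant {c ℓ₁ ℓ₂} {𝕂 : OrderedField c ℓ₁ ℓ₂} {n : ℕ} (𝔽 : SubmodularFunction 𝕂 n)
  (k w : ℕ) {{k≢0 : NonZero k}} {{w≢0 : NonZero w}} where
  open OrderedField 𝕂 hiding (zero)
  open OrderedFieldProperties 𝕂 hiding (_^_)
  open SubmodularFunction 𝔽
  open SubmodularProperties 𝔽
  open Thresholds 𝕂 w
  open DecMembership (Fin._≟_ {n}) using (_∈?_)

  private
    A : Set
    A = Fin n

    K : Carrier
    K = fromℕ k

    0≤K : 0# ≤ K
    0≤K = fromℕ-nonNeg k

    1≤K : 1# ≤ K
    1≤K = ≤-trans (≤-reflexive (sym fromℕ-1)) (fromℕ-mono (ℕ.>-nonZero⁻¹ k))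

    0<K : 0# < K
    0<K = fromℕ-pos′ k

    variable
      ps : List A
      b b′ τ ϑ : Carrier
      es es′ : List (ℕ × A)
      d D : ℕ
      u : A

  Rejects : List A → Carrier → A → Set ℓ₂
  Rejects S ϑ u = K * F (u ∷ S) ≤ K * F S + ϑ

  -- `heavy` records that each member raised k F by at least ϑ when it was inserted; together with
  -- `light` it limits the size of a set. `reject` concerns the group as a whole: a seen element
  -- lies in one of the sets or is rejected by all of them.
  record Group (ps : List A) (b : Carrier) (es : List (ℕ × A)) (ϑ : Carrier) (t : ℕ) : Set (c ⊔ ℓ₂) where
    field
      heavy    : ∀ i → i ℕ.< w → fromℕ (length (members (t ℕ.+ i) es)) * ϑ ≤ K * F (members (t ℕ.+ i) es)
      light    : ∀ i → i ℕ.< w → F (members (t ℕ.+ i) es) ≤ b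
      disjoint : ∀ i i′ → i ℕ.< w → i′ ℕ.< w → i ≢ i′ → Disjoint (members (t ℕ.+ i) es) (members (t ℕ.+ i′) es)
      reject   : ∀ {u} → u ∈ ps → (∃[ i ] i ℕ.< w × u ∈ members (t ℕ.+ i) es) ⊎
                                  (∀ i → i ℕ.< w → Rejects (members (t ℕ.+ i) es) ϑ u)

  Group-cong : ∀ {t t′} → (∀ i → i ℕ.< w → members (t ℕ.+ i) es ≡ members (t′ ℕ.+ i) es′) → b ≤ b′ →
    Group ps b es ϑ t → Group ps b′ es′ ϑ t′
  Group-cong {ϑ = ϑ} eq b≤b′ G = record
    { heavy    = λ i i<w → ≡.subst (λ S → fromℕ (length S) * ϑ ≤ K * F S) (eq i i<w) (heavy i i<w)
    ; light    = λ i i<w → ≤-trans (≡.subst (λ S → F S ≤ _) (eq i i<w) (light i i<w)) b≤b′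
    ; disjoint = λ i i′ i<w i′<w i≢i′ → ≡.subst₂ Disjoint (eq i i<w) (eq i′ i′<w) (disjoint i i′ i<w i′<w i≢i′)
    ; reject   = λ u∈ → [ (λ (i , i<w , u∈S) → inj₁ (i , i<w , ≡.subst (_ ∈_) (eq i i<w) u∈S))
                        , (λ rej → inj₂ λ i i<w → ≡.subst (λ S → Rejects S ϑ _) (eq i i<w) (rej i i<w)) ]′ (reject u∈)
    }
    where open Group G

  Group-add : ∀ {t} → (∀ i → i ℕ.< w → Rejects (members (t ℕ.+ i) es) ϑ u) → Group ps b es ϑ t → Group (u ∷ ps) b es ϑ t
  Group-add rej G = record { Group G ; reject = λ { (here ≡.refl) → inj₂ rej ; (there p) → Group.reject G p } }

  -- Subadditivity makes an element of small value rejected by every set whatsoever. This settles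
  -- groups that are still empty, groups restarted by a reset, and groups above the point where
  -- `guess` stops.
  rejects-light : ∀ S → K * F (u ∷ []) ≤ ϑ → Rejects S ϑ u
  rejects-light {u} {ϑ} S Kv≤ϑ = begin
    K * F (u ∷ S)              ≤⟨ *-monoˡ-≤ 0≤K (F-++ (u ∷ []) S) ⟩
    K * (F (u ∷ []) + F S)     ≈⟨ solve 3 (λ a b c → a :* (b :+ c) := a :* c :+ a :* b) refl K (F (u ∷ [])) (F S) ⟩
    K * F S + K * F (u ∷ [])   ≤⟨ +-monoʳ-≤ _ Kv≤ϑ ⟩
    K * F S + ϑ                ∎
    where open ≤-Reasoning

  -- `groups` ranges over all indices. A group without entries consists of empty sets that have
  -- rejected everything seen, so a group needs no initialisation when its first element is
  -- inserted. `seen` prepares for a reset and limits how far `guess` can go.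
  record Invariant (D : ℕ) (ps : List A) (b τ : Carrier) (es : List (ℕ × A)) : Set (c ⊔ ℓ₂) where
    field
      τ-nonNeg : 0# ≤ τ
      τ≤br     : τ ≤ b * r
      F[]≤b    : F [] ≤ b
      seen     : ∀ {u} → u ∈ ps → F (u ∷ []) ≤ τ
      groups   : ∀ d → Group ps b es (scale τ d) (d ℕ.* w)
      known    : ∀ t {u} → u ∈ members t es → u ∈ ps
      uniq     : ∀ t → Unique (members t es)
      sizes    : ∀ t → length (members t es) ℕ.≤ k
      tags     : All (λ e → proj₁ e ℕ.< D ℕ.* w) es

    b-nonNeg : 0# ≤ b
    b-nonNeg = ≤-trans (F-nonNeg []) F[]≤b

  private
    Group-[] : ∀ {t} → F [] ≤ b → (∀ {u} → u ∈ ps → K * F (u ∷ []) ≤ ϑ) → Group ps b [] ϑ t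
    Group-[] F[]≤b le = record
      { heavy    = λ i i<w → ≤-trans (≤-reflexive (zeroˡ _)) (*-nonNeg 0≤K (F-nonNeg []))
      ; light    = λ i i<w → F[]≤b
      ; disjoint = λ i i′ i<w i′<w i≢i′ x ()
      ; reject   = λ u∈ → inj₂ λ i i<w → rejects-light [] (le u∈)
      }

    Invariant-[] : 0# ≤ τ → τ ≤ b * r → F [] ≤ b → (∀ {u} → u ∈ ps → K * F (u ∷ []) ≤ τ) → Invariant D ps b τ []
    Invariant-[] 0≤τ τ≤br F[]≤b le = record
      { τ-nonNeg = 0≤τ
      ; τ≤br     = τ≤br
      ; F[]≤b    = F[]≤b
      ; seen     = λ {u} u∈ → ≤-trans (≤-trans (≤-reflexive (sym (*-identityˡ _))) (*-monoʳ-≤ (F-nonNeg (u ∷ [])) 1≤K)) (le u∈)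
      ; groups   = λ d → Group-[] F[]≤b (λ u∈ → ≤-trans (le u∈) (scale-mono 0≤τ (ℕ.≤⇒≤′ (z≤n {d}))))
      ; known    = λ t ()
      ; uniq     = λ t → []
      ; sizes    = λ t → z≤n
      ; tags     = []
      }

  Invariant-initial : F [] ≤ b → Invariant D [] b 0# []
  Invariant-initial F[]≤b = Invariant-[] ≤-refl (*-nonNeg (≤-trans (F-nonNeg []) F[]≤b) 0≤r) F[]≤b (λ ())

  -- A seen element has value at most τ, and k τ ≤ b lies below the new lowest threshold b r. Hence
  -- the empty sets have rejected all seen elements.
  Invariant-reset : K * τ ≤ b → Invariant D ps b τ es → Invariant D ps b (b * r) []
  Invariant-reset Kτ≤b inv = Invariant-[] (*-nonNeg b-nonNeg 0≤r) ≤-refl F[]≤b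
    (λ u∈ → ≤-trans (*-monoˡ-≤ 0≤K (seen u∈)) (≤-trans Kτ≤b (≤-*r b-nonNeg)))
    where open Invariant inv

  -- Group d of the new numbering is group d + a of the old one. `last` says that a was not raised
  -- too far, which keeps the lowest threshold within a factor r of b.
  Invariant-shift : ∀ a → (∀ a′ → suc a′ ≡ a → scale τ a′ ≤ b) → Invariant D ps b τ es →
    Invariant D ps b (scale τ a) (shift (a ℕ.* w) es)
  Invariant-shift {τ} {b} {ps = ps} {es = es} a last inv = record
    { τ-nonNeg = scale-nonNeg a τ-nonNeg
    ; τ≤br     = bound a last
    ; F[]≤b    = F[]≤b
    ; seen     = λ u∈ → ≤-trans (seen u∈) (scale-mono τ-nonNeg (ℕ.≤⇒≤′ (z≤n {a})))
    ; groups   = λ d → ≡.subst (λ ϑ → Group ps b _ ϑ (d ℕ.* w)) (≡.sym (scale-+ τ a d))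
        (Group-cong (λ i _ → ≡.sym (≡.trans (members-shift (a ℕ.* w) (d ℕ.* w ℕ.+ i) es) (≡.cong (λ t → members t es) (lemma d i)))) ≤-refl (groups (d ℕ.+ a)))
    ; known    = λ t u∈ → known (t ℕ.+ a ℕ.* w) (≡.subst (_ ∈_) (members-shift (a ℕ.* w) t es) u∈)
    ; uniq     = λ t → ≡.subst Unique (≡.sym (members-shift (a ℕ.* w) t es)) (uniq (t ℕ.+ a ℕ.* w))
    ; sizes    = λ t → ≡.subst (λ S → length S ℕ.≤ k) (≡.sym (members-shift (a ℕ.* w) t es)) (sizes (t ℕ.+ a ℕ.* w))
    ; tags     = All-shift (a ℕ.* w) tags
    }
    where
    open Invariant inv
    bound : ∀ a → (∀ a′ → suc a′ ≡ a → scale τ a′ ≤ b) → scale τ a ≤ b * r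
    bound zero    _    = τ≤br
    bound (suc a) last = *-monoʳ-≤ 0≤r (last a ≡.refl)
    lemma : ∀ d i → d ℕ.* w ℕ.+ i ℕ.+ a ℕ.* w ≡ (d ℕ.+ a) ℕ.* w ℕ.+ i
    lemma d i = begin
      d ℕ.* w ℕ.+ i ℕ.+ a ℕ.* w     ≡⟨ ℕ.+-assoc (d ℕ.* w) i (a ℕ.* w) ⟩
      d ℕ.* w ℕ.+ (i ℕ.+ a ℕ.* w)   ≡⟨ ≡.cong (d ℕ.* w ℕ.+_) (ℕ.+-comm i (a ℕ.* w)) ⟩
      d ℕ.* w ℕ.+ (a ℕ.* w ℕ.+ i)   ≡⟨ ℕ.+-assoc (d ℕ.* w) (a ℕ.* w) i ⟨
      d ℕ.* w ℕ.+ a ℕ.* w ℕ.+ i     ≡⟨ ≡.cong (ℕ._+ i) (ℕ.*-distribʳ-+ w d a) ⟨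
      (d ℕ.+ a) ℕ.* w ℕ.+ i         ∎
      where open ≡.≡-Reasoning

  Invariant-mono : b ≤ b′ → Invariant D ps b τ es → Invariant D ps b′ τ es
  Invariant-mono b≤b′ inv = record { Invariant inv
    ; τ≤br   = ≤-trans (Invariant.τ≤br inv) (*-monoʳ-≤ 0≤r b≤b′)
    ; F[]≤b  = ≤-trans (Invariant.F[]≤b inv) b≤b′
    ; groups = λ d → Group-cong (λ _ _ → ≡.refl) b≤b′ (Invariant.groups inv d) }

  Invariant-skip : F (u ∷ []) ≤ 0# → Invariant D ps b τ es → Invariant D (u ∷ ps) b τ es
  Invariant-skip {u} {τ = τ} v≤0 inv = record { Invariant inv
    ; seen   = λ { (here ≡.refl) → ≤-trans v≤0 τ-nonNeg ; (there p) → seen p }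
    ; groups = λ d → Group-add (λ i _ → rejects-light _ (≤-trans (*-monoˡ-≤ 0≤K v≤0)
        (≤-trans (≤-reflexive (zeroʳ K)) (scale-nonNeg d τ-nonNeg)))) (groups d)
    ; known  = λ t p → there (known t p) }
    where open Invariant inv

  -- A set with k or more elements would satisfy k τ ≤ k F(S) by `heavy` and F(S) ≤ b by `light`,
  -- contrary to b < τ. Quotient and remainder of t by w recover the group and the set.
  Invariant-room : ¬ (τ ≤ b) → Invariant D ps b τ es → ∀ t → length (members t es) ℕ.< k
  Invariant-room {τ} {b} {es = es} τ≰b inv t = ℕ.≰⇒> λ k≤ → τ≰b (*-cancelˡ-≤ 0<K (begin
    K * τ                            ≤⟨ *-monoʳ-≤ τ-nonNeg (fromℕ-mono k≤) ⟩
    fromℕ (length (members t es)) * τ ≤⟨ *-monoˡ-≤ (fromℕ-nonNeg (length (members t es))) (scale-mono τ-nonNeg (ℕ.≤⇒≤′ (z≤n {t ℕ./ w}))) ⟩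
    fromℕ (length (members t es)) * scale τ (t ℕ./ w) ≤⟨ ≡.subst (λ t′ → fromℕ (length (members t′ es)) * scale τ (t ℕ./ w) ≤ K * F (members t′ es)) eq (heavy (t ℕ.% w) (m%n<n t w)) ⟩
    K * F (members t es)             ≤⟨ *-monoˡ-≤ 0≤K (≡.subst (λ t → F (members t es) ≤ b) eq (light (t ℕ.% w) (m%n<n t w))) ⟩
    K * b                            ∎))
    where
    open ≤-Reasoning
    open Invariant inv
    open Group (groups (t ℕ./ w))
    eq : t ℕ./ w ℕ.* w ℕ.+ t ℕ.% w ≡ t
    eq = ≡.trans (ℕ.+-comm _ (t ℕ.% w)) (≡.sym (m≡m%n+[m/n]*n t w))

  -- The state while the arrival u is processed: the groups below d have
  -- been updated.
  record Midway (D : ℕ) (u : A) (ps : List A) (b τ : Carrier) (es : List (ℕ × A)) (d : ℕ) : Set (c ⊔ ℓ₂) where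
    field
      τ-nonNeg : 0# ≤ τ
      τ≤br     : τ ≤ b * r
      F[]≤b    : F [] ≤ b
      seen     : ∀ {x} → x ∈ (u ∷ ps) → F (x ∷ []) ≤ τ
      u∉ps     : u ∉ ps
      before   : ∀ d′ → d′ ℕ.< d → Group (u ∷ ps) b es (scale τ d′) (d′ ℕ.* w)
      after    : ∀ d′ → d ℕ.≤ d′ → Group ps b es (scale τ d′) (d′ ℕ.* w)
      known    : ∀ t {x} → x ∈ members t es → x ∈ (u ∷ ps)
      fresh    : ∀ t → d ℕ.* w ℕ.≤ t → u ∉ members t es
      uniq     : ∀ t → Unique (members t es)
      sizes    : ∀ t → length (members t es) ℕ.≤ k
      room     : ∀ t → d ℕ.* w ℕ.≤ t → length (members t es) ℕ.< k
      tags     : All (λ e → proj₁ e ℕ.< D ℕ.* w) es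

  Midway-start : ¬ (τ ≤ b) → F (u ∷ []) ≤ b → u ∉ ps → Invariant D ps b τ es → Midway D u ps b τ es 0
  Midway-start τ≰b v≤b u∉ps inv = record
    { Invariant inv
    ; seen   = λ { (here ≡.refl) → ≤-trans v≤b (≰⇒≥ τ≰b) ; (there p) → seen p }
    ; u∉ps   = u∉ps
    ; before = λ d′ ()
    ; after  = λ d′ _ → groups d′
    ; known  = λ t p → there (known t p)
    ; fresh  = λ t _ p → u∉ps (known t p)
    ; room   = λ t _ → Invariant-room τ≰b inv t
    }
    where open Invariant inv

  -- The groups from d on have thresholds above k F({u}) and reject u without being inspected.
  Midway-finish : ¬ (scale τ d ≤ K * F (u ∷ [])) → Midway D u ps b τ es d → Invariant D (u ∷ ps) b τ es
  Midway-finish {τ} {d} {u} {ps = ps} {b} {es} above mid = record { Midway mid ; groups = all }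
    where
    open Midway mid using (τ-nonNeg; before; after)
    all : ∀ d′ → Group (u ∷ ps) b es (scale τ d′) (d′ ℕ.* w)
    all d′ with d ℕ.≤? d′
    ... | yes d≤d′ = Group-add (λ i _ → rejects-light _ (≤-trans (≰⇒≥ above) (scale-mono τ-nonNeg (ℕ.≤⇒≤′ d≤d′)))) (after d′ d≤d′)
    ... | no d≰d′  = before d′ (ℕ.≰⇒> d≰d′)

  private
    suc-*≤ : ∀ {d t} → suc d ℕ.* w ℕ.≤ t → d ℕ.* w ℕ.≤ t
    suc-*≤ {d} p = ℕ.≤-trans (ℕ.m≤n+m (d ℕ.* w) w) p

  Midway-reject : (∀ i → i ℕ.< w → Rejects (members (d ℕ.* w ℕ.+ i) es) (scale τ d) u) →
    Midway D u ps b τ es d → Midway D u ps b τ es (suc d)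
  Midway-reject {d} {es} {τ} {u} {ps = ps} {b} rej mid = record { Midway mid
    ; before = extend
    ; after  = λ d′ d<d′ → after d′ (ℕ.<⇒≤ d<d′)
    ; fresh  = λ t p → fresh t (suc-*≤ {d} p)
    ; room   = λ t p → room t (suc-*≤ {d} p) }
    where
    open Midway mid using (before; after; fresh; room)
    extend : ∀ d′ → d′ ℕ.< suc d → Group (u ∷ ps) b es (scale τ d′) (d′ ℕ.* w)
    extend d′ (s≤s d′≤d) with d′ ℕ.≟ d
    ... | yes ≡.refl = Group-add rej (after d ℕ.≤-refl)
    ... | no d′≢d    = before d′ (ℕ.≤∧≢⇒< d′≤d d′≢d)

  -- The set with tag `t*` is the only one that changes. The accepted marginal value keeps it heavy,
  -- the improved best value keeps it light, and u has not yet entered this group, which gives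
  -- disjointness.
  Midway-insert : ∀ i → i ℕ.< w → d ℕ.< D → b ≤ b′ →
    (let S = members (d ℕ.* w ℕ.+ i) es) → K * F S + scale τ d ≤ K * F (u ∷ S) → F (u ∷ S) ≤ b′ →
    Midway D u ps b τ es d → Midway D u ps b′ τ ((d ℕ.* w ℕ.+ i , u) ∷ es) (suc d)
  Midway-insert {d} {D} {b} {b′} {es} {τ} {u} {ps} i i<w d<D b≤b′ accept FS≤b′ mid = record
    { τ-nonNeg = τ-nonNeg
    ; τ≤br     = ≤-trans τ≤br (*-monoʳ-≤ 0≤r b≤b′)
    ; F[]≤b    = ≤-trans F[]≤b b≤b′
    ; seen     = seen
    ; u∉ps     = u∉ps
    ; before   = before′
    ; after    = λ d′ d<d′ → other d′ (λ { ≡.refl → ℕ.<-irrefl ≡.refl d<d′ }) (after d′ (ℕ.<⇒≤ d<d′))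
    ; known    = λ t p → known′ t p (t* ℕ.≟ t)
    ; fresh    = λ t p → ≡.subst (u ∉_) (≡.sym (unchanged t (lower t p))) (fresh t (suc-*≤ {d} p))
    ; uniq     = λ t → uniq′ t (t* ℕ.≟ t)
    ; sizes    = λ t → sizes′ t (t* ℕ.≟ t)
    ; room     = λ t p → ≡.subst (λ S → length S ℕ.< k) (≡.sym (unchanged t (lower t p))) (room t (suc-*≤ {d} p))
    ; tags     = ℕ.<-≤-trans (ℕ.+-monoʳ-< (d ℕ.* w) i<w) (ℕ.≤-trans (ℕ.≤-reflexive (ℕ.+-comm (d ℕ.* w) w)) (ℕ.*-monoˡ-≤ w d<D)) ∷ tags
    }
    where
    open Midway mid
    t* = d ℕ.* w ℕ.+ i
    S = members t* es
    es* = (t* , u) ∷ es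
    here≡ : members t* es* ≡ u ∷ S
    here≡ = members-≡ t* u es
    unchanged : ∀ t → t* ≢ t → members t es* ≡ members t es
    unchanged t t*≢t = members-≢ u es t*≢t
    lower : ∀ t → suc d ℕ.* w ℕ.≤ t → t* ≢ t
    lower t p = ℕ.<⇒≢ (ℕ.<-≤-trans (ℕ.+-monoʳ-< (d ℕ.* w) i<w) (ℕ.≤-trans (ℕ.≤-reflexive (ℕ.+-comm (d ℕ.* w) w)) p))
    d*w≤t* : d ℕ.* w ℕ.≤ t*
    d*w≤t* = ℕ.m≤m+n _ i
    other : ∀ {ps} d′ → d ≢ d′ → Group ps b es (scale τ d′) (d′ ℕ.* w) → Group ps b′ es* (scale τ d′) (d′ ℕ.* w)
    other d′ d≢d′ = Group-cong (λ i′ i′<w → ≡.sym (unchanged _ (d≢d′⇒d*w+i≢d′*w+i′ i<w i′<w d≢d′))) b≤b′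
    known′ : ∀ t {x} → x ∈ members t es* → Dec (t* ≡ t) → x ∈ (u ∷ ps)
    known′ t p (yes ≡.refl) with ≡.subst (_ ∈_) here≡ p
    ... | here eq = here eq
    ... | there q = known t* q
    known′ t p (no t*≢t) = known t (≡.subst (_ ∈_) (unchanged t t*≢t) p)
    uniq′ : ∀ t → Dec (t* ≡ t) → Unique (members t es*)
    uniq′ t (yes ≡.refl) = ≡.subst Unique (≡.sym here≡) (∉-Unique (fresh t* d*w≤t*) (uniq t*))
    uniq′ t (no t*≢t)    = ≡.subst Unique (≡.sym (unchanged t t*≢t)) (uniq t)
    sizes′ : ∀ t → Dec (t* ≡ t) → length (members t es*) ℕ.≤ k
    sizes′ t (yes ≡.refl) = ≡.subst (λ S → length S ℕ.≤ k) (≡.sym here≡) (room t* d*w≤t*)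
    sizes′ t (no t*≢t)    = ≡.subst (λ S → length S ℕ.≤ k) (≡.sym (unchanged t t*≢t)) (sizes t)
    open Group (after d ℕ.≤-refl)
    tag≢ : ∀ {i′} → i ≢ i′ → t* ≢ d ℕ.* w ℕ.+ i′
    tag≢ i≢i′ eq = i≢i′ (ℕ.+-cancelˡ-≡ (d ℕ.* w) _ _ eq)
    -- Enlarging S keeps rejected elements rejected by submodularity.
    still : ∀ {x} → x ∈ ps → x ∉ S → Rejects S (scale τ d) x → Rejects (u ∷ S) (scale τ d) x
    still {x} x∈ps x∉S rej = +-cancelʳ-≤ (K * F S) (begin
      K * F (x ∷ u ∷ S) + K * F S          ≈⟨ distribˡ K _ _ ⟨
      K * (F (x ∷ u ∷ S) + F S)            ≤⟨ *-monoˡ-≤ 0≤K (F-diminishing x∉uS there) ⟩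
      K * (F (u ∷ S) + F (x ∷ S))          ≈⟨ distribˡ K _ _ ⟩
      K * F (u ∷ S) + K * F (x ∷ S)        ≤⟨ +-monoʳ-≤ _ rej ⟩
      K * F (u ∷ S) + (K * F S + scale τ d) ≈⟨ solve 3 (λ a b c → a :+ (b :+ c) := a :+ c :+ b) refl (K * F (u ∷ S)) (K * F S) (scale τ d) ⟩
      K * F (u ∷ S) + scale τ d + K * F S  ∎)
      where
      open ≤-Reasoning
      x∉uS : x ∉ (u ∷ S)
      x∉uS (here ≡.refl) = u∉ps x∈ps
      x∉uS (there p)     = x∉S p
    current : Group (u ∷ ps) b′ es* (scale τ d) (d ℕ.* w)
    current = record
      { heavy    = λ i′ i′<w → heavy′ i′ i′<w (i ℕ.≟ i′)
      ; light    = λ i′ i′<w → light′ i′ i′<w (i ℕ.≟ i′)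
      ; disjoint = λ i₁ i₂ p q i₁≢i₂ → disjoint′ i₁ i₂ p q i₁≢i₂ (i ℕ.≟ i₁) (i ℕ.≟ i₂)
      ; reject   = λ { (here ≡.refl) → inj₁ (i , i<w , ≡.subst (u ∈_) (≡.sym here≡) (here ≡.refl))
                     ; (there x∈ps)  → reject′ x∈ps (reject x∈ps) }
      }
      where
      heavy′ : ∀ i′ → i′ ℕ.< w → Dec (i ≡ i′) →
        fromℕ (length (members (d ℕ.* w ℕ.+ i′) es*)) * scale τ d ≤ K * F (members (d ℕ.* w ℕ.+ i′) es*)
      heavy′ i′ i′<w (yes ≡.refl) = ≡.subst (λ S → fromℕ (length S) * scale τ d ≤ K * F S) (≡.sym here≡) (begin
        (1# + fromℕ (length S)) * scale τ d         ≈⟨ solve 2 (λ l t → (con 1 :+ l) :* t := l :* t :+ t) refl (fromℕ (length S)) (scale τ d) ⟩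
        fromℕ (length S) * scale τ d + scale τ d    ≤⟨ +-monoˡ-≤ _ (heavy i i<w) ⟩
        K * F S + scale τ d                         ≤⟨ accept ⟩
        K * F (u ∷ S)                               ∎)
        where open ≤-Reasoning
      heavy′ i′ i′<w (no i≢i′) = ≡.subst (λ S → fromℕ (length S) * scale τ d ≤ K * F S) (≡.sym (unchanged _ (tag≢ i≢i′))) (heavy i′ i′<w)
      light′ : ∀ i′ → i′ ℕ.< w → Dec (i ≡ i′) → F (members (d ℕ.* w ℕ.+ i′) es*) ≤ b′
      light′ i′ i′<w (yes ≡.refl) = ≡.subst (λ S → F S ≤ b′) (≡.sym here≡) FS≤b′
      light′ i′ i′<w (no i≢i′)    = ≡.subst (λ S → F S ≤ b′) (≡.sym (unchanged _ (tag≢ i≢i′))) (≤-trans (light i′ i′<w) b≤b′)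
      disjoint′ : ∀ i₁ i₂ → i₁ ℕ.< w → i₂ ℕ.< w → i₁ ≢ i₂ → Dec (i ≡ i₁) → Dec (i ≡ i₂) →
        Disjoint (members (d ℕ.* w ℕ.+ i₁) es*) (members (d ℕ.* w ℕ.+ i₂) es*)
      disjoint′ i₁ i₂ p q i₁≢i₂ (yes ≡.refl) (yes ≡.refl) = contradiction ≡.refl i₁≢i₂
      disjoint′ i₁ i₂ p q i₁≢i₂ (yes ≡.refl) (no i≢i₂) = ≡.subst₂ Disjoint (≡.sym here≡) (≡.sym (unchanged _ (tag≢ i≢i₂)))
        λ { x (here ≡.refl) r → fresh _ (ℕ.m≤m+n _ i₂) r ; x (there r) r′ → disjoint i₁ i₂ p q i₁≢i₂ x r r′ }
      disjoint′ i₁ i₂ p q i₁≢i₂ (no i≢i₁) (yes ≡.refl) = ≡.subst₂ Disjoint (≡.sym (unchanged _ (tag≢ i≢i₁))) (≡.sym here≡)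
        λ { x r (here ≡.refl) → fresh _ (ℕ.m≤m+n _ i₁) r ; x r (there r′) → disjoint i₁ i₂ p q i₁≢i₂ x r r′ }
      disjoint′ i₁ i₂ p q i₁≢i₂ (no i≢i₁) (no i≢i₂) = ≡.subst₂ Disjoint (≡.sym (unchanged _ (tag≢ i≢i₁))) (≡.sym (unchanged _ (tag≢ i≢i₂)))
        (disjoint i₁ i₂ p q i₁≢i₂)
      reject′ : ∀ {x} → x ∈ ps → (∃[ j ] j ℕ.< w × x ∈ members (d ℕ.* w ℕ.+ j) es) ⊎ (∀ j → j ℕ.< w → Rejects (members (d ℕ.* w ℕ.+ j) es) (scale τ d) x) →
        (∃[ j ] j ℕ.< w × x ∈ members (d ℕ.* w ℕ.+ j) es*) ⊎ (∀ j → j ℕ.< w → Rejects (members (d ℕ.* w ℕ.+ j) es*) (scale τ d) x)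
      reject′ x∈ps (inj₁ (j , j<w , x∈)) = inj₁ (j , j<w , stays j x∈ (i ℕ.≟ j))
        where
        stays : ∀ j {x} → x ∈ members (d ℕ.* w ℕ.+ j) es → Dec (i ≡ j) → x ∈ members (d ℕ.* w ℕ.+ j) es*
        stays j p (yes ≡.refl) = ≡.subst (_ ∈_) (≡.sym here≡) (there p)
        stays j p (no i≢j)     = ≡.subst (_ ∈_) (≡.sym (unchanged _ (tag≢ i≢j))) p
      -- A member of S satisfies the rejection inequality trivially, so both alternatives may hold
      -- at once. Such an x is filed as a member, since diminishing returns need x outside the
      -- enlarged set.
      reject′ {x} x∈ps (inj₂ rej) with x ∈? S
      ... | yes x∈S = inj₁ (i , i<w , ≡.subst (x ∈_) (≡.sym here≡) (there x∈S))
      ... | no x∉S  = inj₂ λ j j<w → go j j<w (i ℕ.≟ j)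
        where
        go : ∀ j → j ℕ.< w → Dec (i ≡ j) → Rejects (members (d ℕ.* w ℕ.+ j) es*) (scale τ d) x
        go j j<w (yes ≡.refl) = ≡.subst (λ S → Rejects S (scale τ d) x) (≡.sym here≡) (still x∈ps x∉S (rej i i<w))
        go j j<w (no i≢j)     = ≡.subst (λ S → Rejects S (scale τ d) x) (≡.sym (unchanged _ (tag≢ i≢j))) (rej j j<w)
    before′ : ∀ d′ → d′ ℕ.< suc d → Group (u ∷ ps) b′ es* (scale τ d′) (d′ ℕ.* w)
    before′ d′ (s≤s d′≤d) with d ℕ.≟ d′
    ... | yes ≡.refl = current
    ... | no d≢d′    = other d′ d≢d′ (before d′ (ℕ.≤∧≢⇒< d′≤d (d≢d′ ∘ ≡.sym)))

  -- The bound by n beside the one by k keeps the number of entries polynomial in n and the bit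
  -- length of k.
  entries-bound : All (λ e → proj₁ e ℕ.< D ℕ.* w) es → (∀ t → Unique (members t es)) → (∀ t → length (members t es) ℕ.≤ k) →
    length es ℕ.≤ D ℕ.* w ℕ.* (k ℕ.⊓ n)
  entries-bound {D} {es} tags uniq sizes = length-entries (D ℕ.* w) es tags λ t → ℕ.⊓-glb (sizes t)
    (ℕ.≤-trans (Unique-⊆⇒length-≤ (uniq t) (λ {x} _ → ∈-allFin x)) (ℕ.≤-reflexive (List.length-tabulate id)))

module _ {a} {A : Set a} where

  Unique-++⁻ˡ : ∀ (xs : List A) {ys} → Unique (xs ++ ys) → Unique xs
  Unique-++⁻ˡ []       _         = []
  Unique-++⁻ˡ (x ∷ xs) (x∉ ∷ us) = All.++⁻ˡ xs x∉ ∷ Unique-++⁻ˡ xs us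

  ∈-members-∷ : ∀ i e (es : List (ℕ × A)) {u} → u ∈ members i es → u ∈ members i (e ∷ es)
  ∈-members-∷ i (j , x) es u∈ with j ℕ.≟ i
  ... | yes _ = there u∈
  ... | no _  = u∈

  ∈-below⁺ : ∀ {s i u} (es : List (ℕ × A)) → i ℕ.< s → u ∈ members i es → u ∈ below s es
  ∈-below⁺ {s} {i} ((j , x) ∷ es) i<s u∈ with j ℕ.≟ i | suc j ℕ.≤? s
  ∈-below⁺ ((j , x) ∷ es) i<s (here eq)  | yes _      | yes _  = here eq
  ∈-below⁺ ((j , x) ∷ es) i<s (there u∈) | yes _      | yes _  = there (∈-below⁺ es i<s u∈)
  ∈-below⁺ ((j , x) ∷ es) i<s u∈         | yes ≡.refl | no j≮s = contradiction i<s j≮s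
  ∈-below⁺ ((j , x) ∷ es) i<s u∈         | no _       | yes _  = there (∈-below⁺ es i<s u∈)
  ∈-below⁺ ((j , x) ∷ es) i<s u∈         | no _       | no _   = ∈-below⁺ es i<s u∈

  ∈-below⁻ : ∀ {s u} (es : List (ℕ × A)) → u ∈ below s es → ∃[ i ] i ℕ.< s × u ∈ members i es
  ∈-below⁻ {s} ((j , x) ∷ es) u∈ with suc j ℕ.≤? s
  ∈-below⁻ {s} ((j , x) ∷ es) (here eq)  | yes j<s = j , j<s , ≡.subst (_ ∈_) (≡.sym (members-≡ j x es)) (here eq)
  ∈-below⁻ {s} ((j , x) ∷ es) (there u∈) | yes _ = let (i , i<s , u∈i) = ∈-below⁻ es u∈ in i , i<s , ∈-members-∷ i (j , x) es u∈i
  ∈-below⁻ {s} ((j , x) ∷ es) u∈ | no _ = let (i , i<s , u∈i) = ∈-below⁻ es u∈ in i , i<s , ∈-members-∷ i (j , x) es u∈i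

  private
    Unique-members-∷ : ∀ i e (es : List (ℕ × A)) → Unique (members i (e ∷ es)) → Unique (members i es)
    Unique-members-∷ i (j , x) es us with j ℕ.≟ i
    Unique-members-∷ i (j , x) es (_ ∷ us) | yes _ = us
    Unique-members-∷ i (j , x) es us       | no _  = us

  Unique-below : ∀ s (es : List (ℕ × A)) → (∀ i → Unique (members i es)) →
    (∀ i i′ → i ℕ.< s → i′ ℕ.< s → i ≢ i′ → Disjoint (members i es) (members i′ es)) → Unique (below s es)
  Unique-below s []             us dis = []
  Unique-below s ((j , x) ∷ es) us dis with suc j ℕ.≤? s
  ... | no _    = Unique-below s es (λ i → Unique-members-∷ i (j , x) es (us i))
    λ i i′ i<s i′<s i≢i′ y y∈ y∈′ → dis i i′ i<s i′<s i≢i′ y (∈-members-∷ i (j , x) es y∈) (∈-members-∷ i′ (j , x) es y∈′)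
  ... | yes j<s = ∉-Unique x∉ (Unique-below s es (λ i → Unique-members-∷ i (j , x) es (us i))
    λ i i′ i<s i′<s i≢i′ y y∈ y∈′ → dis i i′ i<s i′<s i≢i′ y (∈-members-∷ i (j , x) es y∈) (∈-members-∷ i′ (j , x) es y∈′))
    where
    x∉ : x ∉ below s es
    x∉ x∈ with ∈-below⁻ es x∈
    ... | i , i<s , x∈i with j ℕ.≟ i
    ...   | yes ≡.refl = Unique-head-∉ (≡.subst Unique (members-≡ j x es) (us j)) x∈i
    ...   | no j≢i     = dis j i j<s i<s j≢i x (≡.subst (x ∈_) (≡.sym (members-≡ j x es)) (here ≡.refl)) (∈-members-∷ i (j , x) es x∈i)

xp+x+xq : ∀ x p q → x ℕ.* p ℕ.+ x ℕ.+ x ℕ.* q ≡ x ℕ.* (p ℕ.+ 1 ℕ.+ q)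
xp+x+xq = solve-∀

-- Runs of the algorithm

opaque
  -- Since w thresholds double the value, this many span a factor of k + 1.
  groupCount : ℕ → ℕ → ℕ
  groupCount k w = ⌈log₂ suc k ⌉ ℕ.* w

  groupCount≡ : ∀ k w → groupCount k w ≡ ⌈log₂ suc k ⌉ ℕ.* w
  groupCount≡ k w = ≡.refl

-- L bounds the lengths of all arrays and B the bit lengths of all naturals.
record Sizes (k n : ℕ) : Set where
  field
    w L B     : ℕ
    {{w≢0}}   : NonZero w
    L≤2^B     : L ℕ.≤ 2 ℕ.^ B
    7≤L       : 7 ℕ.≤ L
    w≤2^B     : w ℕ.≤ 2 ℕ.^ B
    k≤2^B     : k ℕ.≤ 2 ℕ.^ B
    Dw≤2^B    : groupCount k w ℕ.* w ℕ.≤ 2 ℕ.^ B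
    entries≤L : suc (groupCount k w ℕ.* w ℕ.* (k ℕ.⊓ n)) ℕ.≤ L

module Execution {c ℓ₁ ℓ₂} {𝕂 : OrderedField c ℓ₁ ℓ₂} (I : Streaming.Instance 𝕂)
  (sz : Sizes (Streaming.Instance.k I) (Streaming.Instance.n I)) where
  open Sizes sz
  open OrderedField 𝕂 hiding (zero)
  open OrderedFieldProperties 𝕂 hiding (_^_)
  open Streaming 𝕂
  open Instance I
  open Syntax 6
  open Program w
  open Run 6 I
  open ProgramLogic 𝕂 6 I
  open Judgement L B
  open OracleProperties 𝕂 6 I
  open CoinTosses 𝕂
  open SubmodularFunction submodularFunction using (F-nonNeg; F-cong)
  open SubmodularProperties submodularFunction
  open RandomGreedyAnalysis submodularFunction
  open Thresholds 𝕂 w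
  open StreamInvariant submodularFunction k w {{k≢0}}

  A : Set
  A = Fin n

  -- The abstract state between commands: parallel arrays appear as one list of pairs, constants
  -- such as w, k, r and the array of ones are supplied by `⟪_⟫`, and scratch arrays are empty.
  record Memory : Set c where
    field
      str              : List A
      t i s            : ℕ
      es ts            : List (ℕ × A)
      b τ τ′ v x y     : Carrier
      out Q pool stk rem : List A

  ⟪_⟫ : Memory → State
  ⟪ μ ⟫ = state str
    ((t ∷ i ∷ s ∷ w ∷ k ∷ []) ∷ map proj₁ es ∷ map proj₁ ts ∷ [] ∷ [] ∷ [] ∷ [] ∷ [])
    (ones Q ∷ (b ∷ τ ∷ τ′ ∷ v ∷ x ∷ y ∷ r ∷ []) ∷ [] ∷ [] ∷ [] ∷ [] ∷ [] ∷ [])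
    (out ∷ Q ∷ map proj₂ es ∷ map proj₂ ts ∷ pool ∷ stk ∷ rem ∷ [])
    where open Memory μ

  D : ℕ
  D = groupCount k w

  scale-D : ∀ {τ} → 0# ≤ τ → fromℕ (suc k) * τ ≤ scale τ D
  scale-D {τ} 0≤τ = ≡.subst (λ d → fromℕ (suc k) * τ ≤ scale τ d) (≡.sym (groupCount≡ k w)) (scale-log k 0≤τ)

  module _ where

    -- The pairs es, ts and pool, stk, rem exchange their contents, so that
    -- their total lengths are bounded.
    record Fits (μ : Memory) : Set where
      open Memory μ
      field
        t≤ : t ℕ.≤ 2 ℕ.^ B
        i≤ : i ℕ.≤ 2 ℕ.^ B
        s≤ : s ℕ.≤ 2 ℕ.^ B
        tags≤   : All (λ e → proj₁ e ℕ.≤ 2 ℕ.^ B) es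
        tags′≤  : All (λ e → proj₁ e ℕ.≤ 2 ℕ.^ B) ts
        ∣es∣≤   : length es ℕ.+ length ts ℕ.≤ L
        ∣out∣≤  : length out ℕ.≤ L
        ∣Q∣≤    : length Q ℕ.≤ L
        ∣pool∣≤ : length pool ℕ.+ length stk ℕ.+ length rem ℕ.≤ L

    private
      variable
        μ : Memory
        cs : List Cmd
        σ : State
        j T : ℕ
        z : Carrier
        ps rm : List A

    small : Fits μ → Small ⟪ μ ⟫
    small {μ} fits = within
      (bound 5 (ℕ.≤-trans (ℕ.m≤m+n 5 2) 7≤L) Vec.∷ len-map proj₁ es ∣es∣≤′ Vec.∷ len-map proj₁ ts ∣ts∣≤′ Vec.∷ bound 0 z≤n Vec.∷ bound 0 z≤n Vec.∷ bound 0 z≤n Vec.∷ bound 0 z≤n Vec.∷ Vec.[])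
      ((val t≤ ∷ val i≤ ∷ val s≤ ∷ val w≤2^B ∷ val k≤2^B ∷ []) Vec.∷ All.map⁺ (All.map val tags≤) Vec.∷ All.map⁺ (All.map val tags′≤) Vec.∷ [] Vec.∷ [] Vec.∷ [] Vec.∷ [] Vec.∷ Vec.[])
      (len-map (λ _ → one) Q ∣Q∣≤ Vec.∷ bound 7 7≤L Vec.∷ bound 0 z≤n Vec.∷ bound 0 z≤n Vec.∷ bound 0 z≤n Vec.∷ bound 0 z≤n Vec.∷ bound 0 z≤n Vec.∷ Vec.[])
      (bound _ ∣out∣≤ Vec.∷ bound _ ∣Q∣≤ Vec.∷ len-map proj₂ es ∣es∣≤′ Vec.∷ len-map proj₂ ts ∣ts∣≤′ Vec.∷ bound _ pool≤ Vec.∷ bound _ stk≤ Vec.∷ bound _ rem≤ Vec.∷ Vec.[])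
      where
      open Memory μ using (es; ts; Q; pool; stk; rem)
      open Fits fits
      bound : ∀ x → x ℕ.≤ L → x ℕ.≤ L ℕ.+ 0
      bound x p = ℕ.≤-trans p (ℕ.m≤m+n L 0)
      len-map : ∀ {a b} {X : Set a} {Y : Set b} (h : X → Y) xs → length xs ℕ.≤ L → length (map h xs) ℕ.≤ L ℕ.+ 0
      len-map h xs p = bound _ (ℕ.≤-trans (ℕ.≤-reflexive (List.length-map h xs)) p)
      val : ∀ {x} → x ℕ.≤ 2 ℕ.^ B → x ℕ.≤ 2 ℕ.^ (B ℕ.+ 0)
      val p = ℕ.≤-trans p (ℕ.^-monoʳ-≤ 2 (ℕ.m≤m+n B 0))
      ∣es∣≤′ : length es ℕ.≤ L
      ∣es∣≤′ = ℕ.≤-trans (ℕ.m≤m+n _ _) ∣es∣≤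
      ∣ts∣≤′ : length ts ℕ.≤ L
      ∣ts∣≤′ = ℕ.≤-trans (ℕ.m≤n+m _ (length es)) ∣es∣≤
      pool≤ : length pool ℕ.≤ L
      pool≤ = ℕ.≤-trans (ℕ.≤-trans (ℕ.m≤m+n _ _) (ℕ.m≤m+n _ _)) ∣pool∣≤
      stk≤ : length stk ℕ.≤ L
      stk≤ = ℕ.≤-trans (ℕ.≤-trans (ℕ.m≤n+m _ (length pool)) (ℕ.m≤m+n _ _)) ∣pool∣≤
      rem≤ : length rem ℕ.≤ L
      rem≤ = ℕ.≤-trans (ℕ.m≤n+m _ (length pool ℕ.+ length stk)) ∣pool∣≤

    -- Checkpoints are placed where the state has the form `⟪ μ ⟫`; there `Fits` bounds all arrays,
    -- and the step budget starts anew.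
    refuel : Fits μ → Good fuel T (cs , ⟪ μ ⟫) z → Good j T (cs , ⟪ μ ⟫) z
    refuel fits = check (small fits)

    condᵗ : ∀ {b p q} → ⟦ b ⟧ᵗ σ ≡ true → Good j T (p ∷ cs , σ) z → Good (suc j) (suc T) (cond b p q ∷ cs , σ) z
    condᵗ {σ} {cs = cs} {p = p} {q} eq G = det (≡.subst (λ a → Good _ _ ((if a then p else q) ∷ cs , σ) _) (≡.sym eq) G)

    condᶠ : ∀ {b p q} → ⟦ b ⟧ᵗ σ ≡ false → Good j T (q ∷ cs , σ) z → Good (suc j) (suc T) (cond b p q ∷ cs , σ) z
    condᶠ {σ} {cs = cs} {p = p} {q} eq G = det (≡.subst (λ a → Good _ _ ((if a then p else q) ∷ cs , σ) _) (≡.sym eq) G)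

    whileᵗ : ∀ {b p} → ⟦ b ⟧ᵗ σ ≡ true → Good j T (p ∷ while b p ∷ cs , σ) z → Good (suc j) (suc T) (while b p ∷ cs , σ) z
    whileᵗ {σ} {cs = cs} {b = b} {p} eq G = det (≡.subst (λ a → Good _ _ ((if a then p ∷ while b p ∷ cs else cs) , σ) _) (≡.sym eq) G)

    whileᶠ : ∀ {b p} → ⟦ b ⟧ᵗ σ ≡ false → Good j T (cs , σ) z → Good (suc j) (suc T) (while b p ∷ cs , σ) z
    whileᶠ {σ} {cs = cs} {b = b} {p} eq G = det (≡.subst (λ a → Good _ _ ((if a then p ∷ while b p ∷ cs else cs) , σ) _) (≡.sym eq) G)

    ask : ∀ Q r → lookup (elems σ) 1F ≡ Q → lookup (reals σ) 0F ≡ ones Q →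
      Good j T (cs , pushʳ r (F Q) σ) z → Good (suc j) (suc T) (query r 1F 0F ∷ cs , σ) z
    ask {σ} {cs = cs} Q r ≡.refl eq G = det (≡.subst (λ a → Good _ _ (cs , when a (λ v → pushʳ r v σ) σ) _)
      (≡.sym (≡.trans (≡.cong (λ l → oracle (List.zip Q l)) eq) (oracle-F Q))) G)

    coast : Good 40 T (cs , σ) z → Good (40 ℕ.+ j) T (cs , σ) z
    coast = weaken (ℕ.m≤m+n 40 _) ℕ.≤-refl ≤-refl

    later : ∀ N {t t′} → t ℕ.≤ t′ → t ℕ.≤ N ℕ.+ t′
    later N t≤t′ = ℕ.≤-trans t≤t′ (ℕ.m≤n+m _ N)

    -- Loops that clear, copy and move arrays

    clearQ-ok : ∀ μ Q N → length Q ℕ.≤ N → Fits (record μ { Q = Q }) →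
      Good 40 T (cs , ⟪ record μ { Q = [] } ⟫) z → Good j (N ℕ.* 4 ℕ.+ suc T) (clearQ ∷ cs , ⟪ record μ { Q = Q } ⟫) z
    clearQ-ok μ []      N       _        fits G = refuel fits (delay (later (N ℕ.* 4) ℕ.≤-refl) (block 1 (coast G)))
    clearQ-ok μ (u ∷ Q) (suc N) (s≤s ∣Q∣≤) fits G =
      refuel fits (block 4 (clearQ-ok μ Q N ∣Q∣≤ (record { Fits fits ; ∣Q∣≤ = ℕ.≤-trans (ℕ.n≤1+n _) (Fits.∣Q∣≤ fits) }) G))

    evaluate-x : ∀ μ → Good j T (cs , ⟪ record μ { x = F (Memory.Q μ) } ⟫) z →
      Good (5 ℕ.+ j) (5 ℕ.+ T) (evaluate (lit 4) ∷ cs , ⟪ μ ⟫) z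
    evaluate-x μ G = block 1 (ask (Memory.Q μ) 2F ≡.refl ≡.refl (block 3 G))

    evaluate-y : ∀ μ → Good j T (cs , ⟪ record μ { y = F (Memory.Q μ) } ⟫) z →
      Good (5 ℕ.+ j) (5 ℕ.+ T) (evaluate (lit 5) ∷ cs , ⟪ μ ⟫) z
    evaluate-y μ G = block 1 (ask (Memory.Q μ) 2F ≡.refl ≡.refl (block 3 G))

    F-reverse : ∀ xs → F (xs ʳ++ []) ≈ F xs
    F-reverse xs = F-cong (λ p → ≡.subst (_ ∈_) (List.++-identityʳ xs) (ʳ++-⊆ xs p)) (λ p → ⊆-ʳ++ xs (∈-++⁺ˡ p))

    -- The bound k serves feasibility and the bound L serves memory; L grows with min(k, n) and can
    -- be smaller than k.
    Best : Carrier → List A → Set ℓ₂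
    Best b out = b ≤ F out × length out ℕ.≤ k × length out ℕ.≤ L

    clearOut-ok : ∀ μ out N → length out ℕ.≤ N → Fits (record μ { out = out }) →
      Good 40 T (cs , ⟪ record μ { out = [] } ⟫) z →
      Good j (N ℕ.* 2 ℕ.+ suc T) (while (nonempty elem 0F) (pop elem 0F) ∷ cs , ⟪ record μ { out = out } ⟫) z
    clearOut-ok μ []        N       _          fits G = refuel fits (delay (later (N ℕ.* 2) ℕ.≤-refl) (block 1 (coast G)))
    clearOut-ok μ (u ∷ out) (suc N) (s≤s ∣out∣≤) fits G =
      refuel fits (block 2 (clearOut-ok μ out N ∣out∣≤ (record { Fits fits ; ∣out∣≤ = ℕ.<⇒≤ (Fits.∣out∣≤ fits) }) G))

    moveOut-ok : ∀ μ Q out N → length Q ℕ.≤ N → length Q ℕ.+ length out ℕ.≤ L → Fits (record μ { Q = Q ; out = out }) →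
      Good 40 T (cs , ⟪ record μ { Q = [] ; out = Q ʳ++ out } ⟫) z →
      Good j (N ℕ.* 6 ℕ.+ suc T) (while (nonempty elem 1F) (push elem 0F (top 1F) ⨾ popQ) ∷ cs , ⟪ record μ { Q = Q ; out = out } ⟫) z
    moveOut-ok μ []      out N       _        _   fits G = refuel fits (delay (later (N ℕ.* 6) ℕ.≤-refl) (block 1 (coast G)))
    moveOut-ok μ (u ∷ Q) out (suc N) (s≤s ∣Q∣≤) sum≤ fits G = refuel fits (block 6 (moveOut-ok μ Q (u ∷ out) N ∣Q∣≤ sum′
      (record { Fits fits ; ∣Q∣≤ = ℕ.<⇒≤ (Fits.∣Q∣≤ fits) ; ∣out∣≤ = ℕ.≤-trans (ℕ.m≤n+m _ (length Q)) sum′ }) G))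
      where
      sum′ : length Q ℕ.+ suc (length out) ℕ.≤ L
      sum′ = ℕ.≤-trans (ℕ.≤-reflexive (ℕ.+-suc (length Q) (length out))) sum≤

    improveTime : ℕ → ℕ
    improveTime T = 5 ℕ.+ (L ℕ.* 2 ℕ.+ suc (L ℕ.* 6 ℕ.+ suc (L ℕ.* 4 ℕ.+ suc T)))

    -- The continuation learns only that b′ dominates both b and `F Q`, so a single continuation
    -- serves both outcomes of the comparison.
    improve-ok : ∀ μ → (let open Memory μ using (b; y; out; Q)) → Fits μ → y ≡ F Q → length Q ℕ.≤ k → Best b out →
      (∀ b′ out′ → b ≤ b′ → F Q ≤ b′ → Best b′ out′ → Good 40 T (cs , ⟪ record μ { Q = [] ; b = b′ ; out = out′ } ⟫) z) →
      Good j (improveTime T) (improve ∷ cs , ⟪ μ ⟫) z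
    improve-ok μ fits y≡ ∣Q∣≤k best G with Memory.y μ ≤? Memory.b μ
    ... | yes y≤b = refuel fits (block 1 (condᵗ (⌊⌋-true (y ≤? b) y≤b) (block 1
      (delay (later 2 (later (L ℕ.* 2) (later 1 (later (L ℕ.* 6) (later 1 ℕ.≤-refl)))))
        (clearQ-ok μ Q L ∣Q∣≤ fits (G b out ≤-refl (≡.subst (_≤ b) y≡ y≤b) best))))))
      where
      open Memory μ using (b; y; out; Q)
      open Fits fits using (∣Q∣≤)
    ... | no y≰b = refuel fits (block 1 (condᶠ (⌊⌋-false (y ≤? b) y≰b) (block 3
      (clearOut-ok (record μ { b = y }) out L ∣out∣≤ (record { Fits fits }) (moveOut-ok (record μ { b = y }) Q [] L ∣Q∣≤
        (ℕ.≤-trans (ℕ.≤-reflexive (ℕ.+-identityʳ _)) ∣Q∣≤) (record { Fits fits ; ∣out∣≤ = z≤n })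
        (clearQ-ok (record μ { b = y ; out = Q ʳ++ [] }) [] L z≤n (record { Fits fits ; ∣Q∣≤ = z≤n ; ∣out∣≤ = rev≤ ∣Q∣≤ })
          (G y (Q ʳ++ []) (≰⇒≥ y≰b) (≤-reflexive (reflexive (≡.sym y≡)))
            (≤-reflexive (trans (reflexive y≡) (sym (F-reverse Q))) , rev≤ ∣Q∣≤k , rev≤ ∣Q∣≤))))))))
      where
      open Memory μ using (b; y; out; Q)
      open Fits fits using (∣out∣≤; ∣Q∣≤)
      rev≤ : ∀ {x} → length Q ℕ.≤ x → length (Q ʳ++ []) ℕ.≤ x
      rev≤ = ℕ.≤-trans (ℕ.≤-reflexive (≡.trans (List.length-ʳ++ Q) (ℕ.+-identityʳ _)))

    restore-ok : ∀ μ ts es N → length ts ℕ.≤ N → Fits (record μ { es = es ; ts = ts }) →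
      Good 40 T (cs , ⟪ record μ { es = ts ʳ++ es ; ts = [] } ⟫) z →
      Good j (N ℕ.* 8 ℕ.+ suc T) (restore ∷ cs , ⟪ record μ { es = es ; ts = ts } ⟫) z
    restore-ok μ []       es N       _         fits G = refuel fits (delay (later (N ℕ.* 8) ℕ.≤-refl) (block 1 (coast G)))
    restore-ok μ (e ∷ ts) es (suc N) (s≤s ∣ts∣≤) fits G = refuel fits (block 8 (restore-ok μ ts (e ∷ es) N ∣ts∣≤
      (record { Fits fits ; ∣es∣≤ = ℕ.≤-trans (ℕ.≤-reflexive (≡.sym (ℕ.+-suc (length es) (length ts)))) ∣es∣≤
        ; tags≤ = All.head tags′≤ ∷ tags≤ ; tags′≤ = All.tail tags′≤ }) G))
      where open Fits fits using (tags≤; tags′≤; ∣es∣≤)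

    scan-ok : ∀ μ → (let open Memory μ using (t; i)) → ∀ es ts Q N → length es ℕ.≤ N → length es ℕ.+ length Q ℕ.≤ L →
      Fits (record μ { es = es ; ts = ts ; Q = Q }) →
      Good 40 T (cs , ⟪ record μ { es = [] ; ts = es ʳ++ ts ; Q = members (t ℕ.+ i) es ʳ++ Q } ⟫) z →
      Good j (N ℕ.* 13 ℕ.+ suc T) (while (nonempty elem 2F)
        (cond (top 1F ≤ⁿ 𝑡 ⊕ 𝑖 & 𝑡 ⊕ 𝑖 ≤ⁿ top 1F) (pushQ (top 2F)) skip
          ⨾ push elem 3F (top 2F) ⨾ push nat 2F (top 1F) ⨾ dropEntry) ∷ cs , ⟪ record μ { es = es ; ts = ts ; Q = Q } ⟫) z
    scan-ok μ []             ts Q N       _         _    fits G = refuel fits (delay (later (N ℕ.* 13) ℕ.≤-refl) (block 1 (coast G)))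
    scan-ok μ ((a , u) ∷ es) ts Q (suc N) (s≤s ∣es∣≤N) sum≤ fits G with a ℕ.≟ Memory.t μ ℕ.+ Memory.i μ
    ... | yes eq = refuel fits (block 2 (condᵗ (≡-test a eq) (block 10
      (scan-ok μ es ((a , u) ∷ ts) (u ∷ Q) N ∣es∣≤N sum′ (record { Fits fits
        ; ∣es∣≤ = ℕ.≤-trans (ℕ.≤-reflexive (ℕ.+-suc (length es) (length ts))) ∣es∣≤
        ; tags≤ = All.tail tags≤ ; tags′≤ = All.head tags≤ ∷ tags′≤
        ; ∣Q∣≤ = ℕ.≤-trans (ℕ.m≤n+m _ (length es)) sum′ }) G))))
      where
      open Fits fits using (tags≤; tags′≤; ∣es∣≤)
      sum′ : length es ℕ.+ suc (length Q) ℕ.≤ L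
      sum′ = ℕ.≤-trans (ℕ.≤-reflexive (ℕ.+-suc (length es) (length Q))) sum≤
    ... | no neq = refuel fits (block 2 (condᶠ (≢-test a _ neq) (delay (later 2 ℕ.≤-refl) (block 8
      (scan-ok μ es ((a , u) ∷ ts) Q N ∣es∣≤N (ℕ.<⇒≤ sum≤) (record { Fits fits
        ; ∣es∣≤ = ℕ.≤-trans (ℕ.≤-reflexive (ℕ.+-suc (length es) (length ts))) ∣es∣≤
        ; tags≤ = All.tail tags≤ ; tags′≤ = All.head tags≤ ∷ tags′≤ }) G)))))
      where open Fits fits using (tags≤; tags′≤; ∣es∣≤)

    buildTime : ℕ → ℕ
    buildTime T = suc (L ℕ.* 13 ℕ.+ suc (L ℕ.* 8 ℕ.+ suc T))

    build-ok : ∀ μ → (let open Memory μ using (t; i; es; ts; Q)) → ts ≡ [] → Q ≡ [] → Fits μ →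
      Good 40 T (cs , ⟪ record μ { Q = members (t ℕ.+ i) es ʳ++ [] } ⟫) z →
      Good j (buildTime T) (build ∷ cs , ⟪ μ ⟫) z
    build-ok μ ≡.refl ≡.refl fits G = refuel fits (block 1 (scan-ok μ es [] [] L ∣es∣≤′ ∣es∣≤ fits
      (restore-ok (record μ { Q = members (t ℕ.+ i) es ʳ++ [] }) (es ʳ++ []) [] L rev≤
        (record { Fits fits ; ∣es∣≤ = rev≤ ; tags≤ = [] ; tags′≤ = All-ʳ++⁺ tags≤ [] ; ∣Q∣≤ = Q≤ })
        (≡.subst (λ es′ → Good 40 _ (_ , ⟪ record μ { es = es′ ; Q = members (t ℕ.+ i) es ʳ++ [] } ⟫) _) (≡.sym (ʳ++-involutive es)) G))))
      where
      open Memory μ using (t; i; es)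
      open Fits fits using (tags≤; ∣es∣≤)
      ∣es∣≤′ : length es ℕ.≤ L
      ∣es∣≤′ = ℕ.≤-trans (ℕ.m≤m+n _ _) ∣es∣≤
      rev≤ : length (es ʳ++ []) ℕ.≤ L
      rev≤ = ℕ.≤-trans (ℕ.≤-reflexive (List.length-ʳ++ es)) ∣es∣≤
      Q≤ : length (members (t ℕ.+ i) es ʳ++ []) ℕ.≤ L
      Q≤ = ℕ.≤-trans (ℕ.≤-reflexive (≡.trans (List.length-ʳ++ (members (t ℕ.+ i) es)) (ℕ.+-identityʳ _)))
        (ℕ.≤-trans (length-members (t ℕ.+ i) es) ∣es∣≤′)

    prune-scan-ok : ∀ μ → (let open Memory μ using (s)) → ∀ es ts N → length es ℕ.≤ N → Fits (record μ { es = es ; ts = ts }) →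
      (All (λ e → proj₁ e ℕ.≤ 2 ℕ.^ B) (shift s es ʳ++ ts) → Good 40 T (cs , ⟪ record μ { es = [] ; ts = shift s es ʳ++ ts } ⟫) z) →
      Good j (N ℕ.* 9 ℕ.+ suc T) (while (nonempty elem 2F)
        (cond (𝑠 ≤ⁿ top 1F) (push elem 3F (top 2F) ⨾ push nat 2F (top 1F ⊖ 𝑠)) skip ⨾ dropEntry) ∷ cs , ⟪ record μ { es = es ; ts = ts } ⟫) z
    prune-scan-ok μ []             ts N       _         fits G = refuel fits (delay (later (N ℕ.* 9) ℕ.≤-refl) (block 1 (coast (G (Fits.tags′≤ fits)))))
    prune-scan-ok μ ((a , u) ∷ es) ts (suc N) (s≤s ∣es∣≤N) fits G with Memory.s μ ℕ.≤? a
    ... | yes s≤a = refuel fits (block 2 (condᵗ (⌊⌋-true (s ℕ.≤? a) s≤a) (block 6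
      (prune-scan-ok μ es ((a ℕ.∸ s , u) ∷ ts) N ∣es∣≤N (record { Fits fits
        ; ∣es∣≤ = ℕ.≤-trans (ℕ.≤-reflexive (ℕ.+-suc (length es) (length ts))) ∣es∣≤
        ; tags≤ = All.tail tags≤ ; tags′≤ = ℕ.≤-trans (ℕ.m∸n≤m a s) (All.head tags≤) ∷ tags′≤ }) G))))
      where
      open Memory μ using (s)
      open Fits fits using (tags≤; tags′≤; ∣es∣≤)
    ... | no s≰a = refuel fits (block 2 (condᶠ (⌊⌋-false (s ℕ.≤? a) s≰a) (delay (later 2 ℕ.≤-refl) (block 4
      (prune-scan-ok μ es ts N ∣es∣≤N (record { Fits fits ; ∣es∣≤ = ℕ.<⇒≤ ∣es∣≤ ; tags≤ = All.tail tags≤ }) G)))))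
      where
      open Memory μ using (s)
      open Fits fits using (tags≤; ∣es∣≤)

    pruneTime : ℕ → ℕ
    pruneTime T = suc (L ℕ.* 9 ℕ.+ suc (L ℕ.* 8 ℕ.+ suc T))

    prune-ok : ∀ μ → (let open Memory μ using (s; es; ts)) → ts ≡ [] → Fits μ →
      Good 40 T (cs , ⟪ record μ { es = shift s es } ⟫) z → Good j (pruneTime T) (prune ∷ cs , ⟪ μ ⟫) z
    prune-ok μ ≡.refl fits G = refuel fits (block 1 (prune-scan-ok μ es [] L (ℕ.≤-trans (ℕ.m≤m+n _ _) ∣es∣≤) fits λ tags →
      restore-ok μ (shift s es ʳ++ []) [] L rev≤ (record { Fits fits ; ∣es∣≤ = rev≤ ; tags≤ = [] ; tags′≤ = tags })
        (≡.subst (λ es′ → Good 40 _ (_ , ⟪ record μ { es = es′ } ⟫) _) (≡.sym (ʳ++-involutive (shift s es))) G)))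
      where
      open Memory μ using (s; es)
      open Fits fits using (∣es∣≤)
      rev≤ : length (shift s es ʳ++ []) ℕ.≤ L
      rev≤ = ℕ.≤-trans (ℕ.≤-reflexive (≡.trans (List.length-ʳ++ (shift s es)) (ℕ.+-identityʳ _)))
        (ℕ.≤-trans (length-shift s es) (ℕ.≤-trans (ℕ.m≤m+n _ _) ∣es∣≤))

    dropEntries-ok : ∀ μ es N → length es ℕ.≤ N → Fits (record μ { es = es }) →
      Good 40 T (cs , ⟪ record μ { es = [] } ⟫) z →
      Good j (N ℕ.* 4 ℕ.+ suc T) (while (nonempty elem 2F) dropEntry ∷ cs , ⟪ record μ { es = es } ⟫) z
    dropEntries-ok μ []       N       _          fits G = refuel fits (delay (later (N ℕ.* 4) ℕ.≤-refl) (block 1 (coast G)))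
    dropEntries-ok μ (e ∷ es) (suc N) (s≤s ∣es∣≤N) fits G = refuel fits (block 4 (dropEntries-ok μ es N ∣es∣≤N
      (record { Fits fits ; ∣es∣≤ = ℕ.<⇒≤ (Fits.∣es∣≤ fits) ; tags≤ = All.tail (Fits.tags≤ fits) }) G))

    -- The loop makes at most N steps because `scale τ N` exceeds b. The least exponent a with
    -- `scale τ a` above b is handed on, as `Invariant-shift` depends on its minimality.
    align-ok : ∀ μ → (let open Memory μ using (b)) → ∀ τ s N → ¬ (scale τ N ≤ b) → s ℕ.+ N ℕ.* w ℕ.≤ 2 ℕ.^ B → Fits (record μ { τ = τ ; s = s }) →
      (∀ a → a ℕ.≤ N → ¬ (scale τ a ≤ b) → (∀ a′ → suc a′ ≡ a → scale τ a′ ≤ b) →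
        s ℕ.+ a ℕ.* w ℕ.≤ 2 ℕ.^ B →
        Good 40 T (cs , ⟪ record μ { τ = scale τ a ; s = s ℕ.+ a ℕ.* w } ⟫) z) →
      Good j (N ℕ.* 4 ℕ.+ suc T) (while (τ̂ ≤ʳ 𝑏) (set real 1F (lit 1) (τ̂ *ʳ 𝑟) ⨾ set nat 0F (lit 2) (𝑠 ⊕ 𝑤)) ∷ cs
        , ⟪ record μ { τ = τ ; s = s } ⟫) z
    align-ok μ τ s N above s≤ fits G with τ ≤? Memory.b μ
    ... | no τ≰b = refuel fits (delay (later (N ℕ.* 4) ℕ.≤-refl) (whileᶠ (⌊⌋-false (τ ≤? Memory.b μ) τ≰b)
      (coast (≡.subst (λ s′ → Good 40 _ (_ , ⟪ record μ { τ = τ ; s = s′ } ⟫) _) (ℕ.+-identityʳ s)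
        (G 0 z≤n τ≰b (λ _ ()) (ℕ.≤-trans (ℕ.≤-reflexive (ℕ.+-identityʳ s)) (Fits.s≤ fits)))))))
    align-ok μ τ s zero    above s≤ fits G | yes τ≤b = contradiction τ≤b above
    align-ok {T = T} {cs = cs} {z = z} μ τ s (suc N) above s≤ fits G | yes τ≤b = refuel fits (whileᵗ (⌊⌋-true (τ ≤? Memory.b μ) τ≤b) (block 3
      (align-ok μ (τ * r) (s ℕ.+ w) N (above ∘ ≡.subst (_≤ Memory.b μ) (scale-suc τ N)) s′≤
        (record { Fits fits ; s≤ = ℕ.≤-trans (ℕ.m≤m+n _ _) s′≤ })
        λ a a≤N ab be sa≤ → ≡.subst₂ (λ τ′ s′ → Good 40 T (cs , ⟪ record μ { τ = τ′ ; s = s′ } ⟫) z) (≡.sym (scale-suc τ a)) (≡.sym (ℕ.+-assoc s w (a ℕ.* w)))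
          (G (suc a) (s≤s a≤N) (ab ∘ ≡.subst (_≤ Memory.b μ) (≡.sym (scale-suc τ a)))
            (λ { a′ ≡.refl → below-suc a′ be }) (ℕ.≤-trans (ℕ.≤-reflexive (≡.sym (ℕ.+-assoc s w (a ℕ.* w)))) sa≤)))))
      where
      s′≤ : s ℕ.+ w ℕ.+ N ℕ.* w ℕ.≤ 2 ℕ.^ B
      s′≤ = ℕ.≤-trans (ℕ.≤-reflexive (ℕ.+-assoc s w (N ℕ.* w))) s≤
      below-suc : ∀ a → (∀ a′ → suc a′ ≡ a → scale (τ * r) a′ ≤ Memory.b μ) → scale τ a ≤ Memory.b μ
      below-suc zero    be = τ≤b
      below-suc (suc a) be = ≡.subst (_≤ Memory.b μ) (scale-suc τ a) (be a ≡.refl)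

    record Ready (rm : List A) (μ : Memory) : Set ℓ₂ where
      open Memory μ
      field
        ts≡[]   : ts ≡ []
        Q≡[]    : Q ≡ []
        pool≡[] : pool ≡ []
        stk≡[]  : stk ≡ []
        rem≡    : rem ≡ rm
        ∣rem∣≤1 : length rm ℕ.≤ 1
        t≤      : t ℕ.≤ 2 ℕ.^ B
        i≤      : i ℕ.≤ 2 ℕ.^ B
        s≤      : s ℕ.≤ 2 ℕ.^ B
        best    : Best b out

    entries-fit : ∀ {es} → All (λ e → proj₁ e ℕ.< D ℕ.* w) es → (∀ t → Unique (members t es)) →
      (∀ t → length (members t es) ℕ.≤ k) → suc (length es) ℕ.≤ L
    entries-fit {es} tags uniq sizes = ℕ.≤-trans (s≤s (entries-bound {D = D} {es = es} tags uniq sizes)) entries≤L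

    Ready-fits : ∀ μ → (let open Memory μ using (es)) → Ready rm μ → All (λ e → proj₁ e ℕ.< D ℕ.* w) es → suc (length es) ℕ.≤ L → Fits μ
    Ready-fits μ record { ts≡[] = ≡.refl ; Q≡[] = ≡.refl ; pool≡[] = ≡.refl ; stk≡[] = ≡.refl ; rem≡ = ≡.refl
                        ; ∣rem∣≤1 = ∣rem∣≤1 ; t≤ = t≤ ; i≤ = i≤ ; s≤ = s≤ ; best = _ , _ , ∣out∣≤ } tags ∣es∣< = record
      { t≤ = t≤ ; i≤ = i≤ ; s≤ = s≤
      ; tags≤   = All.map (λ t< → ℕ.≤-trans (ℕ.<⇒≤ t<) Dw≤2^B) tags
      ; tags′≤  = []
      ; ∣es∣≤   = ℕ.≤-trans (ℕ.≤-reflexive (ℕ.+-identityʳ _)) (ℕ.<⇒≤ ∣es∣<)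
      ; ∣out∣≤  = ∣out∣≤
      ; ∣Q∣≤    = z≤n
      ; ∣pool∣≤ = ℕ.≤-trans ∣rem∣≤1 (ℕ.≤-trans (s≤s z≤n) 7≤L)
      }

    costs : ∀ {t t′ γ} → t ≡ t′ → Good j t γ z → Good j t′ γ z
    costs ≡.refl G = G

    K : Carrier
    K = fromℕ k

    -- Processing the stream

    realign-ok : ∀ μ → (let open Memory μ using (es; b; τ)) → Ready rm μ → Invariant D ps b τ es → ¬ (b ≤ 0#) →
      (∀ τ′ es′ s′ → ¬ (τ′ ≤ b) → Invariant D ps b τ′ es′ → s′ ℕ.≤ 2 ℕ.^ B → Good 40 T (cs , ⟪ record μ { τ = τ′ ; es = es′ ; s = s′ } ⟫) z) →
      Good j (realignCost L D ℕ.+ T) (realign ∷ cs , ⟪ μ ⟫) z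
    realign-ok {rm = rm} {ps = ps} {T = T} {cs = cs} {z = z} μ ready ivt b≰0 G = costs (realign-time L D T)
      (refuel (fits ready ivt) (condᶠ (⌊⌋-false (b ≤? 0#) b≰0) (block 1 outcome)))
      where
      open Memory μ using (es; b; τ)
      fits : ∀ {ν} → Ready rm ν → Invariant D ps (Memory.b ν) (Memory.τ ν) (Memory.es ν) → Fits ν
      fits {ν} ready ivt = Ready-fits ν ready (Invariant.tags ivt) (entries-fit (Invariant.tags ivt) (Invariant.uniq ivt) (Invariant.sizes ivt))
      rest : Cmd
      rest = set nat 0F (lit 2) (lit 0) ⨾ while (τ̂ ≤ʳ 𝑏) (set real 1F (lit 1) (τ̂ *ʳ 𝑟) ⨾ set nat 0F (lit 2) (𝑠 ⊕ 𝑤)) ⨾ prune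
      aligned : ∀ τ₁ es₁ → ¬ (scale τ₁ D ≤ b) → Invariant D ps b τ₁ es₁ → ∀ {j} →
        Good (3 ℕ.+ j) (3 ℕ.+ (D ℕ.* 4 ℕ.+ suc (pruneTime T))) (rest ∷ cs , ⟪ record μ { τ = τ₁ ; es = es₁ } ⟫) z
      aligned τ₁ es₁ above ivt₁ = block 3 (align-ok (record μ { es = es₁ }) τ₁ 0 D above Dw≤2^B
        fits₁
        λ a a≤D τ≰b last s≤ → prune-ok (record μ { es = es₁ ; τ = scale τ₁ a ; s = a ℕ.* w }) (Ready.ts≡[] ready)
          (record { Fits fits₁ ; s≤ = s≤ })
          (G (scale τ₁ a) (shift (a ℕ.* w) es₁) (a ℕ.* w) τ≰b (Invariant-shift a last ivt₁) s≤))
        where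
        fits₁ : Fits (record μ { τ = τ₁ ; es = es₁ ; s = 0 })
        fits₁ = fits (record { Ready ready ; s≤ = z≤n }) ivt₁
      fits₀ : Fits μ
      fits₀ = fits ready ivt
      outcome : Good _ _ (reset ∷ rest ∷ cs , ⟪ μ ⟫) z
      outcome with K * τ ≤? b
      ... | yes Kτ≤b = condᵗ (⌊⌋-true (K * τ ≤? b) Kτ≤b) (block 2 (dropEntries-ok (record μ { τ = b * r }) es L
        (ℕ.≤-trans (ℕ.m≤m+n _ _) (Fits.∣es∣≤ (fits ready ivt))) (record { Fits fits₀ })
        (aligned (b * r) [] (λ p → <-*r b≰0 (≤-trans (scale-mono (*-nonNeg (0<⇒0≤ b≰0) 0≤r) (ℕ.≤⇒≤′ (z≤n {D}))) p))
          (Invariant-reset Kτ≤b ivt))))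
      -- Without a reset b < k τ, and k τ is at most `scale τ D`, so D alignment steps are enough.
      ... | no Kτ≰b = condᶠ (⌊⌋-false (K * τ ≤? b) Kτ≰b) (delay (later 2 (later (L ℕ.* 4) ℕ.≤-refl))
        (block 1 (aligned τ es (λ p → Kτ≰b (≤-trans (≤-trans (*-monoʳ-≤ τ-nonNeg (≤-+ˡ 0≤1)) (scale-D τ-nonNeg)) p)) ivt)))
        where open Invariant ivt using (τ-nonNeg)

    module _ (u : A) (ps : List A) where

      Trying : Memory → ℕ → Set (c ⊔ ℓ₂)
      Trying μ d = Ready (u ∷ []) μ × Midway D u ps b τ es d × t ≡ d ℕ.* w × τ′ ≡ scale τ d
        where open Memory μ using (t; es; b; τ; τ′)

      record Tried (μ : Memory) : Set c where
        field
          i* : ℕ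
          es* : List (ℕ × A)
          b* x* y* : Carrier
          out* : List A

        result : Memory
        result = record μ { i = i* ; es = es* ; b = b* ; x = x* ; y = y* ; out = out* }

      -- Rejections by the sets of group d accumulate until all w sets have refused u, which is the
      -- hypothesis of `Midway-reject`; the first acceptance instead leads to `Midway-insert`.
      tries-ok : ∀ μ → (let open Memory μ using (i; es; τ)) → ∀ d N → i ℕ.+ N ≡ w → d ℕ.< D → Trying μ d →
        (∀ i′ → i′ ℕ.< i → Rejects (members (d ℕ.* w ℕ.+ i′) es) (scale τ d) u) →
        (∀ ν → (let open Tried {μ} ν) → Ready (u ∷ []) result → Midway D u ps b* τ es* (suc d) → Good 40 T (cs , ⟪ result ⟫) z) →
        Good j (N ℕ.* tryCost L ℕ.+ suc T) (while (𝑖 ⊕ lit 1 ≤ⁿ 𝑤) try ∷ cs , ⟪ μ ⟫) z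
      tries-ok {T = T} {cs = cs} {z = z} μ d N i+N≡w d<D (ready@record { rem≡ = ≡.refl ; Q≡[] = ≡.refl } , mid , ≡.refl , ≡.refl) rej G = go N i+N≡w
        where
        open Memory μ using (t; i; es; b; τ; x; y; out)
        open Midway mid using (uniq; sizes; room; tags)
        fits : Fits μ
        fits = Ready-fits μ ready tags (entries-fit tags uniq sizes)
        S q : List A
        S = members (t ℕ.+ i) es
        q = S ʳ++ []
        ∣q∣ : length q ≡ length S
        ∣q∣ = ≡.trans (List.length-ʳ++ S) (ℕ.+-identityʳ _)
        exit : i ≡ w → ∀ {j} → Good (suc 40 ℕ.+ j) (suc T) (while (𝑖 ⊕ lit 1 ≤ⁿ 𝑤) try ∷ cs , ⟪ μ ⟫) z
        exit i≡w = whileᶠ (⌊⌋-false (i ℕ.+ 1 ℕ.≤? w) (λ p → ℕ.1+n≰n (≡.subst (λ a → suc a ℕ.≤ w) i≡w (≡.subst (ℕ._≤ w) (ℕ.+-comm i 1) p))))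
          (coast (G (record { i* = i ; es* = es ; b* = b ; x* = x ; y* = y ; out* = out }) ready
            (Midway-reject (λ i′ i′<w → rej i′ (≡.subst (i′ ℕ.<_) (≡.sym i≡w) i′<w)) mid)))
        F-uq : F (u ∷ q) ≈ F (u ∷ S)
        F-uq = F-cong {u ∷ q} {u ∷ S} (λ { (here eq) → here eq ; (there p) → there (≡.subst (_ ∈_) (List.++-identityʳ S) (ʳ++-⊆ S p)) })
                      (λ { (here eq) → here eq ; (there p) → there (⊆-ʳ++ S (∈-++⁺ˡ p)) })
        go : ∀ N → i ℕ.+ N ≡ w → Good _ (N ℕ.* tryCost L ℕ.+ suc T) (while (𝑖 ⊕ lit 1 ≤ⁿ 𝑤) try ∷ cs , ⟪ μ ⟫) z
        go zero    i+0≡w = refuel fits (exit (≡.trans (≡.sym (ℕ.+-identityʳ i)) i+0≡w))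
        go (suc N) i+N≡w = costs (try-time L (N ℕ.* tryCost L) (suc T)) (refuel fits
          (whileᵗ (⌊⌋-true (i ℕ.+ 1 ℕ.≤? w) (≡.subst (ℕ._≤ w) (≡.sym (ℕ.+-comm i 1)) i<w)) (block 1
            (build-ok μ (Ready.ts≡[] ready) ≡.refl fits (block 1
              (evaluate-x (record μ { Q = q }) (block 5 (evaluate-y (record μ { Q = u ∷ q ; x = F q }) outcome))))))))
          where
          i<w : i ℕ.< w
          i<w = ℕ.≤-trans (ℕ.m≤m+n (suc i) N) (ℕ.≤-reflexive (≡.trans (≡.sym (ℕ.+-suc i N)) i+N≡w))
          μ₂ : Memory
          μ₂ = record μ { Q = u ∷ q ; x = F q ; y = F (u ∷ q) }
          ∣uq∣≤k : length (u ∷ q) ℕ.≤ k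
          ∣uq∣≤k = ≡.subst (λ l → suc l ℕ.≤ k) (≡.sym ∣q∣) (room (t ℕ.+ i) (ℕ.m≤m+n t i))
          fits₂ : Fits μ₂
          fits₂ = record { Fits fits ; ∣Q∣≤ = ℕ.≤-trans (ℕ.≤-reflexive (≡.cong suc ∣q∣))
            (ℕ.≤-trans (s≤s (length-members (t ℕ.+ i) es)) (entries-fit tags uniq sizes)) }
          outcome : ∀ {j} → Good (10 ℕ.+ j) (2 ℕ.+ (5 ℕ.+ (L ℕ.* 2 ℕ.+ suc (L ℕ.* 6 ℕ.+ suc (L ℕ.* 4 ℕ.+ suc (5 ℕ.+ (N ℕ.* tryCost L ℕ.+ suc T)))))))
            (cond (real 𝑘 *ʳ 𝑥 +ʳ τ̌ ≤ʳ real 𝑘 *ʳ 𝑦)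
              (improve ⨾ push elem 2F (top 6F) ⨾ push nat 1F (𝑡 ⊕ 𝑖) ⨾ set nat 0F (lit 1) 𝑤)
              (clearQ ⨾ set nat 0F (lit 1) (𝑖 ⊕ lit 1)) ∷ while (𝑖 ⊕ lit 1 ≤ⁿ 𝑤) try ∷ cs , ⟪ μ₂ ⟫) z
          outcome with K * F q + scale τ d ≤? K * F (u ∷ q)
          ... | yes p = condᵗ (⌊⌋-true (K * F q + scale τ d ≤? K * F (u ∷ q)) p) (block 1
            (improve-ok μ₂ fits₂ ≡.refl ∣uq∣≤k (Ready.best ready) λ b′ out′ b≤b′ Fuq≤b′ best′ →
              let ready′ = record { Ready ready ; i≤ = w≤2^B ; best = best′ }
                  mid′ = Midway-insert i i<w d<D b≤b′ (accepted p) (≤-trans (≤-reflexive (sym F-uq)) Fuq≤b′) mid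
                  μ₃ = record μ { i = w ; x = F q ; y = F (u ∷ q) ; b = b′ ; out = out′ ; es = (t ℕ.+ i , u) ∷ es }
              in block 5 (refuel (Ready-fits μ₃ ready′ (Midway.tags mid′) (entries-fit (Midway.tags mid′) (Midway.uniq mid′) (Midway.sizes mid′)))
                (delay (later (N ℕ.* tryCost L) ℕ.≤-refl)
                  (whileᶠ (⌊⌋-false (w ℕ.+ 1 ℕ.≤? w) (λ w<w → ℕ.1+n≰n (≡.subst (ℕ._≤ w) (ℕ.+-comm w 1) w<w)))
                    (coast (G (record { i* = w ; es* = (t ℕ.+ i , u) ∷ es ; b* = b′ ; x* = F q ; y* = F (u ∷ q) ; out* = out′ }) ready′ mid′)))))))
            where
            accepted : K * F q + scale τ d ≤ K * F (u ∷ q) → K * F S + scale τ d ≤ K * F (u ∷ S)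
            accepted p = ≤-trans (≤-reflexive (+-congʳ (*-congˡ (sym (F-reverse S))))) (≤-trans p (≤-reflexive (*-congˡ F-uq)))
          ... | no ¬p = condᶠ (⌊⌋-false (K * F q + scale τ d ≤? K * F (u ∷ q)) ¬p) (block 1
            (delay (later 5 (later (L ℕ.* 2) (later 1 (later (L ℕ.* 6) (later 1 (ℕ.+-monoʳ-≤ (L ℕ.* 4) (s≤s (later 4 ℕ.≤-refl))))))))
              (clearQ-ok μ₂ (u ∷ q) L (Fits.∣Q∣≤ fits₂) fits₂ (block 1
                (tries-ok (record μ { i = i ℕ.+ 1 ; x = F q ; y = F (u ∷ q) }) d N
                  (≡.trans (ℕ.+-assoc i 1 N) i+N≡w) d<D
                  (record { Ready ready ; i≤ = ℕ.≤-trans (≡.subst (ℕ._≤ w) (≡.sym (ℕ.+-comm i 1)) i<w) w≤2^B } , mid , ≡.refl , ≡.refl)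
                  (λ i′ i′<i+1 → rejected i′ (ℕ.m<1+n⇒m<n∨m≡n (≡.subst (i′ ℕ.<_) (ℕ.+-comm i 1) i′<i+1)))
                  λ ν ready′ mid′ → G (record { Tried ν }) ready′ mid′)))))
            where
            rejected : ∀ i′ → i′ ℕ.< i ⊎ i′ ≡ i → Rejects (members (d ℕ.* w ℕ.+ i′) es) (scale τ d) u
            rejected i′ (inj₁ i′<i)   = rej i′ i′<i
            rejected i′ (inj₂ ≡.refl) = ≤-trans (≤-reflexive (*-congˡ (sym F-uq)))
              (≤-trans (≰⇒≥ ¬p) (≤-reflexive (+-congʳ (*-congˡ (F-reverse S)))))

      guesses-ok : ∀ μ → (let open Memory μ using (str; v)) → ∀ d N → d ℕ.+ N ≡ D → v ≡ F (u ∷ []) → ¬ (v ≤ 0#) → Trying μ d →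
        (∀ μ′ → Memory.str μ′ ≡ str → Ready (u ∷ []) μ′ → Invariant D (u ∷ ps) (Memory.b μ′) (Memory.τ μ′) (Memory.es μ′) → Good 40 T (cs , ⟪ μ′ ⟫) z) →
        Good j (N ℕ.* guessCost L w ℕ.+ suc T) (while (τ̌ ≤ʳ real 𝑘 *ʳ 𝑣)
          (set nat 0F (lit 1) (lit 0) ⨾ while (𝑖 ⊕ lit 1 ≤ⁿ 𝑤) try
            ⨾ set real 1F (lit 2) (τ̌ *ʳ 𝑟) ⨾ set nat 0F (lit 0) (𝑡 ⊕ 𝑤)) ∷ cs , ⟪ μ ⟫) z
      guesses-ok {T = T} {cs = cs} {z = z} μ d N d+N≡D ≡.refl v≰0 (ready , mid , ≡.refl , ≡.refl) G
        with Memory.τ′ μ ≤? K * Memory.v μ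
      ... | no above = refuel fits (delay (later (N ℕ.* guessCost L w) ℕ.≤-refl) (whileᶠ (⌊⌋-false (τ′ ≤? K * v) above)
        (coast (G μ ≡.refl ready (Midway-finish above mid)))))
        where
        open Memory μ using (τ′; v)
        open Midway mid using (uniq; sizes; tags)
        fits : Fits μ
        fits = Ready-fits μ ready tags (entries-fit tags uniq sizes)
      -- Reaching the group with index D would mean (k + 1) τ ≤ k v ≤ k τ, so τ and hence v would
      -- not be positive.
      guesses-ok μ d zero d+0≡D ≡.refl v≰0 (ready , mid , ≡.refl , ≡.refl) G | yes p =
        contradiction (≤-trans (seen (here ≡.refl)) τ≤0) v≰0
        where
        open Memory μ using (b; τ; v)
        open Midway mid using (τ-nonNeg; seen)
        τ≤0 : τ ≤ 0#
        τ≤0 = +-cancelʳ-≤ (K * τ) (begin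
          τ + K * τ                ≈⟨ solve 2 (λ a b → a :+ b :* a := (con 1 :+ b) :* a) refl τ K ⟩
          fromℕ (suc k) * τ        ≤⟨ scale-D τ-nonNeg ⟩
          scale τ D                ≡⟨ ≡.cong (scale τ) (≡.trans (≡.sym d+0≡D) (ℕ.+-identityʳ d)) ⟩
          scale τ d                ≤⟨ p ⟩
          K * v                    ≤⟨ *-monoˡ-≤ (fromℕ-nonNeg k) (seen (here ≡.refl)) ⟩
          K * τ                    ≈⟨ +-identityˡ _ ⟨
          0# + K * τ               ∎)
          where open ≤-Reasoning
      guesses-ok {T = T} {cs = cs} {z = z} μ d (suc N) d+N≡D ≡.refl v≰0 (ready , mid , ≡.refl , ≡.refl) G | yes p =
        costs (guess-time L w (N ℕ.* guessCost L w) (suc T)) (refuel fits (whileᵗ (⌊⌋-true (τ′ ≤? K * v) p) (block 3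
          (tries-ok (record μ { i = 0 }) d w ≡.refl d<D (record { Ready ready ; i≤ = z≤n } , mid , ≡.refl , ≡.refl) (λ _ ())
            λ ν ready′ mid′ → block 3 (guesses-ok (record (Tried.result ν) { τ′ = τ′ * r ; t = t ℕ.+ w }) (suc d) N
              (≡.trans (≡.sym (ℕ.+-suc d N)) d+N≡D) ≡.refl v≰0
              (record { Ready ready′ ; t≤ = t≤ } , mid′ , ℕ.+-comm (d ℕ.* w) w , ≡.refl) G)))))
        where
        open Memory μ using (t; τ′; v)
        open Midway mid using (uniq; sizes; tags)
        fits : Fits μ
        fits = Ready-fits μ ready tags (entries-fit tags uniq sizes)
        d<D : d ℕ.< D
        d<D = ℕ.≤-trans (ℕ.m≤m+n (suc d) N) (ℕ.≤-reflexive (≡.trans (≡.sym (ℕ.+-suc d N)) d+N≡D))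
        t≤ : t ℕ.+ w ℕ.≤ 2 ℕ.^ B
        t≤ = ℕ.≤-trans (ℕ.≤-trans (ℕ.≤-reflexive (ℕ.+-comm (d ℕ.* w) w)) (ℕ.*-monoˡ-≤ w d<D)) Dw≤2^B

    leave-ok : ∀ {u} μ → Ready (u ∷ []) μ → (Ready [] (record μ { rem = [] }) → Good j T (cs , ⟪ record μ { rem = [] } ⟫) z) →
      Good (suc j) (suc T) (pop elem 6F ∷ cs , ⟪ μ ⟫) z
    leave-ok μ ready@record { rem≡ = ≡.refl } G = block 1 (G (record { Ready ready ; rem≡ = ≡.refl ; ∣rem∣≤1 = z≤n }))

    arrive-ok : ∀ {u str′} μ → (let open Memory μ using (str; es; b; τ)) → str ≡ u ∷ str′ → u ∉ ps → Ready [] μ → Invariant D ps b τ es →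
      (∀ μ′ → Memory.str μ′ ≡ str′ → Ready [] μ′ → Invariant D (u ∷ ps) (Memory.b μ′) (Memory.τ μ′) (Memory.es μ′) →
        Good 20 T (while more arrive ∷ cs , ⟪ μ′ ⟫) z) →
      Good j (arriveCost L w D ℕ.+ T) (while more arrive ∷ cs , ⟪ μ ⟫) z
    arrive-ok {ps = ps} {T = T} {cs = cs} {z = z} {u = u} {str′} μ ≡.refl u∉ps ready@record { rem≡ = ≡.refl ; Q≡[] = ≡.refl } ivt G =
      costs (arrive-time L w D T) (refuel (Ready-fits μ ready tags ∣es∣<) (block 8
        (evaluate-y (record μ { str = str′ ; rem = u ∷ [] ; Q = u ∷ [] }) (block 3
          (improve-ok μ₁ fits₁ ≡.refl (ℕ.>-nonZero⁻¹ k {{k≢0}}) (Ready.best ready) continue)))))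
      where
      open Memory μ using (es; b; τ; τ′)
      open Invariant ivt using (uniq; sizes; tags)
      ∣es∣< : suc (length es) ℕ.≤ L
      ∣es∣< = entries-fit tags uniq sizes
      μ₁ : Memory
      μ₁ = record μ { str = str′ ; rem = u ∷ [] ; Q = u ∷ [] ; y = F (u ∷ []) ; v = F (u ∷ []) }
      ready₁ : Ready (u ∷ []) (record μ₁ { Q = [] })
      ready₁ = record { Ready ready ; rem≡ = ≡.refl ; ∣rem∣≤1 = s≤s z≤n }
      fits₁ : Fits μ₁
      fits₁ = record { Fits (Ready-fits (record μ₁ { Q = [] }) ready₁ tags ∣es∣<) ; ∣Q∣≤ = ℕ.≤-trans (s≤s z≤n) 7≤L }
      rest : List Cmd
      rest = pop elem 6F ∷ while more arrive ∷ cs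
      continue : ∀ b′ out′ → b ≤ b′ → F (u ∷ []) ≤ b′ → Best b′ out′ →
        Good 40 (3 ℕ.+ (realignCost L D ℕ.+ (4 ℕ.+ (D ℕ.* guessCost L w ℕ.+ suc (1 ℕ.+ T)))))
          ((cond (𝑣 ≤ʳ real (lit 0)) skip (realign ⨾ guess) ⨾ pop elem 6F) ∷ while more arrive ∷ cs
          , ⟪ record μ₁ { Q = [] ; b = b′ ; out = out′ } ⟫) z
      continue b′ out′ b≤b′ v≤b′ best′ = block 1 (outcome (F (u ∷ []) ≤? 0#))
        where
        μ₂ : Memory
        μ₂ = record μ₁ { Q = [] ; b = b′ ; out = out′ }
        ready₂ : Ready (u ∷ []) μ₂
        ready₂ = record { Ready ready₁ ; best = best′ }
        ivt₂ : Invariant D ps b′ τ es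
        ivt₂ = Invariant-mono b≤b′ ivt
        outcome : Dec (F (u ∷ []) ≤ 0#) → Good 39 (2 ℕ.+ (realignCost L D ℕ.+ (4 ℕ.+ (D ℕ.* guessCost L w ℕ.+ suc (1 ℕ.+ T)))))
          (cond (𝑣 ≤ʳ real (lit 0)) skip (realign ⨾ guess) ∷ rest , ⟪ μ₂ ⟫) z
        outcome (yes v≤0) = condᵗ (⌊⌋-true (F (u ∷ []) ≤? 0#) v≤0) (block 1
          (delay (later (realignCost L D) (later 4 (later (D ℕ.* guessCost L w) (later 1 ℕ.≤-refl))))
            (leave-ok μ₂ ready₂ λ ready₃ → weaken (ℕ.m≤m+n 20 16) ℕ.≤-refl ≤-refl (G (record μ₂ { rem = [] }) ≡.refl ready₃ (Invariant-skip v≤0 ivt₂)))))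
        outcome (no v≰0) = condᶠ (⌊⌋-false (F (u ∷ []) ≤? 0#) v≰0) (block 1
          (realign-ok μ₂ ready₂ ivt₂ (λ b≤0 → v≰0 (≤-trans v≤b′ b≤0)) λ τ′ es′ s′ τ′≰b ivt′ s′≤ → block 4
            (guesses-ok u ps (record μ₂ { τ = τ′ ; es = es′ ; s = s′ ; τ′ = τ′ ; t = 0 }) 0 D ≡.refl ≡.refl v≰0
              (record { Ready ready₂ ; s≤ = s′≤ ; t≤ = z≤n } , Midway-start τ′≰b v≤b′ u∉ps ivt′ , ≡.refl , ≡.refl)
              λ μ′ str≡ ready′ ivt″ → weaken (ℕ.m≤m+n 21 19) ℕ.≤-refl ≤-refl
                (leave-ok μ′ ready′ λ ready″ → G (record μ′ { rem = [] }) str≡ ready″ ivt″))))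

    stream-ok : ∀ str′ ps μ → (let open Memory μ using (str; es; b; τ)) → str ≡ str′ → Unique str′ → (∀ {x} → x ∈ str′ → x ∉ ps) →
      (∀ x → x ∈ ps ⊎ x ∈ str′) → Ready [] μ → Invariant D ps b τ es →
      (∀ ps′ μ′ → (∀ x → x ∈ ps′) → Ready [] μ′ → Invariant D ps′ (Memory.b μ′) (Memory.τ μ′) (Memory.es μ′) → Good 40 T (cs , ⟪ μ′ ⟫) z) →
      Good j (length str′ ℕ.* arriveCost L w D ℕ.+ suc T) (while more arrive ∷ cs , ⟪ μ ⟫) z
    stream-ok [] ps μ ≡.refl us dis all ready ivt G = refuel (Ready-fits μ ready tags (entries-fit tags uniq sizes))
      (block 1 (coast (G ps μ (λ x → [ id , (λ ()) ]′ (all x)) ready ivt)))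
      where open Invariant ivt using (uniq; sizes; tags)
    stream-ok {T = T} (u ∷ str′) ps μ ≡.refl us@(_ ∷ us′) dis all ready ivt G =
      costs (≡.sym (ℕ.+-assoc (arriveCost L w D) _ (suc T)))
      (arrive-ok μ ≡.refl (dis (here ≡.refl)) ready ivt λ μ′ str≡ ready′ ivt′ →
        stream-ok str′ (u ∷ ps) μ′ str≡ us′
          (λ { x∈ (here ≡.refl) → Unique-head-∉ us x∈ ; x∈ (there x∈ps) → dis (there x∈) x∈ps })
          (λ x → [ (λ p → inj₁ (there p)) , (λ { (here eq) → inj₁ (here eq) ; (there p) → inj₂ p }) ]′ (all x)) ready′ ivt′ G)

    -- Random greedy on the lowest group

    collect-ok : ∀ μ es pool N → length es ℕ.≤ N → length es ℕ.+ length pool ℕ.≤ L → Memory.stk μ ≡ [] → Memory.rem μ ≡ [] →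
      Fits (record μ { es = es ; pool = pool }) →
      Good 40 T (cs , ⟪ record μ { es = [] ; pool = below w es ʳ++ pool } ⟫) z →
      Good j (N ℕ.* 7 ℕ.+ suc T) (collect ∷ cs , ⟪ record μ { es = es ; pool = pool } ⟫) z
    collect-ok μ []             pool N       _         _    _ _ fits G = refuel fits (delay (later (N ℕ.* 7) ℕ.≤-refl) (block 1 (coast G)))
    collect-ok μ ((a , u) ∷ es) pool (suc N) (s≤s ∣es∣≤N) sum≤ ≡.refl ≡.refl fits G with suc a ℕ.≤? w
    ... | yes a<w = refuel fits (block 2 (condᵗ (⌊⌋-true (a ℕ.+ 1 ℕ.≤? w) (≡.subst (ℕ._≤ w) (ℕ.+-comm 1 a) a<w)) (block 4
      (collect-ok μ es (u ∷ pool) N ∣es∣≤N sum′ ≡.refl ≡.refl (record { Fits fits ; ∣es∣≤ = ℕ.<⇒≤ ∣es∣≤ ; tags≤ = All.tail tags≤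
        ; ∣pool∣≤ = ≡.subst (ℕ._≤ L) (≡.sym (≡.trans (ℕ.+-identityʳ _) (ℕ.+-identityʳ _))) (ℕ.≤-trans (ℕ.m≤n+m _ (length es)) sum′) }) G))))
      where
      open Fits fits using (tags≤; ∣es∣≤)
      sum′ : length es ℕ.+ suc (length pool) ℕ.≤ L
      sum′ = ℕ.≤-trans (ℕ.≤-reflexive (ℕ.+-suc (length es) (length pool))) sum≤
    ... | no a≮w = refuel fits (block 2 (condᶠ (⌊⌋-false (a ℕ.+ 1 ℕ.≤? w) (λ p → a≮w (≡.subst (ℕ._≤ w) (ℕ.+-comm a 1) p))) (block 4
      (collect-ok μ es pool N ∣es∣≤N (ℕ.<⇒≤ sum≤) ≡.refl ≡.refl (record { Fits fits ; ∣es∣≤ = ℕ.<⇒≤ ∣es∣≤ ; tags≤ = All.tail tags≤ }) G))))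
      where open Fits fits using (tags≤; ∣es∣≤)

    sum-swap : ∀ a b c → a ℕ.+ suc b ℕ.+ c ≡ suc a ℕ.+ b ℕ.+ c
    sum-swap a b c = ≡.cong (ℕ._+ c) (ℕ.+-suc a b)

    bubbles-ok : ∀ μ pool h stk N → (let S = Memory.Q μ) → length pool ℕ.≤ N → suc (length S) ℕ.≤ L →
      All (λ y → F (y ∷ S) ≤ F (h ∷ S)) stk → Fits (record μ { pool = pool ; stk = h ∷ stk }) →
      (∀ h′ stk′ x′ y′ → h′ ∷ stk′ ↭ pool ++ (h ∷ stk) → All (λ y → F (y ∷ S) ≤ F (h′ ∷ S)) stk′ →
        Good 40 T (cs , ⟪ record μ { pool = [] ; stk = h′ ∷ stk′ ; x = x′ ; y = y′ } ⟫) z) →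
      Good j (N ℕ.* 35 ℕ.+ suc T) (while (nonempty elem 4F) bubble ∷ cs , ⟪ record μ { pool = pool ; stk = h ∷ stk } ⟫) z
    bubbles-ok μ [] h stk N _ _ max fits G = refuel fits (delay (later (N ℕ.* 35) ℕ.≤-refl) (block 1
      (coast (G h stk (Memory.x μ) (Memory.y μ) ↭-refl max))))
    bubbles-ok {T = T} {cs = cs} {z = z} μ (p ∷ pool) h stk (suc N) (s≤s ∣pool∣≤N) S< max fits G = refuel fits (block 6
      (evaluate-x (record μ₀ { Q = p ∷ S }) (block 9
        (evaluate-y (record μ₀ { Q = h ∷ S ; x = F (p ∷ S) }) (block 5 (outcome (F (p ∷ S) ≤? F (h ∷ S))))))))
      where
      S : List A
      S = Memory.Q μ
      μ₀ μ₁ : Memory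
      μ₀ = record μ { pool = p ∷ pool ; stk = h ∷ stk }
      μ₁ = record μ₀ { x = F (p ∷ S) ; y = F (h ∷ S) }
      μ₂ : Memory
      μ₂ = record μ { x = F (p ∷ S) ; y = F (h ∷ S) }
      fits₂ : ∀ a b → Fits (record μ₂ { pool = pool ; stk = a ∷ b ∷ stk })
      fits₂ a b = record { Fits fits ; ∣pool∣≤ = ≡.subst (ℕ._≤ L) (≡.sym (sum-swap (length pool) (suc (length stk)) _)) (Fits.∣pool∣≤ fits) }
      outcome : Dec (F (p ∷ S) ≤ F (h ∷ S)) → ∀ {j} → Good (20 ℕ.+ j) (5 ℕ.+ (N ℕ.* 35 ℕ.+ suc T))
        (cond (𝑥 ≤ʳ 𝑦) (push elem 5F (top 5F) ⨾ set elem 5F (lit 1) (top 4F)) (push elem 5F (top 4F)) ∷ pop elem 4F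
          ∷ while (nonempty elem 4F) bubble ∷ cs , ⟪ μ₁ ⟫) z
      outcome (yes p≤h) = condᵗ (⌊⌋-true (F (p ∷ S) ≤? F (h ∷ S)) p≤h) (block 4
        (bubbles-ok μ₂ pool h (p ∷ stk) N ∣pool∣≤N S< (p≤h ∷ max) (fits₂ h p) λ h′ stk′ x′ y′ perm max′ →
          G h′ stk′ x′ y′ (↭-trans perm (↭-trans (++⁺ˡ pool (swap h p ↭-refl)) (↭-shift p pool (h ∷ stk)))) max′))
      outcome (no p≰h) = condᶠ (⌊⌋-false (F (p ∷ S) ≤? F (h ∷ S)) p≰h) (delay (later 2 ℕ.≤-refl) (block 2
        (bubbles-ok μ₂ pool p (h ∷ stk) N ∣pool∣≤N S< (≰⇒≥ p≰h ∷ All.map (λ y≤h → ≤-trans y≤h (≰⇒≥ p≰h)) max) (fits₂ p h) λ h′ stk′ x′ y′ perm max′ →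
          G h′ stk′ x′ y′ (↭-trans perm (↭-shift p pool (h ∷ stk))) max′)))

    take-ok : ∀ μ {S h stk} → Memory.Q μ ≡ S → Memory.stk μ ≡ h ∷ stk →
      Good j T (cs , ⟪ record μ { Q = pick S h ; x = F S ; y = F (h ∷ S) } ⟫) z → Good (20 ℕ.+ j) (20 ℕ.+ T) (take ∷ cs , ⟪ μ ⟫) z
    take-ok {j = j} {T = T} {cs = cs} {z = z} μ {S} {h} {stk} ≡.refl ≡.refl G = block 1 (evaluate-x μ (block 5
      (evaluate-y (record μ { Q = h ∷ S ; x = F S }) outcome)))
      where
      outcome : Good (4 ℕ.+ j) (4 ℕ.+ T) (cond (𝑥 ≤ʳ 𝑦) skip popQ ∷ cs , ⟪ record μ { Q = h ∷ S ; x = F S ; y = F (h ∷ S) } ⟫) z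
      outcome with F S ≤? F (h ∷ S)
      ... | yes p = condᵗ (⌊⌋-true (F S ≤? F (h ∷ S)) p) (weaken (ℕ.m≤n+m (1 ℕ.+ j) 2) (ℕ.m≤n+m (1 ℕ.+ T) 2) ≤-refl (block 1 G))
      ... | no ¬p = condᶠ (⌊⌋-false (F S ≤? F (h ∷ S)) ¬p) (block 3 G)

    move₅-ok : ∀ μ stk pool N → length stk ℕ.≤ N → Fits (record μ { pool = pool ; stk = stk }) →
      Good 40 T (cs , ⟪ record μ { pool = stk ʳ++ pool ; stk = [] } ⟫) z →
      Good j (N ℕ.* 4 ℕ.+ suc T) (while (nonempty elem 5F) (push elem 4F (top 5F) ⨾ pop elem 5F) ∷ cs , ⟪ record μ { pool = pool ; stk = stk } ⟫) z
    move₅-ok μ []        pool N       _         fits G = refuel fits (delay (later (N ℕ.* 4) ℕ.≤-refl) (block 1 (coast G)))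
    move₅-ok μ (h ∷ stk) pool (suc N) (s≤s ∣stk∣≤N) fits G = refuel fits (block 4 (move₅-ok μ stk (h ∷ pool) N ∣stk∣≤N
      (record { Fits fits ; ∣pool∣≤ = ≡.subst (ℕ._≤ L) (sum-swap (length pool) (length stk) _) (Fits.∣pool∣≤ fits) }) G))

    move₆-ok : ∀ μ rem pool N → Memory.stk μ ≡ [] → length rem ℕ.≤ N → Fits (record μ { pool = pool ; rem = rem }) →
      Good 40 T (cs , ⟪ record μ { pool = rem ʳ++ pool ; rem = [] } ⟫) z →
      Good j (N ℕ.* 4 ℕ.+ suc T) (while (nonempty elem 6F) (push elem 4F (top 6F) ⨾ pop elem 6F) ∷ cs , ⟪ record μ { pool = pool ; rem = rem } ⟫) z
    move₆-ok μ []        pool N       _      _         fits G = refuel fits (delay (later (N ℕ.* 4) ℕ.≤-refl) (block 1 (coast G)))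
    move₆-ok μ (h ∷ rem) pool (suc N) ≡.refl (s≤s ∣rem∣≤N) fits G = refuel fits (block 4 (move₆-ok μ rem (h ∷ pool) N ≡.refl ∣rem∣≤N
      (record { Fits fits ; ∣pool∣≤ = ≡.subst (ℕ._≤ L) (ℕ.+-suc (length pool ℕ.+ 0) (length rem)) (Fits.∣pool∣≤ fits) }) G))

    -- A relation, because ties leave the set M of the c largest candidates undetermined; bounds are
    -- demanded for every possible choice.
    Top : List A → ℕ → List A → List A → List A → Set ℓ₂
    Top S c C M R = M ++ R ↭ C × length M ≡ c × All (λ w → All (λ u → F (w ∷ S) ≤ F (u ∷ S)) M) R

    inv-value : ∀ c σ′ → ⟦ 𝑖 ⟧ⁿ σ′ ≡ just (suc c) → ⟦ inv (real 𝑖) ⟧ʳ σ′ ≡ just (fromℕ (suc c) ⁻¹)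
    inv-value c σ′ eq rewrite eq | ⌊⌋-false (fromℕ (suc c) ≟ 0#) (0<⇒≉0 (fromℕ-pos c)) = ≡.refl

    module _ (P S : List A) (S< : suc (length S) ℕ.≤ L) where

      -- `φ u` is the value guaranteed once u is chosen, and z may be at most the mean of φ over any
      -- set of c + 1 best candidates. After the maximum has been put aside, the target changes to
      -- the mean over the others as given by `mean`.
      rounds-ok : ∀ (φ : A → Carrier) μ c C rm → suc c ℕ.≤ length C → C ++ rm ↭ P →
        Fits (record μ { i = suc c ; pool = C ; stk = [] ; rem = rm ; Q = S }) →
        (∀ M R → Top S (suc c) C M R → fromℕ (suc c) * z ≤ sumOf φ M) →
        (∀ u pool′ rem′ x′ y′ → pool′ ++ rem′ ↭ P →
          Good 30 T (cs , ⟪ record μ { i = 0 ; Q = pick S u ; pool = pool′ ; stk = [] ; rem = rem′ ; x = x′ ; y = y′ } ⟫) (φ u)) →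
        Good j (suc c ℕ.* roundCost L ℕ.+ suc T) (while (lit 1 ≤ⁿ 𝑖) round ∷ cs , ⟪ record μ { i = suc c ; pool = C ; stk = [] ; rem = rm ; Q = S } ⟫) z
      rounds-ok {z = z} {T = T} {cs = cs} φ μ c (a ∷ C) rm (s≤s c≤) perm fits top≤ G =
        costs (round-time L (c ℕ.* roundCost L) (suc T)) (refuel fits (block 6
          (bubbles-ok μ₀ C a [] L C≤L S< [] fits₁ λ h st x′ y′ perm′ max → block 1
            (toss (inv-value c ⟪ record μ₀ { pool = [] ; stk = h ∷ st ; x = x′ ; y = y′ } ⟫ ≡.refl) (0<chance c) (chance≤1 c) (success h st x′ y′ perm′)
              (λ p<1 → failure c c≤ fits top≤ p<1 h st x′ y′ perm′ max)
              (mean-≤ c z (φ h) λ { ≡.refl → top≤ (h ∷ []) st (↭-trans perm′ (++-comm C (a ∷ [])) , ≡.refl , All.map (_∷ []) max) })))))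
        where
        μ₀ : Memory
        μ₀ = record μ { i = suc c ; stk = [] ; rem = rm ; Q = S }
        C≤L : length C ℕ.≤ L
        C≤L = ℕ.≤-trans (ℕ.n≤1+n _) (ℕ.≤-trans (ℕ.m≤m+n _ _) (ℕ.≤-trans (ℕ.m≤m+n _ _) (Fits.∣pool∣≤ fits)))
        lengths : ∀ {h : A} {st} → h ∷ st ↭ C ++ a ∷ [] → length st ≡ length C
        lengths perm′ = ℕ.suc-injective (≡.trans (↭-length perm′) (≡.trans (List.length-++ C) (ℕ.+-comm (length C) 1)))
        fits₁ : Fits (record μ₀ { pool = C ; stk = a ∷ [] })
        fits₁ = record { Fits fits ; ∣pool∣≤ = ≡.subst (ℕ._≤ L) (≡.sym (sum-swap (length C) 0 _)) (Fits.∣pool∣≤ fits) }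
        rest : List Cmd
        rest = while (lit 1 ≤ⁿ 𝑖) round ∷ cs
        branch : Cmd
        branch = cond (lit 1 ≤ⁿ top 3F)
          (pop nat 3F ⨾ take ⨾ set nat 0F (lit 1) (lit 0))
          (pop nat 3F ⨾ push elem 6F (top 5F) ⨾ pop elem 5F ⨾ set nat 0F (lit 1) (𝑖 ⊖ lit 1))
          ⨾ while (nonempty elem 5F) (push elem 4F (top 5F) ⨾ pop elem 5F)
        fits₂ : ∀ {h st} → h ∷ st ↭ C ++ a ∷ [] → Fits (record μ₀ { pool = [] ; stk = h ∷ st })
        fits₂ {h} {st} perm′ = record { Fits fits ; ∣pool∣≤ = ≡.subst (λ l → suc l ℕ.+ length rm ℕ.≤ L)
          (≡.trans (ℕ.+-identityʳ (length C)) (≡.sym (lengths perm′))) (Fits.∣pool∣≤ fits) }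
        success : ∀ h st x′ y′ → h ∷ st ↭ C ++ a ∷ [] →
          Good 38 (26 ℕ.+ (L ℕ.* 4 ℕ.+ suc (c ℕ.* roundCost L ℕ.+ suc T))) (branch ∷ rest , pushⁿ 3F 1 ⟪ record μ₀ { pool = [] ; stk = h ∷ st ; x = x′ ; y = y′ } ⟫) (φ h)
        success h st x′ y′ perm′ = block 5 (take-ok (record μ₀ { pool = [] ; stk = h ∷ st ; x = x′ ; y = y′ }) ≡.refl ≡.refl (block 1
          (move₅-ok (record μ₀ { i = 0 ; Q = pick S h ; x = F S ; y = F (h ∷ S) }) (h ∷ st) [] L
            (≡.subst (λ l → suc l ℕ.≤ L) (≡.sym (lengths perm′)) (ℕ.≤-trans (ℕ.m≤m+n _ _) (ℕ.≤-trans (ℕ.m≤m+n _ _) (Fits.∣pool∣≤ fits))))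
            (record { Fits (fits₂ perm′) ; i≤ = z≤n ; ∣Q∣≤ = ℕ.≤-trans (length-pick S h) S< })
            (delay (later (c ℕ.* roundCost L) ℕ.≤-refl) (block 1 (weaken (ℕ.m≤m+n 30 9) ℕ.≤-refl ≤-refl
              (G h ((h ∷ st) ʳ++ []) rm (F S) (F (h ∷ S)) (↭-trans (++⁺ʳ rm (↭-trans (ʳ++-↭ (h ∷ st) [])
                (↭-trans (↭-reflexive (List.++-identityʳ (h ∷ st))) (↭-trans perm′ (++-comm C (a ∷ [])))))) perm))))))))
        failure : ∀ c → c ℕ.≤ length C → Fits (record μ { i = suc c ; pool = a ∷ C ; stk = [] ; rem = rm ; Q = S }) →
          (∀ M R → Top S (suc c) (a ∷ C) M R → fromℕ (suc c) * z ≤ sumOf φ M) → chance c < 1# →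
          ∀ h st x′ y′ → h ∷ st ↭ C ++ a ∷ [] → All (λ y → F (y ∷ S) ≤ F (h ∷ S)) st →
          Good 38 (26 ℕ.+ (L ℕ.* 4 ℕ.+ suc (c ℕ.* roundCost L ℕ.+ suc T))) (branch ∷ rest
            , pushⁿ 3F 0 ⟪ record μ { i = suc c ; stk = h ∷ st ; rem = rm ; Q = S ; pool = [] ; x = x′ ; y = y′ } ⟫) (mean c z (φ h))
        failure zero    _  _     _    p<1 = contradiction 1≤chance0 p<1
        failure (suc c) c≤ fits′ top≤ p<1 h st x′ y′ perm′ max = delay (later 17 ℕ.≤-refl) (block 9
          (move₅-ok (record μ { i = suc c ; rem = h ∷ rm ; Q = S ; x = x′ ; y = y′ }) st [] L
            (≡.subst (ℕ._≤ L) (≡.sym (lengths perm′)) C≤L) fits₃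
            (rounds-ok φ (record μ { x = x′ ; y = y′ }) c (st ʳ++ []) (h ∷ rm) (≡.subst (suc c ℕ.≤_) (≡.sym ∣C′∣) c≤)
              perm₃ fits₄ below≤ λ u pool′ rem′ x″ y″ → G u pool′ rem′ x″ y″)))
          where
          ∣C′∣ : length (st ʳ++ []) ≡ length C
          ∣C′∣ = ≡.trans (List.length-ʳ++ st) (≡.trans (ℕ.+-identityʳ _) (lengths perm′))
          C′↭ : st ʳ++ [] ↭ st
          C′↭ = ↭-trans (ʳ++-↭ st []) (↭-reflexive (List.++-identityʳ st))
          hC′↭ : h ∷ (st ʳ++ []) ↭ a ∷ C
          hC′↭ = ↭-trans (prep h C′↭) (↭-trans perm′ (++-comm C (a ∷ [])))
          i≤′ : suc c ℕ.≤ 2 ℕ.^ B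
          i≤′ = ℕ.≤-trans (ℕ.n≤1+n _) (Fits.i≤ fits′)
          pool≤ : length C ℕ.+ suc (length rm) ℕ.≤ L
          pool≤ = ≡.subst (ℕ._≤ L) (≡.trans (≡.cong (λ l → suc l ℕ.+ length rm) (ℕ.+-identityʳ (length C))) (≡.sym (ℕ.+-suc (length C) (length rm)))) (Fits.∣pool∣≤ fits)
          fits₃ : Fits (record μ { i = suc c ; rem = h ∷ rm ; Q = S ; x = x′ ; y = y′ ; pool = [] ; stk = st })
          fits₃ = record { Fits fits′ ; i≤ = i≤′ ; ∣pool∣≤ = ≡.subst (λ l → l ℕ.+ suc (length rm) ℕ.≤ L) (≡.sym (lengths perm′)) pool≤ }
          fits₄ : Fits (record μ { i = suc c ; rem = h ∷ rm ; Q = S ; x = x′ ; y = y′ ; pool = st ʳ++ [] ; stk = [] })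
          fits₄ = record { Fits fits′ ; i≤ = i≤′ ; ∣pool∣≤ = ≡.subst (λ l → l ℕ.+ suc (length rm) ℕ.≤ L) (≡.sym (≡.trans (ℕ.+-identityʳ _) ∣C′∣)) pool≤ }
          perm₃ : (st ʳ++ []) ++ (h ∷ rm) ↭ P
          perm₃ = ↭-trans (↭-shift h (st ʳ++ []) rm) (↭-trans (++⁺ʳ rm hC′↭) perm)
          -- Best candidates among the remaining ones become best among all when h, the maximum, is
          -- added to them; thus the hypothesis on z applies to `h ∷ M`.
          below≤ : ∀ M R → Top S (suc c) (st ʳ++ []) M R → fromℕ (suc c) * mean (suc c) z (φ h) ≤ sumOf φ M
          below≤ M R (MR↭ , ∣M∣ , tops) = ≤-trans (≤-reflexive (mean-* c z (φ h))) (+-cancelˡ-≤ (φ h) (≤-trans (≤-reflexive (-‿cancelʳ _ _))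
            (top≤ (h ∷ M) R (↭-trans (prep h MR↭) hC′↭ , ≡.cong suc ∣M∣ ,
              All.tabulate λ {w} w∈R → All.lookup max (∈-resp-↭ C′↭ (∈-resp-↭ MR↭ (∈-++⁺ʳ M w∈R))) ∷ All.lookup tops w∈R))))

    private
      n∸[n∸m]≤m : ∀ n m → n ℕ.∸ (n ℕ.∸ m) ℕ.≤ m
      n∸[n∸m]≤m n m with ℕ.≤-total n m
      ... | inj₁ n≤m rewrite ℕ.m≤n⇒m∸n≡0 n≤m = n≤m
      ... | inj₂ m≤n = ℕ.≤-reflexive (ℕ.m∸[m∸n]≡n m≤n)

    module _ (P : List A) (κ : ℕ) (κ≤∣P∣ : κ ℕ.≤ length P) (P≤L : length P ℕ.≤ L) (κ≤2^B : κ ℕ.≤ 2 ℕ.^ B)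
      (Φ : ℕ → List A → Carrier)
      (Φ-step : ∀ i S M R → Top S κ P M R → fromℕ κ * Φ (suc i) S ≤ sumOf (λ u → Φ i (pick S u)) M) where

      iterations-ok : ∀ μ t S pool N → t ℕ.≤ N → pool ↭ P → length S ℕ.+ t ℕ.≤ κ →
        Fits (record μ { t = t ; s = κ ; pool = pool ; stk = [] ; rem = [] ; Q = S }) →
        (∀ S′ pool′ i′ x′ y′ → pool′ ↭ P → length S′ ℕ.≤ κ →
          Fits (record μ { t = 0 ; i = i′ ; s = κ ; pool = pool′ ; stk = [] ; rem = [] ; Q = S′ ; x = x′ ; y = y′ }) →
          Good 40 T (cs , ⟪ record μ { t = 0 ; i = i′ ; s = κ ; pool = pool′ ; stk = [] ; rem = [] ; Q = S′ ; x = x′ ; y = y′ } ⟫) (Φ 0 S′)) →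
        Good j (N ℕ.* greedyCost L ℕ.+ suc T) (while (lit 1 ≤ⁿ 𝑡)
          (set nat 0F (lit 1) 𝑠 ⨾ while (lit 1 ≤ⁿ 𝑖) round
            ⨾ while (nonempty elem 6F) (push elem 4F (top 6F) ⨾ pop elem 6F)
            ⨾ set nat 0F (lit 0) (𝑡 ⊖ lit 1)) ∷ cs , ⟪ record μ { t = t ; s = κ ; pool = pool ; stk = [] ; rem = [] ; Q = S } ⟫) (Φ t S)
      iterations-ok μ zero S pool N _ pool↭P S≤ fits G = refuel fits (delay (later (N ℕ.* greedyCost L) ℕ.≤-refl) (block 1 (coast
        (G S pool (Memory.i μ) (Memory.x μ) (Memory.y μ) pool↭P (≡.subst (ℕ._≤ κ) (ℕ.+-identityʳ (length S)) S≤) (record { Fits fits })))))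
      iterations-ok {T = T} {cs = cs} μ (suc t) S pool (suc N) (s≤s t≤N) pool↭P S≤ fits G =
        costs (greedy-time L (N ℕ.* greedyCost L) (suc T)) (refuel fits (block 4 (enter κ ≡.refl)))
        where
        next-iteration : ℕ
        next-iteration = 1 ℕ.+ (L ℕ.* 4 ℕ.+ suc (1 ℕ.+ (N ℕ.* greedyCost L ℕ.+ suc T)))
        S<κ : suc (length S) ℕ.≤ κ
        S<κ = ℕ.≤-trans (ℕ.≤-trans (s≤s (ℕ.m≤m+n (length S) t)) (ℕ.≤-reflexive (≡.sym (ℕ.+-suc (length S) t)))) S≤
        S<L : suc (length S) ℕ.≤ L
        S<L = ℕ.≤-trans S<κ (ℕ.≤-trans κ≤∣P∣ P≤L)
        loop : Cmd
        loop = while (lit 1 ≤ⁿ 𝑡)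
          (set nat 0F (lit 1) 𝑠 ⨾ while (lit 1 ≤ⁿ 𝑖) round
            ⨾ while (nonempty elem 6F) (push elem 4F (top 6F) ⨾ pop elem 6F)
            ⨾ set nat 0F (lit 0) (𝑡 ⊖ lit 1))
        rest : List Cmd
        rest = (while (nonempty elem 6F) (push elem 4F (top 6F) ⨾ pop elem 6F) ⨾ set nat 0F (lit 0) (𝑡 ⊖ lit 1)) ∷ loop ∷ cs
        μ₀ : Memory
        μ₀ = record μ { t = suc t ; s = κ ; stk = [] ; rem = [] ; Q = S }
        again : ∀ u pool′ rem′ x′ y′ → pool′ ++ rem′ ↭ P →
          Good 30 next-iteration (rest , ⟪ record μ₀ { i = 0 ; Q = pick S u ; pool = pool′ ; stk = [] ; rem = rem′ ; x = x′ ; y = y′ } ⟫) (Φ t (pick S u))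
        again u pool′ rem′ x′ y′ perm = block 1 (move₆-ok (record μ₀ { i = 0 ; Q = pick S u ; x = x′ ; y = y′ }) rem′ pool′ L ≡.refl
          (ℕ.≤-trans (ℕ.m≤n+m _ (length pool′)) sum≤) fits₁
          (block 1 (iterations-ok (record μ { i = 0 ; x = x′ ; y = y′ }) t (pick S u) (rem′ ʳ++ pool′) N t≤N
            perm₂ (ℕ.≤-trans (ℕ.+-monoˡ-≤ t (length-pick S u)) (ℕ.≤-trans (ℕ.≤-reflexive (≡.sym (ℕ.+-suc (length S) t))) S≤)) fits₂
            λ S′ pool″ i″ x″ y″ → G S′ pool″ i″ x″ y″)))
          where
          sum≤ : length pool′ ℕ.+ length rem′ ℕ.≤ L
          sum≤ = ℕ.≤-trans (ℕ.≤-reflexive (≡.trans (≡.sym (List.length-++ pool′)) (↭-length perm))) P≤L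
          perm₂ : rem′ ʳ++ pool′ ↭ P
          perm₂ = ↭-trans (ʳ++-↭ rem′ pool′) (↭-trans (++-comm rem′ pool′) perm)
          fits₁ : Fits (record μ₀ { i = 0 ; Q = pick S u ; pool = pool′ ; stk = [] ; rem = rem′ ; x = x′ ; y = y′ })
          fits₁ = record { Fits fits ; i≤ = z≤n ; ∣Q∣≤ = ℕ.≤-trans (length-pick S u) S<L
            ; ∣pool∣≤ = ≡.subst (λ l → l ℕ.+ length rem′ ℕ.≤ L) (≡.sym (ℕ.+-identityʳ (length pool′))) sum≤ }
          fits₂ : Fits (record μ { t = t ; i = 0 ; s = κ ; Q = pick S u ; pool = rem′ ʳ++ pool′ ; stk = [] ; rem = [] ; x = x′ ; y = y′ })
          fits₂ = record { Fits fits₁ ; t≤ = ℕ.≤-trans (ℕ.n≤1+n t) (Fits.t≤ fits)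
            ; ∣pool∣≤ = ≡.subst (ℕ._≤ L) (≡.sym (≡.trans (≡.trans (ℕ.+-identityʳ _) (ℕ.+-identityʳ _)) (↭-length perm₂))) P≤L }
        enter : ∀ κ′ → κ′ ≡ κ → Good 56 (L ℕ.* roundCost L ℕ.+ suc next-iteration) (while (lit 1 ≤ⁿ 𝑖) round ∷ rest
          , ⟪ record μ₀ { i = κ′ ; pool = pool ; stk = [] ; rem = [] ; Q = S } ⟫) (Φ (suc t) S)
        enter zero    ≡.refl = contradiction S<κ λ ()
        enter (suc c) ≡.refl = delay (ℕ.+-monoˡ-≤ (suc next-iteration) (ℕ.*-monoˡ-≤ (roundCost L) (ℕ.≤-trans κ≤∣P∣ P≤L)))
          (rounds-ok P S S<L (λ u → Φ t (pick S u)) μ₀ c pool [] (ℕ.≤-trans κ≤∣P∣ (ℕ.≤-reflexive (≡.sym (↭-length pool↭P))))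
            (↭-trans (↭-reflexive (List.++-identityʳ pool)) pool↭P) (record { Fits fits ; i≤ = κ≤2^B })
            (λ M R (perm , ∣M∣ , tops) → Φ-step t S M R (↭-trans perm pool↭P , ∣M∣ , tops)) again)

    halt-ok : ∀ μ → Best (Memory.b μ) (Memory.out μ) → ∀ {z} → z ≤ Memory.b μ → ∀ {j T} → Good j T ([] , ⟪ μ ⟫) z
    halt-ok μ (b≤ , ∣out∣≤k , _) z≤b = done (ℕ.≤-trans (∣toSet∣≤length (Memory.out μ)) ∣out∣≤k) (≤-trans z≤b (≤-trans b≤ (≤-reflexive (F≈f (Memory.out μ)))))

    ending : List Cmd
    ending = (collect ⨾ greedy ⨾ evaluate (lit 5) ⨾ improve) ∷ []

    -- Φ is left abstract because two potentials are used: a constant, if the stream has already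
    -- produced a good set, and that of random greedy otherwise. In both cases the final `improve`
    -- attains Φ 0.
    ending-ok : ∀ μ → (let open Memory μ using (es; b; τ)) → Ready [] μ → Invariant D ps b τ es → (P : List A) → P ≡ below w es ʳ++ [] →
      (κ : ℕ) → κ ≡ k ℕ.∸ (k ℕ.∸ length P) → (Φ : ℕ → List A → Carrier) →
      (∀ i S M R → Top S κ P M R → fromℕ κ * Φ (suc i) S ≤ sumOf (λ u → Φ i (pick S u)) M) →
      (∀ S → Φ 0 S ≤ F S ⊎ Φ 0 S ≤ b) →
      Good j (suc (finishCost L)) (ending , ⟪ μ ⟫) (Φ κ [])
    ending-ok μ ready@record { stk≡[] = ≡.refl ; rem≡ = ≡.refl ; Q≡[] = ≡.refl ; pool≡[] = ≡.refl } ivt P ≡.refl κ ≡.refl Φ Φ-step Φ-end =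
      refuel fits (block 1 (delay (finish-time L) (collect-ok μ es [] L (ℕ.<⇒≤ ∣es∣<) (ℕ.≤-trans (ℕ.≤-reflexive (ℕ.+-identityʳ _)) (ℕ.<⇒≤ ∣es∣<)) ≡.refl ≡.refl fits
        (block 5 (iterations-ok P κ (n∸[n∸m]≤m k (length P)) P≤L κ≤2^B Φ Φ-step (record μ { es = [] }) κ [] P L
          (ℕ.≤-trans (n∸[n∸m]≤m k (length P)) P≤L) ↭-refl ℕ.≤-refl
          (record { Fits fits ; t≤ = κ≤2^B ; s≤ = κ≤2^B ; ∣es∣≤ = ℕ.≤-trans (ℕ.≤-reflexive (≡.cong length (Ready.ts≡[] ready))) z≤n ; tags≤ = []
            ; ∣pool∣≤ = ≡.subst (ℕ._≤ L) (≡.sym (≡.trans (ℕ.+-identityʳ _) (ℕ.+-identityʳ _))) P≤L })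
          λ S′ pool′ i′ x′ y′ perm S′≤κ fits′ → block 1
            (evaluate-y (record μ { es = [] ; t = 0 ; i = i′ ; s = κ ; pool = pool′ ; stk = [] ; rem = [] ; Q = S′ ; x = x′ ; y = y′ })
              (improve-ok (record μ { es = [] ; t = 0 ; i = i′ ; s = κ ; pool = pool′ ; stk = [] ; rem = [] ; Q = S′ ; x = x′ ; y = F S′ })
                (record { Fits fits′ }) ≡.refl (ℕ.≤-trans S′≤κ (ℕ.m∸n≤m k (k ℕ.∸ length P))) (Ready.best ready)
                λ b′ out′ b≤b′ FS≤b′ best′ → halt-ok _ best′ ([ (λ p → ≤-trans p FS≤b′) , (λ p → ≤-trans p b≤b′) ]′ (Φ-end S′)))))))))
      where
      open Memory μ using (es)
      open Invariant ivt using (uniq; sizes; tags)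
      ∣es∣< : suc (length es) ℕ.≤ L
      ∣es∣< = entries-fit tags uniq sizes
      fits : Fits μ
      fits = Ready-fits μ ready tags ∣es∣<
      P≤L : length P ℕ.≤ L
      P≤L = ℕ.≤-trans (ℕ.≤-reflexive (≡.trans (List.length-ʳ++ (below w es)) (ℕ.+-identityʳ _))) (ℕ.≤-trans (length-below w es) (ℕ.<⇒≤ ∣es∣<))
      κ≤2^B : κ ℕ.≤ 2 ℕ.^ B
      κ≤2^B = ℕ.≤-trans (ℕ.m∸n≤m k (k ℕ.∸ length P)) k≤2^B

    -- Value of the solution

    module _ (O : List A) (O-unique : Unique O) (∣O∣≤k : length O ℕ.≤ k) (ζ : Carrier) (0≤ζ : 0# ≤ ζ)
      (ratio : fromℕ 4 * (fromℕ (suc w) * ζ) + F O ≤ fromℕ w * F O) where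

      ending-value : ∀ μ → Ready [] μ → Invariant D ps (Memory.b μ) (Memory.τ μ) (Memory.es μ) → (∀ x → x ∈ ps) →
        Good j (suc (finishCost L)) (ending , ⟪ μ ⟫) ζ
      ending-value {ps = ps} {j = j} μ ready ivt all with ζ ≤? Memory.b μ
      -- With the constant potential ζ the outcome of random greedy is immaterial, since `improve`
      -- never lowers the best value.
      ... | yes ζ≤b = ending-ok μ ready ivt _ ≡.refl _ ≡.refl (λ _ _ → ζ)
        (λ i S M R (_ , ∣M∣ , _) → ≤-reflexive (≡.subst (λ κ → fromℕ κ * ζ ≈ sumOf (λ _ → ζ) M) ∣M∣ (sym (constant M)))) (λ _ → inj₂ ζ≤b)
        where
        constant : ∀ (M : List A) → sumOf (λ _ → ζ) M ≈ fromℕ (length M) * ζ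
        constant []      = sym (zeroˡ ζ)
        constant (_ ∷ M) = trans (+-congˡ (constant M)) (solve 2 (λ ζ l → ζ :+ l :* ζ := (con 1 :+ l) :* ζ) refl ζ (fromℕ (length M)))
      ... | no ζ≰b = final κ ≡.refl
        where
        open Memory μ using (b; τ; es)
        open Invariant ivt using (τ-nonNeg; τ≤br; F[]≤b; groups; uniq; sizes)
        open Group (groups 0) using (light; disjoint; reject)
        P : List A
        P = below w es ʳ++ []
        κ : ℕ
        κ = k ℕ.∸ (k ℕ.∸ length P)
        ∈P : ∀ {i u} → i ℕ.< w → u ∈ members i es → u ∈ P
        ∈P i<w u∈ = ⊆-ʳ++ (below w es) (∈-++⁺ˡ (∈-below⁺ es i<w u∈))
        P-unique : Unique P
        P-unique = Unique-resp-↭ (↭-sym (↭-trans (ʳ++-↭ (below w es) []) (↭-reflexive (List.++-identityʳ (below w es)))))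
          (Unique-below w es uniq disjoint)
        Ls : List (List A)
        Ls = applyUpTo (λ i → members i es) w
        -- The common upper bound for b and τ in the comparison: b ≤ ζ and τ ≤ b r ≤ ζ r.
        ζ′ : Carrier
        ζ′ = ζ * r
        ζ≤ζ′ : ζ ≤ ζ′
        ζ≤ζ′ = ≤-*r 0≤ζ
        b≤ζ : b ≤ ζ
        b≤ζ = ≰⇒≥ ζ≰b
        module C = Comparison k {{k≢0}} P O O-unique ∣O∣≤k
        ws : Mixture
        ws = C.mixture Ls
        W : ℕ
        W = total-weight ws
        ws-inside : Inside P ws
        ws-inside = C.mixture-inside Ls (All.applyUpTo⁺₁ _ w (λ {i} i<w → uniq i , ∈P i<w))
        -- A pool with at least k elements has κ = k, the mean size for which the mixture was
        -- designed. In a smaller pool κ = |P|, and no subset of P is larger.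
        size≤ : total-size ws ℕ.≤ W ℕ.* κ
        size≤ with ℕ.≤-total k (length P)
        ... | inj₁ k≤P = ≡.subst (λ κ → total-size ws ℕ.≤ W ℕ.* κ) (≡.sym (≡.cong (k ℕ.∸_) (ℕ.m≤n⇒m∸n≡0 k≤P)))
          (ℕ.≤-trans (C.mixture-size Ls (All.applyUpTo⁺₁ _ w (λ {i} _ → sizes i))) (ℕ.≤-reflexive (≡.cong (ℕ._* k) (≡.sym (C.mixture-weight Ls)))))
        ... | inj₂ P≤k = ≡.subst (λ κ → total-size ws ℕ.≤ W ℕ.* κ) (≡.sym (ℕ.m∸[m∸n]≡n P≤k)) (size≤weight*length ws ws-inside)
        accepted : All (C.Accepted τ-nonNeg (≤-trans b≤ζ ζ≤ζ′) (≤-trans τ≤br (*-monoʳ-≤ 0≤r b≤ζ))) Ls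
        accepted = All.applyUpTo⁺₁ _ w λ {i} i<w → light i i<w ,
          All.tabulate λ {u} _ → [ (λ (i′ , i′<w , u∈) → inj₁ (∈P i′<w u∈)) , (λ rej → inj₂ (rej i i<w)) ]′ (reject (all u))
        ∣Ls∣ : length Ls ≡ w
        ∣Ls∣ = List.length-applyUpTo (λ i → members i es) w
        gain : fromℕ 3 * (fromℕ W * ζ′) ≤ H ws []
        gain = C.mixture-value τ-nonNeg (≤-trans b≤ζ ζ≤ζ′) (≤-trans τ≤br (*-monoʳ-≤ 0≤r b≤ζ)) Ls
          (AllPairs.applyUpTo⁺₁ _ w λ {i} {i′} i<i′ i′<w → disjoint i i′ (ℕ.<-trans i<i′ i′<w) i′<w (ℕ.<⇒≢ i<i′)) accepted
          (≡.subst (λ l → fromℕ 4 * (fromℕ l * ζ′) + F O ≤ fromℕ l * F O) (≡.sym ∣Ls∣) (≤-trans (+-monoˡ-≤ (F O) (*-monoˡ-≤ (fromℕ-nonNeg 4) (≤-reflexive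
            (trans (solve 3 (λ w ζ r → w :* (ζ :* r) := (w :* r) :* ζ) refl (fromℕ w) ζ r) (*-congʳ wr≈1+w))))) ratio))
        W≡ : W ≡ w ℕ.* k
        W≡ = ≡.trans (C.mixture-weight Ls) (≡.cong (ℕ._* k) ∣Ls∣)
        0<W : 0# < fromℕ W
        0<W = fromℕ-pos′ W {{≡.subst NonZero (≡.sym W≡) (ℕ.m*n≢0 w k {{w≢0}} {{k≢0}})}}
        final : ∀ κ′ → κ′ ≡ κ → Good j (suc (finishCost L)) (ending , ⟪ μ ⟫) ζ
        -- Zero iterations mean an empty pool. All sets of the mixture are then empty, so the gain
        -- would give ζ ≤ F([]) ≤ b.
        final zero 0≡κ = contradiction ζ≤b ζ≰b
          where
          P≡[] : P ≡ []
          P≡[] with ℕ.≤-total k (length P)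
          ... | inj₁ k≤P = contradiction (≡.trans (≡.sym (≡.cong (k ℕ.∸_) (ℕ.m≤n⇒m∸n≡0 k≤P))) (≡.sym 0≡κ)) (ℕ.≢-nonZero⁻¹ k {{k≢0}})
          ... | inj₂ P≤k = empty P (≡.trans (≡.sym (ℕ.m∸[m∸n]≡n P≤k)) (≡.sym 0≡κ))
            where
            empty : ∀ (P : List A) → length P ≡ 0 → P ≡ []
            empty [] _ = ≡.refl
          ζ≤b : ζ ≤ b
          ζ≤b = *-cancelˡ-≤ 0<W (begin
            fromℕ W * ζ                 ≤⟨ *-monoˡ-≤ (0<⇒0≤ 0<W) ζ≤ζ′ ⟩
            fromℕ W * ζ′                ≤⟨ ≤-+ʳ (*-nonNeg (fromℕ-nonNeg 2) (*-nonNeg (0<⇒0≤ 0<W) (≤-trans 0≤ζ ζ≤ζ′))) ⟩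
            fromℕ W * ζ′ + fromℕ 2 * (fromℕ W * ζ′) ≈⟨ solve 2 (λ a t → a :+ t :* a := (con 1 :+ t) :* a) refl (fromℕ W * ζ′) (fromℕ 2) ⟩
            fromℕ 3 * (fromℕ W * ζ′)    ≤⟨ gain ⟩
            H ws []                     ≤⟨ H-empty ws (≡.subst (λ P → Inside P ws) P≡[] ws-inside) ⟩
            fromℕ W * F []              ≤⟨ *-monoˡ-≤ (0<⇒0≤ 0<W) F[]≤b ⟩
            fromℕ W * b                 ∎)
            where open ≤-Reasoning
        final (suc c) c≡κ = weaken ℕ.≤-refl ℕ.≤-refl (Pot.potential-start yW≈1 (≤-trans (*-monoˡ-≤ (fromℕ-nonNeg 3) (*-monoˡ-≤ (0<⇒0≤ 0<W) ζ≤ζ′)) gain))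
          (ending-ok μ ready ivt P ≡.refl (suc c) c≡κ Pot.potential
            (λ i S M R (perm , ∣M∣ , tops) → Pot.potential-step i S M R (∈-resp-↭ (↭-sym perm)) ∣M∣
              (Unique-++⁻ˡ M (Unique-resp-↭ (↭-sym perm) P-unique)) ws-inside tops
              (≡.subst (λ κ → total-size ws ℕ.≤ W ℕ.* κ) (≡.sym c≡κ) size≤))
            (λ S → inj₁ (≤-reflexive (Pot.potential-zero S yW≈1))))
          where
          yW≈1 : fromℕ W ⁻¹ * fromℕ W ≈ 1#
          yW≈1 = ⁻¹-inverseˡ 0<W
          module Pot = Potential ws c (fromℕ W ⁻¹) (⁻¹-nonNeg 0<W)

    push-real : ∀ {a e v} → ⟦ e ⟧ʳ σ ≡ just v → Good j T (cs , pushʳ a v σ) z → Good (suc j) (suc T) (push real a e ∷ cs , σ) z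
    push-real {σ} {cs = cs} {a = a} eq G = det (≡.subst (λ v → Good _ _ (cs , when v (λ v → pushʳ a v σ) σ) _) (≡.sym eq) G)

    μ₀ : Memory
    μ₀ = record { str = order ; t = 0 ; i = 0 ; s = 0 ; es = [] ; ts = [] ; b = F [] ; τ = 0# ; τ′ = 0# ; v = 0# ; x = 0# ; y = 0#
                ; out = [] ; Q = [] ; pool = [] ; stk = [] ; rem = [] }

    private
      small-initial : ∀ {l} → length l ℕ.≤ 7 → All (ℕ._≤ 2 ℕ.^ B) l →
        Small (state order (l ∷ [] ∷ [] ∷ [] ∷ [] ∷ [] ∷ [] ∷ []) ([] ∷ [] ∷ [] ∷ [] ∷ [] ∷ [] ∷ [] ∷ []) ([] ∷ [] ∷ [] ∷ [] ∷ [] ∷ [] ∷ [] ∷ []))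
      small-initial l≤7 l≤ = within
        (ℕ.≤-trans l≤7 (ℕ.≤-trans 7≤L (ℕ.m≤m+n L 0)) Vec.∷ z≤n Vec.∷ z≤n Vec.∷ z≤n Vec.∷ z≤n Vec.∷ z≤n Vec.∷ z≤n Vec.∷ Vec.[])
        (All.map (λ x≤ → ℕ.≤-trans x≤ (ℕ.^-monoʳ-≤ 2 (ℕ.m≤m+n B 0))) l≤ Vec.∷ [] Vec.∷ [] Vec.∷ [] Vec.∷ [] Vec.∷ [] Vec.∷ [] Vec.∷ Vec.[])
        (z≤n Vec.∷ z≤n Vec.∷ z≤n Vec.∷ z≤n Vec.∷ z≤n Vec.∷ z≤n Vec.∷ z≤n Vec.∷ Vec.[])
        (z≤n Vec.∷ z≤n Vec.∷ z≤n Vec.∷ z≤n Vec.∷ z≤n Vec.∷ z≤n Vec.∷ z≤n Vec.∷ Vec.[])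

    initial-small : Small initial
    initial-small = small-initial (s≤s z≤n) (k≤2^B ∷ [])

    initialise-ok : Good 30 T (while more arrive ∷ ending , ⟪ μ₀ ⟫) z → Good fuel (23 ℕ.+ T) (program ∷ [] , initial) z
    -- Pushing the constant w is not mild, as it may add many bits in one step; the bounds are
    -- therefore verified afresh after it.
    initialise-ok G = block 2 (jump ≡.refl (small-initial (s≤s (s≤s z≤n)) (w≤2^B ∷ k≤2^B ∷ []))
      (block 7 (push-real r-value (block 10 (ask [] 1F ≡.refl ≡.refl (block 1 (weaken (ℕ.m≤m+n 30 10) ℕ.≤-refl ≤-refl G)))))))
      where
      r-value : ⟦ real (lit (suc w)) *ʳ inv (real (lit w)) ⟧ʳ (state order ((0 ∷ 0 ∷ 0 ∷ w ∷ k ∷ []) ∷ [] ∷ [] ∷ [] ∷ [] ∷ [] ∷ [] ∷ []) ([] ∷ [] ∷ [] ∷ [] ∷ [] ∷ [] ∷ [] ∷ []) ([] ∷ [] ∷ [] ∷ [] ∷ [] ∷ [] ∷ [] ∷ [])) ≡ just r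
      r-value rewrite ⌊⌋-false (fromℕ w ≟ 0#) (0<⇒≉0 (fromℕ-pos′ w)) = ≡.refl

    programTime : ℕ
    programTime = 23 ℕ.+ (n ℕ.* arriveCost L w D ℕ.+ suc (suc (finishCost L)))

    program-ok : ∀ O → Unique O → length O ℕ.≤ k → ∀ ζ → 0# ≤ ζ → fromℕ 4 * (fromℕ (suc w) * ζ) + F O ≤ fromℕ w * F O →
      Good fuel programTime (program ∷ [] , initial) ζ
    program-ok O O-unique ∣O∣≤k ζ 0≤ζ ratio = initialise-ok (≡.subst (λ l → Good 30 (l ℕ.* arriveCost L w D ℕ.+ suc (suc (finishCost L))) (while more arrive ∷ ending , ⟪ μ₀ ⟫) ζ) ∣order∣
      (stream-ok order [] μ₀ ≡.refl (Unique-resp-↭ (↭-sym order-↭) (Unique.allFin⁺ n)) (λ _ ()) (λ x → inj₂ (∈-resp-↭ (↭-sym order-↭) (∈-allFin x)))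
        ready (Invariant-initial ≤-refl) λ ps′ μ′ all ready′ ivt → ending-value O O-unique ∣O∣≤k ζ 0≤ζ ratio μ′ ready′ ivt all))
      where
      ∣order∣ : length order ≡ n
      ∣order∣ = ≡.trans (↭-length order-↭) (List.length-tabulate id)
      ready : Ready [] μ₀
      ready = record { ts≡[] = ≡.refl ; Q≡[] = ≡.refl ; pool≡[] = ≡.refl ; stk≡[] = ≡.refl ; rem≡ = ≡.refl ; ∣rem∣≤1 = z≤n
        ; t≤ = z≤n ; i≤ = z≤n ; s≤ = z≤n ; best = ≤-refl , z≤n , z≤n }

    -- Memory, halting and value of all runs

    private
      sum-lengths : ∀ {a} {X : Set a} {b m} {xs : Vec (List X) m} → Vec.All (λ l → length l ℕ.≤ b) xs → sum (map length (toList xs)) ℕ.≤ m ℕ.* b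
      sum-lengths Vec.[]       = z≤n
      sum-lengths (p Vec.∷ ps) = ℕ.+-mono-≤ p (sum-lengths ps)

      bits : ∀ {i e} → i ℕ.≤ 2 ℕ.^ e → 1 ℕ.+ ⌈log₂ suc i ⌉ ℕ.≤ 2 ℕ.+ e
      bits {i} {e} i≤ = s≤s (ℕ.≤-trans (⌈log₂⌉-mono-≤ (ℕ.≤-trans (s≤s i≤) (ℕ.≤-trans (ℕ.+-monoˡ-≤ (2 ℕ.^ e) (ℕ.^-monoʳ-≤ 2 (z≤n {e})))
        (ℕ.≤-reflexive (≡.cong (2 ℕ.^ e ℕ.+_) (≡.sym (ℕ.+-identityʳ (2 ℕ.^ e)))))))) (ℕ.≤-reflexive (⌈log₂2^n⌉≡n (suc e))))

      sum-bits : ∀ {e b} {l : List ℕ} → All (ℕ._≤ 2 ℕ.^ e) l → length l ℕ.≤ b → sum (map (λ i → 1 ℕ.+ ⌈log₂ suc i ⌉) l) ℕ.≤ b ℕ.* (2 ℕ.+ e)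
      sum-bits []       _ = z≤n
      sum-bits (p ∷ ps) (s≤s q) = ℕ.+-mono-≤ (bits p) (sum-bits ps q)

      sum-all-bits : ∀ {e b m} {xs : Vec (List ℕ) m} → Vec.All (All (ℕ._≤ 2 ℕ.^ e)) xs → Vec.All (λ l → length l ℕ.≤ b) xs →
        sum (map (λ l → sum (map (λ i → 1 ℕ.+ ⌈log₂ suc i ⌉) l)) (toList xs)) ℕ.≤ m ℕ.* (b ℕ.* (2 ℕ.+ e))
      sum-all-bits Vec.[]       Vec.[]       = z≤n
      sum-all-bits (p Vec.∷ ps) (q Vec.∷ qs) = ℕ.+-mono-≤ (sum-bits p q) (sum-all-bits ps qs)

    stored-bound : ∀ γ → Within fuel (proj₂ γ) → storedElements γ ℕ.≤ 7 ℕ.* (L ℕ.+ fuel)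
    stored-bound γ W = sum-lengths (Within.elems-length W)

    memory-bound : ∀ γ → Within fuel (proj₂ γ) → memory γ ℕ.≤ 7 ℕ.* (L ℕ.+ fuel) ℕ.* ((2 ℕ.+ (B ℕ.+ fuel)) ℕ.+ 1 ℕ.+ (1 ℕ.+ ⌈log₂ suc n ⌉))
    memory-bound γ W = ℕ.≤-trans (ℕ.+-mono-≤ (ℕ.+-mono-≤
        (ℕ.≤-trans (sum-all-bits {e = B ℕ.+ fuel} (Within.nats-value W) (Within.nats-length W)) (ℕ.≤-reflexive (≡.sym (ℕ.*-assoc 7 (L ℕ.+ fuel) (2 ℕ.+ (B ℕ.+ fuel))))))
        (sum-lengths (Within.reals-length W)))
        (ℕ.*-monoˡ-≤ (1 ℕ.+ ⌈log₂ suc n ⌉) (stored-bound γ W)))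
      (ℕ.≤-reflexive (xp+x+xq (7 ℕ.* (L ℕ.+ fuel)) (2 ℕ.+ (B ℕ.+ fuel)) (1 ℕ.+ ⌈log₂ suc n ⌉)))

    private
      execution : ℕ → Dist Config
      execution t = steps t (program ∷ [] , initial)

      -- Time, memory and feasibility do not depend on the solution used for comparison, so the
      -- empty one with target 0 yields them.
      zero-ok : Good fuel programTime (program ∷ [] , initial) 0#
      zero-ok = program-ok [] [] z≤n 0# ≤-refl (begin
        fromℕ 4 * (fromℕ (suc w) * 0#) + F []    ≈⟨ trans (+-congʳ (trans (*-congˡ (zeroʳ _)) (zeroʳ _))) (+-identityˡ _) ⟩
        F []                                     ≈⟨ *-identityˡ _ ⟨
        1# * F []                                ≤⟨ *-monoʳ-≤ (F-nonNeg []) (≤-trans (≤-reflexive (sym fromℕ-1)) (fromℕ-mono (ℕ.>-nonZero⁻¹ w))) ⟩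
        fromℕ w * F []                           ∎)
        where open ≤-Reasoning

      run-within : ∀ t → Surely (Within fuel ∘ proj₂) (execution t)
      run-within = always-within L≤2^B zero-ok ℕ.≤-refl initial-small

    run-stored : ∀ t → Surely (λ γ → storedElements γ ℕ.≤ 7 ℕ.* (L ℕ.+ 60)) (execution t)
    run-stored t = All.map (λ {(_ , γ)} → stored-bound γ) (run-within t)

    run-memory : ∀ t → Surely (λ γ → memory γ ℕ.≤ 7 ℕ.* (L ℕ.+ 60) ℕ.* ((2 ℕ.+ (B ℕ.+ 60)) ℕ.+ 1 ℕ.+ (1 ℕ.+ ⌈log₂ suc n ⌉))) (execution t)
    run-memory t = All.map (λ {(_ , γ)} → memory-bound γ) (run-within t)

    run-halts : ∀ t → programTime ℕ.≤ t → Surely Halted (execution t)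
    run-halts = halts zero-ok

    run-feasible : ∀ t → Surely Halted (execution t) → Surely (Feasible ∘ output) (execution t)
    run-feasible = finals zero-ok

    run-value : ∀ t → Surely Halted (execution t) → ∀ OPT → Feasible OPT → ∀ ζ → 0# ≤ ζ →
      fromℕ 4 * (fromℕ (suc w) * ζ) + f OPT ≤ fromℕ w * f OPT → ζ ≤ expect (f ∘ output) (execution t)
    run-value t halted OPT feasible ζ 0≤ζ ratio = value (program-ok (elements OPT) (elements-unique OPT)
      (ℕ.≤-trans (ℕ.≤-reflexive (length-elements OPT)) feasible) ζ 0≤ζ
      (≤-trans (≤-reflexive (+-congˡ F≈)) (≤-trans ratio (≤-reflexive (*-congˡ (sym F≈)))))) t halted
      where
      F≈ : F (elements OPT) ≈ f OPT
      F≈ = trans (F≈f (elements OPT)) (reflexive (≡.cong f (toSet-elements OPT)))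

module _ where
  open import Data.Nat using (_+_; _*_; _^_; _≤_)

  n≤2^n : ∀ n → n ≤ 2 ^ n
  n≤2^n zero    = z≤n
  n≤2^n (suc n) = ℕ.≤-trans (ℕ.+-mono-≤ (ℕ.^-monoʳ-≤ 2 (z≤n {n})) (n≤2^n n)) (ℕ.≤-reflexive (≡.cong (2 ^ n +_) (≡.sym (ℕ.+-identityʳ (2 ^ n)))))

  1≤⌈log₂suc⌉ : ∀ k .{{_ : NonZero k}} → 1 ≤ ⌈log₂ suc k ⌉
  1≤⌈log₂suc⌉ (suc k) = ⌈log₂⌉-mono-≤ {2} {suc (suc k)} (s≤s (s≤s z≤n))

-- Resource bounds

module Result {c ℓ₁ ℓ₂} (𝕂 : OrderedField c ℓ₁ ℓ₂) (w : ℕ) {{w≢0 : NonZero w}} where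
  open OrderedField 𝕂 hiding (zero)
  open OrderedFieldProperties 𝕂 hiding (_^_)
  open Streaming 𝕂

  algorithm : Algorithm
  algorithm = record { arrays = 6 ; program = Program.program w }

  module _ (I : Instance) where
    open Instance I

    -- The constant 8 in L covers the registers and one entry being inserted. B is crude, but 2^B
    -- dominates k, L, w and D w, and B remains logarithmic in k.
    ℓ D L B : ℕ
    ℓ = ⌈log₂ suc k ⌉
    D = groupCount k w
    L = 8 ℕ.+ D ℕ.* w ℕ.* (k ℕ.⊓ n)
    B = ℓ ℕ.+ (D ℕ.* w ℕ.+ (w ℕ.+ 8))

    private
      2^-≤ : ∀ {i} → i ℕ.≤ B → 2 ℕ.^ i ℕ.≤ 2 ℕ.^ B
      2^-≤ = ℕ.^-monoʳ-≤ 2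

      k≤2^ℓ : k ℕ.≤ 2 ℕ.^ ℓ
      k≤2^ℓ = ℕ.≤-trans (ℕ.n≤1+n k) (n≤2^⌈log₂n⌉ (suc k))

      L≤2^B : L ℕ.≤ 2 ℕ.^ B
      L≤2^B = begin
        8 ℕ.+ D ℕ.* w ℕ.* (k ℕ.⊓ n)                   ≤⟨ ℕ.+-mono-≤ (ℕ.m≤m*n 8 k {{k≢0}}) (ℕ.*-monoʳ-≤ (D ℕ.* w) (ℕ.m⊓n≤m k n)) ⟩
        8 ℕ.* k ℕ.+ D ℕ.* w ℕ.* k                     ≡⟨ ℕ.*-distribʳ-+ k 8 (D ℕ.* w) ⟨
        (8 ℕ.+ D ℕ.* w) ℕ.* k                         ≤⟨ ℕ.*-mono-≤ (n≤2^n (8 ℕ.+ D ℕ.* w)) k≤2^ℓ ⟩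
        2 ℕ.^ (8 ℕ.+ D ℕ.* w) ℕ.* 2 ℕ.^ ℓ             ≡⟨ ℕ.^-distribˡ-+-* 2 (8 ℕ.+ D ℕ.* w) ℓ ⟨
        2 ℕ.^ (8 ℕ.+ D ℕ.* w ℕ.+ ℓ)                   ≤⟨ 2^-≤ (ℕ.≤-trans (ℕ.≤-reflexive (ℕ.+-comm _ ℓ)) (ℕ.+-monoʳ-≤ ℓ (ℕ.≤-trans (ℕ.≤-reflexive (ℕ.+-comm 8 _)) (ℕ.+-monoʳ-≤ (D ℕ.* w) (ℕ.m≤n+m 8 w))))) ⟩
        2 ℕ.^ B                                       ∎
        where open ℕ.≤-Reasoning

      w≤2^B : w ℕ.≤ 2 ℕ.^ B
      w≤2^B = ℕ.≤-trans (n≤2^n w) (2^-≤ (ℕ.≤-trans (ℕ.m≤m+n w 8) (ℕ.≤-trans (ℕ.m≤n+m _ (D ℕ.* w)) (ℕ.m≤n+m _ ℓ))))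

      k≤2^B : k ℕ.≤ 2 ℕ.^ B
      k≤2^B = ℕ.≤-trans k≤2^ℓ (2^-≤ (ℕ.m≤m+n ℓ _))

      Dw≤2^B : D ℕ.* w ℕ.≤ 2 ℕ.^ B
      Dw≤2^B = ℕ.≤-trans (n≤2^n (D ℕ.* w)) (2^-≤ (ℕ.≤-trans (ℕ.m≤m+n (D ℕ.* w) _) (ℕ.m≤n+m _ ℓ)))

    sizes : Sizes k n
    sizes = record { w = w ; L = L ; B = B ; L≤2^B = L≤2^B ; 7≤L = ℕ.m≤m+n 7 _ ; w≤2^B = w≤2^B ; k≤2^B = k≤2^B
                   ; Dw≤2^B = Dw≤2^B ; entries≤L = ℕ.m≤n+m _ 7 }

  -- The hypothesis amounts to 4 (w + 1) ≤ (w - 1) β, which is what the target ζ = f(OPT)/β has to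
  -- satisfy.
  approximation : ∀ β → 0# < β → fromℕ 4 * fromℕ (suc w) + β ≤ fromℕ w * β → ApproximationRatio algorithm β
  approximation β 0<β ratio I t halted = Execution.run-feasible I (sizes I) t halted ,
    λ OPT (feasible , _) → Execution.run-value I (sizes I) t halted OPT feasible (f OPT * β ⁻¹) (*-nonNeg (nonNegative OPT) (⁻¹-nonNeg 0<β)) (bound OPT)
    where
    open Instance I
    open ≤-Reasoning
    bound : ∀ OPT → fromℕ 4 * (fromℕ (suc w) * (f OPT * β ⁻¹)) + f OPT ≤ fromℕ w * f OPT
    bound OPT = begin
      fromℕ 4 * (fromℕ (suc w) * (f OPT * β ⁻¹)) + f OPT        ≈⟨ +-congˡ (unit OPT) ⟨
      fromℕ 4 * (fromℕ (suc w) * (f OPT * β ⁻¹)) + f OPT * β ⁻¹ * β ≈⟨ solve 4 (λ a b x y → a :* (b :* x) :+ x :* y := (a :* b :+ y) :* x) refl (fromℕ 4) (fromℕ (suc w)) (f OPT * β ⁻¹) β ⟩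
      (fromℕ 4 * fromℕ (suc w) + β) * (f OPT * β ⁻¹)            ≤⟨ *-monoʳ-≤ (*-nonNeg (nonNegative OPT) (⁻¹-nonNeg 0<β)) ratio ⟩
      fromℕ w * β * (f OPT * β ⁻¹)                              ≈⟨ solve 3 (λ a b x → a :* b :* x := a :* (x :* b)) refl (fromℕ w) β (f OPT * β ⁻¹) ⟩
      fromℕ w * (f OPT * β ⁻¹ * β)                              ≈⟨ *-congˡ (unit OPT) ⟩
      fromℕ w * f OPT                                           ∎
      where
      unit : ∀ OPT → f OPT * β ⁻¹ * β ≈ f OPT
      unit OPT = trans (*-assoc _ _ _) (trans (*-congˡ (⁻¹-inverseˡ 0<β)) (*-identityʳ _))

  private
    -- There are 7 arrays of elements, and 68 is the constant part 8 of L plus the 60 steps of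
    -- slack.
    c₁ : ℕ
    c₁ = 7 ℕ.* (68 ℕ.+ w ℕ.* w)

  storage : ∀ I → 7 ℕ.* (L I ℕ.+ 60) ℕ.≤ c₁ ℕ.* (Instance.k I ℕ.* ℓ I)
  storage I = ℕ.≤-trans (ℕ.*-monoʳ-≤ 7 (begin
    L I ℕ.+ 60                                       ≤⟨ ℕ.+-monoˡ-≤ 60 (ℕ.+-monoʳ-≤ 8 (ℕ.*-monoʳ-≤ (D I ℕ.* w) (ℕ.m⊓n≤m k n))) ⟩
    8 ℕ.+ D I ℕ.* w ℕ.* k ℕ.+ 60                     ≡⟨ ≡.cong (λ d → 8 ℕ.+ d ℕ.* w ℕ.* k ℕ.+ 60) (groupCount≡ k w) ⟩
    8 ℕ.+ ℓ I ℕ.* w ℕ.* w ℕ.* k ℕ.+ 60               ≡⟨ lemma (ℓ I) w k ⟩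
    68 ℕ.* 1 ℕ.+ w ℕ.* w ℕ.* (k ℕ.* ℓ I)             ≤⟨ ℕ.+-monoˡ-≤ (w ℕ.* w ℕ.* (k ℕ.* ℓ I)) (ℕ.*-monoʳ-≤ 68 (ℕ.*-mono-≤ (ℕ.>-nonZero⁻¹ k {{k≢0}}) (1≤⌈log₂suc⌉ k {{k≢0}}))) ⟩
    68 ℕ.* (k ℕ.* ℓ I) ℕ.+ w ℕ.* w ℕ.* (k ℕ.* ℓ I)   ≡⟨ ℕ.*-distribʳ-+ (k ℕ.* ℓ I) 68 (w ℕ.* w) ⟨
    (68 ℕ.+ w ℕ.* w) ℕ.* (k ℕ.* ℓ I)                 ∎)) (ℕ.≤-reflexive (≡.sym (ℕ.*-assoc 7 (68 ℕ.+ w ℕ.* w) (k ℕ.* ℓ I))))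
    where
    open Instance I
    open ℕ.≤-Reasoning
    lemma : ∀ l w k → 8 ℕ.+ l ℕ.* w ℕ.* w ℕ.* k ℕ.+ 60 ≡ 68 ℕ.* 1 ℕ.+ w ℕ.* w ℕ.* (k ℕ.* l)
    lemma = solve-∀

  stores : Stores-O[klogk]-Elements algorithm
  stores = c₁ , λ I t → All.map (λ p → ℕ.≤-trans p (storage I)) (Execution.run-stored I (sizes I) t)

  -- One logarithmic factor comes from the number of entries, the other from their bit length.
  semiStreaming : SemiStreaming algorithm
  semiStreaming = c₁ ℕ.* (w ℕ.* w ℕ.+ w ℕ.+ 73) , 2 , λ I t → All.map (λ p → ℕ.≤-trans p (bound I)) (Execution.run-memory I (sizes I) t)
    where
    bound : ∀ I → (let open Instance I) → 7 ℕ.* (L I ℕ.+ 60) ℕ.* ((2 ℕ.+ (B I ℕ.+ 60)) ℕ.+ 1 ℕ.+ (1 ℕ.+ ⌈log₂ suc n ⌉))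
      ℕ.≤ c₁ ℕ.* (w ℕ.* w ℕ.+ w ℕ.+ 73) ℕ.* (k ℕ.* (ℓ I ℕ.+ ⌈log₂ suc n ⌉) ℕ.^ 2)
    bound I = begin
      7 ℕ.* (L I ℕ.+ 60) ℕ.* ((2 ℕ.+ (B I ℕ.+ 60)) ℕ.+ 1 ℕ.+ (1 ℕ.+ e))          ≤⟨ ℕ.*-mono-≤ (storage I) factor ⟩
      c₁ ℕ.* (k ℕ.* ℓ I) ℕ.* ((w ℕ.* w ℕ.+ w ℕ.+ 73) ℕ.* (ℓ I ℕ.+ e))            ≤⟨ ℕ.*-monoˡ-≤ ((w ℕ.* w ℕ.+ w ℕ.+ 73) ℕ.* (ℓ I ℕ.+ e)) (ℕ.*-monoʳ-≤ c₁ (ℕ.*-monoʳ-≤ k (ℕ.m≤m+n (ℓ I) e))) ⟩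
      c₁ ℕ.* (k ℕ.* (ℓ I ℕ.+ e)) ℕ.* ((w ℕ.* w ℕ.+ w ℕ.+ 73) ℕ.* (ℓ I ℕ.+ e))    ≡⟨ lemma₂ c₁ k (ℓ I ℕ.+ e) (w ℕ.* w ℕ.+ w ℕ.+ 73) ⟩
      c₁ ℕ.* (w ℕ.* w ℕ.+ w ℕ.+ 73) ℕ.* (k ℕ.* (ℓ I ℕ.+ e) ℕ.^ 2)                ∎
      where
      open Instance I
      open ℕ.≤-Reasoning
      e = ⌈log₂ suc n ⌉
      lemma₂ : ∀ c k x y → c ℕ.* (k ℕ.* x) ℕ.* (y ℕ.* x) ≡ c ℕ.* y ℕ.* (k ℕ.* (x ℕ.* (x ℕ.* 1)))
      lemma₂ = solve-∀
      lemma₁ : ∀ l w e → 2 ℕ.+ (l ℕ.+ (l ℕ.* w ℕ.* w ℕ.+ (w ℕ.+ 8)) ℕ.+ 60) ℕ.+ 1 ℕ.+ (1 ℕ.+ e) ≡ w ℕ.* w ℕ.* l ℕ.+ (w ℕ.+ 72) ℕ.* 1 ℕ.+ (l ℕ.+ e)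
      lemma₁ = solve-∀
      lemma₃ : ∀ l w → w ℕ.* w ℕ.* l ℕ.+ (w ℕ.+ 72) ℕ.* l ℕ.+ l ≡ (w ℕ.* w ℕ.+ w ℕ.+ 73) ℕ.* l
      lemma₃ = solve-∀
      factor : (2 ℕ.+ (B I ℕ.+ 60)) ℕ.+ 1 ℕ.+ (1 ℕ.+ e) ℕ.≤ (w ℕ.* w ℕ.+ w ℕ.+ 73) ℕ.* (ℓ I ℕ.+ e)
      factor = begin
        (2 ℕ.+ (B I ℕ.+ 60)) ℕ.+ 1 ℕ.+ (1 ℕ.+ e)        ≡⟨ ≡.cong (λ d → 2 ℕ.+ (ℓ I ℕ.+ (d ℕ.* w ℕ.+ (w ℕ.+ 8)) ℕ.+ 60) ℕ.+ 1 ℕ.+ (1 ℕ.+ e)) (groupCount≡ k w) ⟩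
        2 ℕ.+ (ℓ I ℕ.+ (ℓ I ℕ.* w ℕ.* w ℕ.+ (w ℕ.+ 8)) ℕ.+ 60) ℕ.+ 1 ℕ.+ (1 ℕ.+ e) ≡⟨ lemma₁ (ℓ I) w e ⟩
        w ℕ.* w ℕ.* ℓ I ℕ.+ (w ℕ.+ 72) ℕ.* 1 ℕ.+ (ℓ I ℕ.+ e) ≤⟨ ℕ.+-monoˡ-≤ (ℓ I ℕ.+ e) (ℕ.+-mono-≤ (ℕ.*-monoʳ-≤ (w ℕ.* w) (ℕ.m≤m+n (ℓ I) e)) (ℕ.*-monoʳ-≤ (w ℕ.+ 72) (ℕ.≤-trans (1≤⌈log₂suc⌉ k {{k≢0}}) (ℕ.m≤m+n (ℓ I) e)))) ⟩
        w ℕ.* w ℕ.* (ℓ I ℕ.+ e) ℕ.+ (w ℕ.+ 72) ℕ.* (ℓ I ℕ.+ e) ℕ.+ (ℓ I ℕ.+ e) ≡⟨ lemma₃ (ℓ I ℕ.+ e) w ⟩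
        (w ℕ.* w ℕ.+ w ℕ.+ 73) ℕ.* (ℓ I ℕ.+ e)          ∎

  size : Instance → ℕ
  size I = 1 ℕ.+ Instance.n I ℕ.+ ℓ I

  -- Closure under sums and products builds the time bound without computing its degree.
  Polynomial : (Instance → ℕ) → Set (c ⊔ ℓ₂)
  Polynomial T = ∃[ C ] ∃[ d ] ∀ I → T I ℕ.≤ C ℕ.* size I ℕ.^ d

  private
    raise : ∀ I {d d′} → d ℕ.≤ d′ → size I ℕ.^ d ℕ.≤ size I ℕ.^ d′
    raise I = ℕ.^-monoʳ-≤ (size I)

  poly-≤ : ∀ {S T} → (∀ I → S I ℕ.≤ T I) → Polynomial T → Polynomial S
  poly-≤ S≤T (C , d , T≤) = C , d , λ I → ℕ.≤-trans (S≤T I) (T≤ I)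

  poly-const : ∀ a → Polynomial (λ _ → a)
  poly-const a = a , 0 , λ I → ℕ.≤-reflexive (≡.sym (ℕ.*-identityʳ a))

  poly-size : Polynomial size
  poly-size = 1 , 1 , λ I → ℕ.≤-reflexive (≡.sym (≡.trans (ℕ.*-identityˡ _) (ℕ.*-identityʳ _)))

  poly-n : Polynomial Instance.n
  poly-n = poly-≤ (λ I → ℕ.≤-trans (ℕ.n≤1+n _) (ℕ.m≤m+n _ _)) poly-size

  poly-+ : ∀ {S T} → Polynomial S → Polynomial T → Polynomial (λ I → S I ℕ.+ T I)
  poly-+ (C , d , S≤) (C′ , d′ , T≤) = C ℕ.+ C′ , d ℕ.+ d′ , λ I → ℕ.≤-trans
    (ℕ.+-mono-≤ (ℕ.≤-trans (S≤ I) (ℕ.*-monoʳ-≤ C (raise I (ℕ.m≤m+n d d′)))) (ℕ.≤-trans (T≤ I) (ℕ.*-monoʳ-≤ C′ (raise I (ℕ.m≤n+m d′ d)))))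
    (ℕ.≤-reflexive (≡.sym (ℕ.*-distribʳ-+ (size I ℕ.^ (d ℕ.+ d′)) C C′)))

  poly-* : ∀ {S T} → Polynomial S → Polynomial T → Polynomial (λ I → S I ℕ.* T I)
  poly-* (C , d , S≤) (C′ , d′ , T≤) = C ℕ.* C′ , d ℕ.+ d′ , λ I → ℕ.≤-trans (ℕ.*-mono-≤ (S≤ I) (T≤ I))
    (ℕ.≤-reflexive (≡.trans (ℕ.[m*n]*[o*p]≡[m*o]*[n*p] C (size I ℕ.^ d) C′ (size I ℕ.^ d′)) (≡.cong (C ℕ.* C′ ℕ.*_) (≡.sym (ℕ.^-distribˡ-+-* (size I) d d′)))))

  poly-D : Polynomial D
  poly-D = poly-≤ (λ I → ℕ.≤-trans (ℕ.≤-reflexive (groupCount≡ (Instance.k I) w)) (ℕ.*-monoˡ-≤ w (ℕ.m≤n+m (ℓ I) (1 ℕ.+ Instance.n I)))) (poly-* poly-size (poly-const w))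

  -- This is where min(k, n) matters: it is at most n, whereas k may be exponential in its bit
  -- length.
  poly-L : Polynomial L
  poly-L = poly-+ (poly-const 8) (poly-* (poly-* poly-D (poly-const w)) (poly-≤ (λ I → ℕ.m⊓n≤n (Instance.k I) (Instance.n I)) poly-n))

  opaque
    unfolding arriveCost finishCost

    poly-time : Polynomial (λ I → Execution.programTime I (sizes I))
    poly-time = poly-+ (poly-const 23) (poly-+ (poly-* poly-n arrivals) (poly-+ (poly-const 2) finishing))
      where
      lin : ∀ a b → Polynomial (λ I → a ℕ.+ L I ℕ.* b)
      lin a b = poly-+ (poly-const a) (poly-* poly-L (poly-const b))
      arrivals : Polynomial (λ I → arriveCost (L I) w (D I))
      arrivals = poly-+ (poly-+ (lin 33 12) (poly-+ (lin 13 21) (poly-* poly-D (poly-const 4))))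
        (poly-* poly-D (poly-+ (poly-* (poly-const w) (lin 36 33)) (poly-const 8)))
      finishing : Polynomial (λ I → finishCost (L I))
      finishing = poly-+ (lin 30 20) (poly-* poly-L (poly-+ (poly-* poly-L (lin 36 39)) (lin 8 4)))

  polynomialTime : PolynomialTime algorithm
  polynomialTime with poly-time
  ... | C , d , T≤ = C , d , λ I → Execution.run-halts I (sizes I) _ (T≤ I)

module _ {c ℓ₁ ℓ₂} (𝕂 : OrderedField c ℓ₁ ℓ₂) where
  open OrderedField 𝕂 hiding (zero)
  open OrderedFieldProperties 𝕂 hiding (_^_)

  fraction-≤ : ∀ a b c d .{{_ : NonZero b}} .{{_ : NonZero d}} → a ℕ.* d ℕ.≤ c ℕ.* b → fromℕ a * fromℕ b ⁻¹ ≤ fromℕ c * fromℕ d ⁻¹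
  fraction-≤ a b@(suc b′) c d@(suc d′) ad≤cb = *-cancelˡ-≤ (*-pos (fromℕ-pos b′) (fromℕ-pos d′)) (begin
    (fromℕ b * fromℕ d) * (fromℕ a * fromℕ b ⁻¹)  ≈⟨ solve 4 (λ x y z t → (x :* y) :* (z :* t) := (t :* x) :* (z :* y)) refl (fromℕ b) (fromℕ d) (fromℕ a) (fromℕ b ⁻¹) ⟩
    (fromℕ b ⁻¹ * fromℕ b) * (fromℕ a * fromℕ d)  ≈⟨ trans (*-congʳ (⁻¹-inverseˡ (fromℕ-pos b′))) (*-identityˡ _) ⟩
    fromℕ a * fromℕ d                             ≈⟨ fromℕ-* a d ⟨
    fromℕ (a ℕ.* d)                               ≤⟨ fromℕ-mono ad≤cb ⟩
    fromℕ (c ℕ.* b)                               ≈⟨ fromℕ-* c b ⟩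
    fromℕ c * fromℕ b                             ≈⟨ trans (*-congʳ (⁻¹-inverseˡ (fromℕ-pos d′))) (*-identityˡ _) ⟨
    (fromℕ d ⁻¹ * fromℕ d) * (fromℕ c * fromℕ b)  ≈⟨ solve 4 (λ x y z t → (t :* y) :* (z :* x) := (x :* y) :* (z :* t)) refl (fromℕ b) (fromℕ d) (fromℕ c) (fromℕ d ⁻¹) ⟩
    (fromℕ b * fromℕ d) * (fromℕ c * fromℕ d ⁻¹)  ∎)
    where open ≤-Reasoning

  fraction-pos : ∀ a b .{{_ : NonZero a}} .{{_ : NonZero b}} → 0# < fromℕ a * fromℕ b ⁻¹
  fraction-pos (suc a) b@(suc b′) = *-pos (fromℕ-pos a) λ b⁻¹≤0 → 0<1 (≤-trans
    (≤-reflexive (sym (⁻¹-inverse (fromℕ b) (0<⇒≉0 (fromℕ-pos b′))))) (≤-trans (*-monoˡ-≤ (fromℕ-nonNeg b) b⁻¹≤0) (≤-reflexive (zeroʳ _))))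

  -- The condition of `approximation` for w + 2 sets, met with equality by 4 (w + 3)/(w + 1); the
  -- shift by 2 keeps the denominator positive.
  ratio : ∀ w → (let β = fromℕ (4 ℕ.* suc (suc (suc w))) * fromℕ (suc w) ⁻¹) →
    fromℕ 4 * fromℕ (suc (suc (suc w))) + β ≤ fromℕ (suc (suc w)) * β
  ratio w = ≤-reflexive (begin-equality
    fromℕ 4 * N + β                       ≈⟨ +-congʳ (fromℕ-* 4 (suc (suc (suc w)))) ⟨
    a + β                                 ≈⟨ +-congʳ (trans (*-congˡ (⁻¹-inverseˡ (fromℕ-pos w))) (*-identityʳ a)) ⟨
    a * (fromℕ (suc w) ⁻¹ * fromℕ (suc w)) + a * fromℕ (suc w) ⁻¹ ≈⟨ solve 3 (λ a i m → a :* (i :* m) :+ a :* i := (con 1 :+ m) :* (a :* i)) refl a (fromℕ (suc w) ⁻¹) (fromℕ (suc w)) ⟩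
    fromℕ (suc (suc w)) * β               ∎)
    where
    open ≤-Reasoning
    N = fromℕ (suc (suc (suc w)))
    a = fromℕ (4 ℕ.* suc (suc (suc w)))
    β = a * fromℕ (suc w) ⁻¹

theoremC1 : ∀ {c ℓ₁ ℓ₂} (𝕂 : OrderedField c ℓ₁ ℓ₂) →
    let open OrderedField 𝕂
        open Streaming 𝕂
    in ∃[ alg ]
         PolynomialTime alg
         × SemiStreaming alg
         × (∃[ β ] 0# < β × β ≤ fromℕ 42819 * fromℕ 10000 ⁻¹ × ApproximationRatio alg β)
         × Stores-O[klogk]-Elements alg
-- Any number of sets from 30 on meets the bound; 32 sets give 4 · 33/31.
theoremC1 𝕂 = algorithm , polynomialTime , semiStreaming ,
  (_ , fraction-pos 𝕂 132 31 , fraction-≤ 𝕂 132 31 42819 10000 (ℕ.≤ᵇ⇒≤ (132 ℕ.* 10000) (42819 ℕ.* 31) _) ,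
    approximation _ (fraction-pos 𝕂 132 31) (ratio 𝕂 30)) , stores
  where open Result 𝕂 32
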